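{- Let $r\ge 4$ be an integer, let $G$ be a graph with $t=\chi_{\mathrm f}(G)\ge 2$, let $\mathcal K$ be a $(<r)$-cycle clique cover of $G$, and let $p\in(0,1)$. Suppose that $b=b(\mathcal K)<\infty$ and that, for some $D\ge 0$ and $0<\xi<1/(2t)$, $$\sum_{K\in\mathcal K}\sum_{v\in V(K)}\Pr(Z_{K,v}>D)\le \xi .$$ Then $$h_r^{\mathrm f}(G)\ge \frac{t}{(bD+1)\bigl(8\log_{1/(1-p)}(2et)+4\bigr)}.$$ In particular, along any sequence of triples $(G,p,D)$ with $p\in(0,1)$ and $D\ge 0$, each with a $(<r)$-cycle clique cover $\mathcal K$ of $G$ with $b=b(\mathcal K)<\infty$ and a number $0<\xi<1/(2t)$ satisfying $\sum_{K\in\mathcal K}\sum_{v\in V(K)}\Pr(Z_{K,v}>D)\le \xi$, and with $t=\chi_{\mathrm f}(G)\to\infty$, if $$bD+1=o\left(\frac{pt}{\log t}\right),$$ then $h_r^{\mathrm f}(G)\to\infty$.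
   Context: All graphs are finite and simple; subgraphs need not be induced. $\chi_{\mathrm f}$ is the fractional chromatic number; $e$ in $2et$ is Euler's number; $\log$ is natural unless a base is displayed. The girth of a forest is $\infty$. $h_r^{\mathrm f}(G)=\max\{\chi_{\mathrm f}(H):H\subseteq G,\ \operatorname{girth}(H)\ge r\}$. A family $\mathcal K$ of cliques (complete subgraphs) of $G$ is a $(<r)$-cycle clique cover if every cycle of $G$ of length less than $r$ is contained in some member of $\mathcal K$. Its local overlap is $b(\mathcal K)=\max_{v\in V(G)}|\{K\in\mathcal K: v\in V(K)\}|$. For $K\in\mathcal K$ and $v\in V(K)$, $Z_{K,v}$ is the number of cycles of length less than $r$ containing $v$ in $K[p]$, the random spanning subgraph of $K$ obtained by retaining each edge independently with probability $p$. -}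

module Defs where

open import Level using (0ℓ)
open import Axiom.ExcludedMiddle using (ExcludedMiddle)
open import Algebra.Bundles using (CommutativeRing; Semiring)
open import Algebra.Structures using (IsCommutativeRing)
open import Data.Fin as Fin using (Fin; toℕ)
open import Data.Fin.Subset using (Subset; inside; outside; _∈_; _⊆_; _∩_; _─_; ∣_∣; ⊤)
open import Data.Fin.Subset.Properties using (p∩q⊆p; ∈⊤)
open import Data.List.Base using (List; []; _∷_; _++_; map; foldr; filter; length; allFin; upTo)
open import Data.List.Membership.Propositional using () renaming (_∈_ to _∈ˡ_)
open import Data.List.Relation.Unary.Unique.Propositional using (Unique)
open import Data.Nat as ℕ using (ℕ; zero; suc)
open import Data.Nat.Base using (_!)
open import Data.Product using (Σ; ∃; ∃-syntax; _×_; _,_; proj₁; proj₂)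
open import Data.Sum using (_⊎_)
open import Data.Vec.Base using ([]; _∷_)
open import Function.Bundles using (_⇔_)
open import Function.Definitions using (Injective)
open import Relation.Binary.Core using (Rel)
open import Relation.Binary.Structures using (IsTotalOrder)
open import Relation.Binary.PropositionalEquality using (_≡_; _≢_)
open import Relation.Binary.Construct.Add.Supremum.NonStrict ℕ._≤_ using (_≤⁺_)
open import Relation.Nullary using (¬_; yes; no)
open import Relation.Nullary.Construct.Add.Supremum using (_⁺; ⊤⁺; [_])
import Algebra.Definitions.RawSemiring as RawSemiringDefs
import Relation.Binary.Construct.NonStrictToStrict as NonStrictToStrict

subsets : ∀ k → List (Subset k)
subsets zero    = [] ∷ []
subsets (suc k) = map (outside ∷_) (subsets k) ++ map (inside ∷_) (subsets k)

HasCardinality : {A : Set} → (A → Set) → ℕ → Set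
HasCardinality {A} P c =
  ∃[ xs ] Unique xs × length xs ≡ c × (∀ (x : A) → x ∈ˡ xs ⇔ P x)

-- A finite simple graph on the vertices Fin order, with its edges numbered by
-- Fin size. Listing the ends of each edge in increasing order excludes loops,
-- and injectivity excludes parallel edges.
record Graph : Set where
  field
    order           : ℕ
    size            : ℕ
    ends            : Fin size → Fin order × Fin order
    ends-increasing : ∀ e → proj₁ (ends e) Fin.< proj₂ (ends e)
    ends-injective  : Injective _≡_ _≡_ ends

  Joins : Fin size → Fin order → Fin order → Set
  Joins e u v = ends e ≡ (u , v) ⊎ ends e ≡ (v , u)

open Graph public

record Subgraph (G : Graph) : Set where
  field
    V : Subset (order G)
    E : Subset (size G)
    ends-in-V : ∀ {e} → e ∈ E → proj₁ (ends G e) ∈ V × proj₂ (ends G e) ∈ V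

open Subgraph public

module _ {G : Graph} where

  whole : Subgraph G
  whole = record { V = ⊤ ; E = ⊤ ; ends-in-V = λ _ → ∈⊤ , ∈⊤ }

  -- The spanning subgraph of H whose edges are the edges of H lying in ω.
  _↾_ : Subgraph G → Subset (size G) → Subgraph G
  H ↾ ω = record
    { V = V H ; E = E H ∩ ω
    ; ends-in-V = λ e∈ → ends-in-V H (p∩q⊆p (E H) ω e∈) }

  Complete : Subgraph G → Set
  Complete K = ∀ {u v} → u ∈ V K → v ∈ V K → u ≢ v → ∃[ e ] e ∈ E K × Joins G e u v

  Independent : Subgraph G → Subset (order G) → Set
  Independent H I =
    I ⊆ V H × (∀ {e} → e ∈ E H → ¬ (proj₁ (ends G e) ∈ I × proj₂ (ends G e) ∈ I))

Clique : Graph → Set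
Clique G = Σ (Subgraph G) Complete

-- j follows i in the cyclic order on Fin k.
Consecutive : ∀ {k} → Fin k → Fin k → Set
Consecutive {k} i j =
  toℕ j ≡ suc (toℕ i) ⊎ (suc (toℕ i) ≡ k × toℕ j ≡ 0)

-- A cycle has no isolated vertices, so it is identified with its edge set:
-- cycles are counted as subgraphs, not as vertex sequences.
IsCycle : (G : Graph) → Subset (size G) → ℕ → Set
IsCycle G F k = 3 ℕ.≤ k × ∃[ c ]
    Injective {A = Fin k} {B = Fin (order G)} _≡_ _≡_ c
  × (∀ i j → Consecutive i j → ∃[ e ] e ∈ F × Joins G e (c i) (c j))
  × (∀ e → e ∈ F → ∃[ i ] ∃[ j ] Consecutive i j × Joins G e (c i) (c j))

HasCycle : {G : Graph} → Subgraph G → ℕ → Set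
HasCycle {G} H k = ∃[ F ] F ⊆ E H × IsCycle G F k

OnEdges : (G : Graph) → Fin (order G) → Subset (size G) → Set
OnEdges G v F = ∃[ e ] e ∈ F × (proj₁ (ends G e) ≡ v ⊎ proj₂ (ends G e) ≡ v)

module _ {G : Graph} {I : Set} (𝒦 : I → Clique G) where

  -- Cliques may repeat in the family, and I may be infinite.
  IsCycleCliqueCover : ℕ → Set
  IsCycleCliqueCover r =
    ∀ F k → IsCycle G F k → k ℕ.< r → ∃[ i ] F ⊆ E (proj₁ (𝒦 i))

  -- b(𝒦) is finite and equal to b.
  IsLocalOverlap : ℕ → Set
  IsLocalOverlap b =
      (∀ v → ∃[ c ] HasCardinality (λ i → v ∈ V (proj₁ (𝒦 i))) c × c ℕ.≤ b)
    × (∃[ v ] HasCardinality (λ i → v ∈ V (proj₁ (𝒦 i))) b)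

-- The axioms of the real numbers. Division is total: the value of 0# ⁻¹ is
-- not specified.
record CompleteOrderedField : Set₁ where
  infix  4 _≈_ _≤_
  infixl 6 _+_
  infixl 7 _*_
  infix  8 -_ _⁻¹
  field
    Carrier           : Set
    _≈_ _≤_           : Rel Carrier 0ℓ
    _+_ _*_           : Carrier → Carrier → Carrier
    -_ _⁻¹            : Carrier → Carrier
    0# 1#             : Carrier
    isCommutativeRing : IsCommutativeRing _≈_ _+_ _*_ -_ 0# 1#
    ⁻¹-cong           : ∀ {x y} → x ≈ y → x ⁻¹ ≈ y ⁻¹
    ⁻¹-inverseʳ       : ∀ x → ¬ x ≈ 0# → x * x ⁻¹ ≈ 1#
    0≉1               : ¬ 0# ≈ 1#
    isTotalOrder      : IsTotalOrder _≈_ _≤_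
    +-monoˡ-≤         : ∀ z {x y} → x ≤ y → x + z ≤ y + z
    *-nonneg          : ∀ {x y} → 0# ≤ x → 0# ≤ y → 0# ≤ x * y
    complete          : ∀ (P : Carrier → Set) → ∃ P → ∃[ u ] (∀ x → P x → x ≤ u) →
                        ∃[ s ] (∀ x → P x → x ≤ s)
                             × (∀ u → (∀ x → P x → x ≤ u) → s ≤ u)

  commutativeRing : CommutativeRing 0ℓ 0ℓ
  commutativeRing = record { isCommutativeRing = isCommutativeRing }

-- Excluded middle is the classical logic of the ambient mathematics. It allows
-- arbitrary properties to be used as events and as conditions in finite sums,
-- and objects to be named by a description.
module Classical (em : ExcludedMiddle 0ℓ) where

  select : {A : Set} → (A → Set) → List A → List A
  select P = filter (λ x → em {P x})

  girth : {G : Graph} → Subgraph G → ℕ ⁺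
  girth H with em {∃[ k ] HasCycle H k × (∀ l → HasCycle H l → k ℕ.≤ l)}
  ... | yes (k , _) = [ k ]
  ... | no  _       = ⊤⁺

  shortCyclesThrough : {G : Graph} → ℕ → Subgraph G → Fin (order G) → ℕ
  shortCyclesThrough {G} r H v = length (select ShortCycle (subsets (size G)))
    where
    ShortCycle : Subset (size G) → Set
    ShortCycle F = F ⊆ E H × (∃[ k ] IsCycle G F k × k ℕ.< r) × OnEdges G v F

  module Reals (ℝ : CompleteOrderedField) where

    open CompleteOrderedField ℝ public
      using (Carrier; _≈_; _≤_; _+_; _*_; -_; _⁻¹; 0#; 1#)
    open CommutativeRing (CompleteOrderedField.commutativeRing ℝ)
      using (semiring)
    open CommutativeRing (CompleteOrderedField.commutativeRing ℝ) public
      using (_-_)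
    open RawSemiringDefs (Semiring.rawSemiring semiring) using (_^_) renaming (_×_ to _×ᵣ_)
    open NonStrictToStrict _≈_ _≤_ public using (_<_)

    infixl 7 _/_
    _/_ : Carrier → Carrier → Carrier
    x / y = x * y ⁻¹

    fromℕ : ℕ → Carrier
    fromℕ k = k ×ᵣ 1#

    -- An element satisfying P if there is one, and 0# otherwise.
    the : (Carrier → Set) → Carrier
    the P with em {∃ P}
    ... | yes (x , _) = x
    ... | no  _       = 0#

    ∑ : {A : Set} → List A → (A → Carrier) → Carrier
    ∑ xs f = foldr _+_ 0# (map f xs)

    IsInfimum IsMaximum : (Carrier → Set) → Carrier → Set
    IsInfimum P s = (∀ x → P x → s ≤ x) × (∀ l → (∀ x → P x → l ≤ x) → l ≤ s)
    IsMaximum P s = P s × (∀ x → P x → x ≤ s)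

    ConvergesTo : (ℕ → Carrier) → Carrier → Set
    ConvergesTo a l = ∀ ε → 0# < ε → ∃[ N ] ∀ k → N ℕ.≤ k → l - ε < a k × a k < l + ε

    TendsTo∞ : (ℕ → Carrier) → Set
    TendsTo∞ a = ∀ M → ∃[ N ] ∀ k → N ℕ.≤ k → M ≤ a k

    -- a = o(c) for a nonnegative sequence a.
    LittleO : (ℕ → Carrier) → (ℕ → Carrier) → Set
    LittleO a c = ∀ ε → 0# < ε → ∃[ N ] ∀ k → N ℕ.≤ k → a k ≤ ε * c k

    exp : Carrier → Carrier
    exp x = the (ConvergesTo λ N → ∑ (upTo N) λ k → x ^ k / fromℕ (k !))

    e : Carrier
    e = exp 1#

    ln : Carrier → Carrier
    ln x = the λ y → exp y ≈ x

    log[_] : Carrier → Carrier → Carrier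
    log[ a ] x = ln x / ln a

    module _ {G : Graph} where

      totalWeight : Subgraph G → (Subset (order G) → Carrier) → Carrier
      totalWeight H w = ∑ (select (Independent H) (subsets (order G))) w

      FractionalColouring : Subgraph G → (Subset (order G) → Carrier) → Set
      FractionalColouring H w =
          (∀ I → 0# ≤ w I)
        × (∀ v → v ∈ V H →
             1# ≤ ∑ (select (λ I → Independent H I × v ∈ I) (subsets (order G))) w)

      χf : Subgraph G → Carrier
      χf H = the (IsInfimum λ s → ∃[ w ] FractionalColouring H w × totalWeight H w ≈ s)

      -- The probability that H[p] has the property A: the sum, over the sets ω
      -- of retained edges of H for which A holds, of the probability of ω.
      Pr : Subgraph G → Carrier → (Subgraph G → Set) → Carrier
      Pr H p A = ∑ (select (λ ω → ω ⊆ E H × A (H ↾ ω)) (subsets (size G)))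
                   λ ω → p ^ ∣ ω ∣ * (1# - p) ^ ∣ E H ─ ω ∣

    hf : ℕ → Graph → Carrier
    hf r G = the (IsMaximum λ s → ∃[ H ] [ r ] ≤⁺ girth {G} H × χf H ≈ s)

    -- Σ_i a i ≤ s for nonnegative terms indexed by a possibly infinite set.
    SumAtMost : {I : Set} → (I → Carrier) → Carrier → Set
    SumAtMost a s = ∀ is → Unique is → ∑ is a ≤ s

    record SparseCover (r : ℕ) : Set₁ where
      field
        G : Graph
        I : Set
        𝒦 : I → Clique G
        p D ξ : Carrier
        b : ℕ

      t : Carrier
      t = χf {G} whole

      field
        covers       : IsCycleCliqueCover 𝒦 r
        localOverlap : IsLocalOverlap 𝒦 b
        0<p          : 0# < p
        p<1          : p < 1#
        0≤D          : 0# ≤ D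
        0<ξ          : 0# < ξ
        ξ<1/2t       : ξ < 1# / (fromℕ 2 * t)
        fewBad       : SumAtMost
          (λ i → let K = proj₁ (𝒦 i) in
            ∑ (select (_∈ V K) (allFin (order G)))
              λ v → Pr K p λ H → D < fromℕ (shortCyclesThrough r H v))
          ξ

      bD+1 : Carrier
      bD+1 = fromℕ b * D + 1#

{-# OPTIONS --safe #-}

-- Let y be an optimal solution of the linear program dual to χf: y ≥ 0 has total weight t, and y(I) ≤ 1
-- for every independent set I. Put L = log_{1/(1-p)}(2et) and let 4L ≤ d ≤ 4L + 1.
--
-- List the vertices by increasing weight. The vertices of a set X with fewer than d later neighbours in X
-- induce a d-colourable graph, so they have weight at most d. If y(X) > 8L + 4, then so much weight remains
-- that, by Abel summation, some suffix of the list has length j < tk/2, where k is the number of its vertices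
-- in X, and at least dk/2 ≥ 2Lk edges of G join these k vertices. There are at most (et/2)^k sets of k vertices
-- in the longest such suffix, and (1-p)^{2Lk} = (2et)^{-2k}. So, by the union bound, with probability at least
-- 1/2 every independent set of G[p] has weight at most 8L + 4. As ξ < 1/2, for some outcome ω this holds and
-- moreover every vertex lies on at most bD short cycles of G[ω].
--
-- Remove the first edge of each short cycle of G[ω]. The removed edges form a graph of maximum degree at most
-- bD, which is greedily (bD + 1)-coloured. Every independent set of the rest is a union of bD + 1 independent
-- sets of G[ω], so it has weight at most (bD + 1)(8L + 4), and weak duality bounds χf of the rest from below.
--
-- The limit statement follows because -log(1-p) ≥ p, and log(2et) ≤ 2 log t once t ≥ 2e.

module Submission where

open import Defs
open import Level using (0ℓ)
open import Axiom.ExcludedMiddle using (ExcludedMiddle)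
open import Algebra.Bundles using (CommutativeRing; RawRing; Semiring)
open import Algebra.Solver.Ring.AlmostCommutativeRing
  using (AlmostCommutativeRing; fromCommutativeRing; _-Raw-AlmostCommutative⟶_)
open import Data.Empty using (⊥)
open import Data.Fin as Fin using (Fin; toℕ)
import Data.Fin.Properties as Fin
open import Data.Fin.Subset using (Subset; inside; outside; _∈_; _∉_; _⊆_; _∩_; _─_; ∣_∣; ⊤)
open import Data.Fin.Subset.Properties using (∈⊤; x∈p∩q⁺; drop-there)
open import Data.Integer.Base as ℤ using (ℤ; -[1+_])
import Data.Integer.Properties as ℤ
open import Data.List.Base
  using (List; []; _∷_; _++_; map; length; tabulate; allFin; upTo; concatMap; cartesianProduct; deduplicate)
import Data.List.Properties as List
open import Data.List.Membership.Propositional using (find; lose) renaming (_∈_ to _∈ˡ_; _∉_ to _∉ˡ_)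
import Data.List.Membership.Propositional.Properties as ∈ˡ
open import Data.List.Relation.Unary.All as All using (All; []; _∷_)
open import Data.List.Relation.Unary.Any using (here; there)
open import Data.List.Relation.Unary.AllPairs using (AllPairs; []; _∷_)
open import Data.List.Relation.Unary.Unique.Propositional using (Unique)
import Data.List.Relation.Unary.Unique.Propositional.Properties as Unique
open import Data.List.Relation.Unary.Unique.DecPropositional.Properties using (deduplicate-!)
open import Data.Maybe.Base using (Maybe; just; nothing)
open import Data.Nat as ℕ using (ℕ; zero; suc)
open import Data.Nat.Base using (_!)
import Data.Nat.Properties as ℕ
open import Data.Product using (∃; ∃-syntax; _×_; _,_; proj₁; proj₂)
open import Data.Sum using (_⊎_; inj₁; inj₂)
open import Data.Unit using (tt) renaming (⊤ to Unit)
open import Data.Vec.Base using ([]; _∷_)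
import Data.Vec.Base as Vec
import Data.Vec.Properties as Vec
open import Function using (_∘_)
open import Function.Bundles using (Equivalence)
open import Relation.Binary.PropositionalEquality as ≡ using (_≡_; _≢_)
open import Relation.Binary.Bundles using (DecTotalOrder; Poset)
open import Relation.Binary.Structures using (IsTotalOrder)
open import Relation.Binary.Construct.Add.Supremum.NonStrict ℕ._≤_ using (_≤⁺_; [_]; _≤⊤⁺)
open import Relation.Nullary using (¬_; Dec; yes; no; does; contradiction)
open import Relation.Nullary.Construct.Add.Supremum using ([_])
import Algebra.Definitions.RawSemiring as RawSemiringDefs
import Algebra.Properties.CommutativeSemiring.Exp as ExpProperties
import Algebra.Properties.Ring as RingProperties
import Algebra.Properties.Semiring.Mult as MultProperties
import Algebra.Properties.Semiring.Mult.TCOptimised as MultProperties′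
import Algebra.Solver.Ring as RingSolver
import Relation.Binary.Construct.NonStrictToStrict as NonStrictToStrict
import Relation.Binary.Reasoning.PartialOrder as PartialOrderReasoning
import Data.List.Relation.Binary.Permutation.Propositional as Permutation
import Data.List.Relation.Binary.Permutation.Propositional.Properties as PermutationProperties
import Data.List.Relation.Binary.Permutation.Setoid.Properties as PermutationSetoidProperties
import Data.List.Relation.Unary.Sorted.TotalOrder.Properties as SortedProperties
import Data.List.Sort as Sort
import Relation.Binary.Construct.On as On

-- The order of `G` is not bounded in terms of t, so a union bound over all vertex sets of a given
-- size cannot work. The dual weights supply the missing bound: along the order of increasing
-- weight, Abel summation trades an inequality between weights for one between cardinalities on some
-- suffix, and there the k vertices of X make up more than a fraction 2/t of the suffix. The number
-- of choices then depends on t and k alone, and the edges that have to be missing outweigh it.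
--
-- All randomness lives in a single random edge set ω of `G`. The random cliques are restrictions of
-- it, and only linearity of expectation connects them.
--
-- The quantities `exp`, `ln`, `χf` and `hf` are named by descriptions, so each of them needs an
-- existence proof before anything can be said about it. The reals are given by axioms only, hence
-- the development of the exponential series.

module Development (em : ExcludedMiddle 0ℓ) (ℝ : CompleteOrderedField) where

  open Classical em
  open Reals ℝ hiding (e)

  -- Arithmetic in a complete ordered field.

  module OrderedField where

    open CompleteOrderedField ℝ public
      using (⁻¹-inverseʳ; 0≉1; isTotalOrder; +-monoˡ-≤; *-nonneg; complete)
    open CompleteOrderedField ℝ using (commutativeRing)
    open CommutativeRing commutativeRing public
      using ( refl; sym; trans; +-cong; +-congˡ; +-congʳ; *-cong; *-congˡ; *-congʳ; -‿cong
            ; +-comm; +-assoc; +-identityˡ; +-identityʳ; -‿inverseˡ; -‿inverseʳ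
            ; *-comm; *-assoc; *-identityˡ; *-identityʳ; distribˡ; distribʳ; zeroˡ; zeroʳ
            ; setoid; reflexive; semiring; commutativeSemiring)
    open CommutativeRing commutativeRing using (ring)
    open RawSemiringDefs (Semiring.rawSemiring semiring) public using (_^_)
    open RingProperties ring using (-‿distribˡ-*; -‿involutive)
    open IsTotalOrder isTotalOrder public
      using () renaming (refl to ≤-refl; reflexive to ≤-reflexive; trans to ≤-trans
                        ; antisym to ≤-antisym; total to ≤-total)
    open NonStrictToStrict _≈_ _≤_ public using (<⇒≤)

    ℝ-poset : Poset 0ℓ 0ℓ 0ℓ
    ℝ-poset = record { isPartialOrder = IsTotalOrder.isPartialOrder isTotalOrder }

    module ≤-Reasoning = PartialOrderReasoning ℝ-poset

    module Solver where

      open MultProperties′ semiring using (×-homo-+; ×1-homo-*) renaming (_×_ to _×′_)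
      open import Relation.Binary.Reasoning.Setoid setoid

      -- Integer coefficients give the solver a decidable equality. The optimised multiple sends 1
      -- to `1#` itself, so the constants 0 and 1 evaluate to `0#` and `1#` definitionally.
      ℕ⟦_⟧ : ℕ → Carrier
      ℕ⟦ n ⟧ = n ×′ 1#

      ℤ⟦_⟧ : ℤ → Carrier
      ℤ⟦ ℤ.+ n ⟧ = ℕ⟦ n ⟧
      ℤ⟦ -[1+ n ] ⟧ = - ℕ⟦ suc n ⟧

      private
        ℕ⟦suc⟧ : ∀ n → ℕ⟦ suc n ⟧ ≈ 1# + ℕ⟦ n ⟧
        ℕ⟦suc⟧ = ×-homo-+ 1# 1

        -0≈0 : - 0# ≈ 0#
        -0≈0 = trans (sym (+-identityˡ _)) (-‿inverseʳ 0#)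

        cancel : ∀ x a b → a - b ≈ (x + a) - (x + b)
        cancel x a b = begin
          a - b                     ≈⟨ +-congʳ (sym (trans (+-congʳ (-‿inverseˡ x)) (+-identityˡ a))) ⟩
          ((- x + x) + a) - b       ≈⟨ +-congʳ (+-assoc _ _ _) ⟩
          (- x + (x + a)) - b       ≈⟨ +-congʳ (+-comm _ _) ⟩
          ((x + a) + - x) - b       ≈⟨ +-assoc _ _ _ ⟩
          (x + a) + (- x + - b)     ≈⟨ +-congˡ -+ ⟩
          (x + a) - (x + b)         ∎
          where
          open import Algebra.Properties.AbelianGroup (CommutativeRing.+-abelianGroup commutativeRing)
            using (⁻¹-∙-comm)
          -+ : - x + - b ≈ - (x + b)
          -+ = ⁻¹-∙-comm x b

        ⊖-homo : ∀ m n → ℤ⟦ m ℤ.⊖ n ⟧ ≈ ℕ⟦ m ⟧ - ℕ⟦ n ⟧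
        ⊖-homo m       zero    = trans (sym (+-identityʳ _)) (+-congˡ (sym -0≈0))
        ⊖-homo zero    (suc n) = sym (+-identityˡ _)
        ⊖-homo (suc m) (suc n) = begin
          ℤ⟦ suc m ℤ.⊖ suc n ⟧               ≡⟨ ≡.cong ℤ⟦_⟧ (ℤ.[1+m]⊖[1+n]≡m⊖n m n) ⟩
          ℤ⟦ m ℤ.⊖ n ⟧                       ≈⟨ ⊖-homo m n ⟩
          ℕ⟦ m ⟧ - ℕ⟦ n ⟧                    ≈⟨ cancel 1# _ _ ⟩
          (1# + ℕ⟦ m ⟧) - (1# + ℕ⟦ n ⟧)      ≈⟨ +-cong (ℕ⟦suc⟧ m) (-‿cong (ℕ⟦suc⟧ n)) ⟨
          ℕ⟦ suc m ⟧ - ℕ⟦ suc n ⟧            ∎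

        neg-homo : ∀ i → ℤ⟦ ℤ.- i ⟧ ≈ - ℤ⟦ i ⟧
        neg-homo (ℤ.+ zero)  = sym -0≈0
        neg-homo (ℤ.+ suc n) = refl
        neg-homo -[1+ n ]    = sym (-‿involutive _)

        +-homo : ∀ i j → ℤ⟦ i ℤ.+ j ⟧ ≈ ℤ⟦ i ⟧ + ℤ⟦ j ⟧
        +-homo (ℤ.+ m)  (ℤ.+ n)  = ×-homo-+ 1# m n
        +-homo (ℤ.+ m)  -[1+ n ] = ⊖-homo m (suc n)
        +-homo -[1+ m ] (ℤ.+ n)  = trans (⊖-homo n (suc m)) (+-comm _ _)
        +-homo -[1+ m ] -[1+ n ] = begin
          - ℕ⟦ suc (suc (m ℕ.+ n)) ⟧             ≡⟨ ≡.cong (λ k → - ℕ⟦ k ⟧) (≡.sym (ℕ.+-suc (suc m) n)) ⟩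
          - ℕ⟦ suc m ℕ.+ suc n ⟧                 ≈⟨ -‿cong (×-homo-+ 1# (suc m) (suc n)) ⟩
          - (ℕ⟦ suc m ⟧ + ℕ⟦ suc n ⟧)            ≈⟨ ⁻¹-∙-comm _ _ ⟨
          - ℕ⟦ suc m ⟧ + - ℕ⟦ suc n ⟧            ∎
          where
          open import Algebra.Properties.AbelianGroup (CommutativeRing.+-abelianGroup commutativeRing)
            using (⁻¹-∙-comm)

        *-homo-nonneg : ∀ m j → ℤ⟦ ℤ.+ m ℤ.* j ⟧ ≈ ℕ⟦ m ⟧ * ℤ⟦ j ⟧
        *-homo-nonneg m (ℤ.+ n)  = trans (reflexive (≡.cong ℤ⟦_⟧ (≡.sym (ℤ.pos-* m n)))) (×1-homo-* m n)
        *-homo-nonneg m -[1+ n ] = begin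
          ℤ⟦ ℤ.+ m ℤ.* -[1+ n ] ⟧            ≡⟨ ≡.cong ℤ⟦_⟧ (≡.sym (ℤ.neg-distribʳ-* (ℤ.+ m) (ℤ.+ suc n))) ⟩
          ℤ⟦ ℤ.- (ℤ.+ m ℤ.* ℤ.+ suc n) ⟧     ≈⟨ neg-homo (ℤ.+ m ℤ.* ℤ.+ suc n) ⟩
          - ℤ⟦ ℤ.+ m ℤ.* ℤ.+ suc n ⟧         ≈⟨ -‿cong (*-homo-nonneg m (ℤ.+ suc n)) ⟩
          - (ℕ⟦ m ⟧ * ℕ⟦ suc n ⟧)            ≈⟨ RingProperties.-‿distribʳ-* ring _ _ ⟩
          ℕ⟦ m ⟧ * - ℕ⟦ suc n ⟧              ∎

        *-homo : ∀ i j → ℤ⟦ i ℤ.* j ⟧ ≈ ℤ⟦ i ⟧ * ℤ⟦ j ⟧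
        *-homo (ℤ.+ m)  j = *-homo-nonneg m j
        *-homo -[1+ m ] j = begin
          ℤ⟦ -[1+ m ] ℤ.* j ⟧          ≡⟨ ≡.cong ℤ⟦_⟧ (≡.sym (ℤ.neg-distribˡ-* (ℤ.+ suc m) j)) ⟩
          ℤ⟦ ℤ.- (ℤ.+ suc m ℤ.* j) ⟧   ≈⟨ neg-homo (ℤ.+ suc m ℤ.* j) ⟩
          - ℤ⟦ ℤ.+ suc m ℤ.* j ⟧       ≈⟨ -‿cong (*-homo-nonneg (suc m) j) ⟩
          - (ℕ⟦ suc m ⟧ * ℤ⟦ j ⟧)      ≈⟨ -‿distribˡ-* _ _ ⟩
          - ℕ⟦ suc m ⟧ * ℤ⟦ j ⟧        ∎

        ℤ-rawRing : RawRing 0ℓ 0ℓ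
        ℤ-rawRing = record
          { Carrier = ℤ ; _≈_ = _≡_ ; _+_ = ℤ._+_ ; _*_ = ℤ._*_ ; -_ = ℤ.-_
          ; 0# = ℤ.0ℤ ; 1# = ℤ.1ℤ }

        almostRing : AlmostCommutativeRing 0ℓ 0ℓ
        almostRing = fromCommutativeRing commutativeRing

        morphism : ℤ-rawRing -Raw-AlmostCommutative⟶ almostRing
        morphism = record
          { ⟦_⟧ = ℤ⟦_⟧ ; +-homo = +-homo ; *-homo = *-homo ; -‿homo = neg-homo
          ; 0-homo = refl ; 1-homo = refl }

        coefficients≟ : ∀ i j → Maybe (ℤ⟦ i ⟧ ≈ ℤ⟦ j ⟧)
        coefficients≟ i j with i ℤ.≟ j
        ... | yes i≡j = just (reflexive (≡.cong ℤ⟦_⟧ i≡j))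
        ... | no  _   = nothing

      open RingSolver ℤ-rawRing almostRing morphism coefficients≟ public
        using (Polynomial; con; solve; _:=_; _:+_; _:*_; _:-_; :-_)

      -- The numerals from `#2` on are nested sums because `fromℕ 2` unfolds to `1# + (1# + 0#)`.
      -- Each of them evaluates to the matching `fromℕ` definitionally.
      #0 #1 #2 #4 #8 : ∀ {n} → Polynomial n
      #0 = con (ℤ.+ 0)
      #1 = con (ℤ.+ 1)
      #2 = #1 :+ (#1 :+ #0)
      #4 = #1 :+ (#1 :+ #2)
      #8 = #1 :+ (#1 :+ (#1 :+ (#1 :+ #4)))

    open Solver public

    infix 3 _by_

    -- Inequalities are proved by certificates: y exceeds x by a nonnegative z, which the ring solver can check.
    _by_ : ∀ {x y z} → 0# ≤ z → x + z ≈ y → x ≤ y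
    _by_ {x} {y} {z} 0≤z x+z≈y = ≤-trans
      (≤-reflexive (sym (+-identityˡ x)))
      (≤-trans (+-monoˡ-≤ x 0≤z) (≤-reflexive (trans (+-comm z x) x+z≈y)))

    slack : ∀ {x y} → x ≤ y → 0# ≤ y - x
    slack {x} {y} x≤y = ≤-trans (≤-reflexive (sym (-‿inverseʳ x))) (+-monoˡ-≤ (- x) x≤y)

    +-mono-≤ : ∀ {x y u v} → x ≤ y → u ≤ v → x + u ≤ y + v
    +-mono-≤ {x} {y} {u} {v} x≤y u≤v =
      ≤-trans (+-monoˡ-≤ u x≤y)
        (≤-trans (≤-reflexive (+-comm y u)) (≤-trans (+-monoˡ-≤ y u≤v) (≤-reflexive (+-comm v y))))

    +-nonneg : ∀ {x y} → 0# ≤ x → 0# ≤ y → 0# ≤ x + y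
    +-nonneg 0≤x 0≤y = ≤-trans (≤-reflexive (sym (+-identityˡ 0#))) (+-mono-≤ 0≤x 0≤y)

    ≰⇒> : ∀ {x y} → ¬ x ≤ y → y < x
    ≰⇒> = NonStrictToStrict.≰⇒> _≈_ _≤_ sym ≤-reflexive ≤-total

    <⇒≱ : ∀ {x y} → x < y → ¬ y ≤ x
    <⇒≱ = NonStrictToStrict.<⇒≱ _≈_ _≤_ ≤-antisym

    ≮⇒≥ : ∀ {x y} → ¬ x < y → y ≤ x
    ≮⇒≥ {x} {y} x≮y with em {y ≤ x}
    ... | yes y≤x = y≤x
    ... | no  y≰x = contradiction (≰⇒> y≰x) x≮y

    <-≤-trans : ∀ {x y z} → x < y → y ≤ z → x < z
    <-≤-trans x<y y≤z = ≤-Reasoning.begin-strict _ ≤-Reasoning.<⟨ x<y ⟩ _ ≤-Reasoning.≤⟨ y≤z ⟩ _ ≤-Reasoning.∎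

    ≤-<-trans : ∀ {x y z} → x ≤ y → y < z → x < z
    ≤-<-trans x≤y y<z = ≤-Reasoning.begin-strict _ ≤-Reasoning.≤⟨ x≤y ⟩ _ ≤-Reasoning.<⟨ y<z ⟩ _ ≤-Reasoning.∎

    <-trans : ∀ {x y z} → x < y → y < z → x < z
    <-trans x<y y<z = <-≤-trans x<y (<⇒≤ y<z)

    module _ {x y z : Carrier} where
      *-monoʳ-≤ : 0# ≤ z → x ≤ y → z * x ≤ z * y
      *-monoʳ-≤ 0≤z x≤y = *-nonneg 0≤z (slack x≤y)
        by solve 3 (λ x y z → z :* x :+ z :* (y :- x) := z :* y) refl x y z

      *-monoˡ-≤ : 0# ≤ z → x ≤ y → x * z ≤ y * z
      *-monoˡ-≤ 0≤z x≤y = *-nonneg 0≤z (slack x≤y)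
        by solve 3 (λ x y z → x :* z :+ z :* (y :- x) := y :* z) refl x y z

    *-mono-≤ : ∀ {x y u v} → 0# ≤ x → 0# ≤ v → x ≤ y → u ≤ v → x * u ≤ y * v
    *-mono-≤ 0≤x 0≤v x≤y u≤v = ≤-trans (*-monoʳ-≤ 0≤x u≤v) (*-monoˡ-≤ 0≤v x≤y)

    slack< : ∀ {x y} → x < y → 0# < y - x
    slack< {x} {y} (x≤y , x≉y) = slack x≤y , λ 0≈y-x → x≉y
      (trans (trans (sym (+-identityˡ x)) (+-congʳ 0≈y-x)) (solve 2 (λ x y → (y :- x) :+ x := y) refl x y))

    unslack< : ∀ {x y} → 0# < y - x → x < y
    unslack< {x} {y} (0≤ , 0≉) = (0≤ by solve 2 (λ x y → x :+ (y :- x) := y) refl x y)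
      , λ x≈y → 0≉ (sym (trans (+-congˡ (-‿cong x≈y)) (-‿inverseʳ y)))

    unslack : ∀ {x y} → 0# ≤ y - x → x ≤ y
    unslack {x} {y} 0≤ = 0≤ by solve 2 (λ x y → x :+ (y :- x) := y) refl x y

    square-nonneg : ∀ x → 0# ≤ x * x
    square-nonneg x with ≤-total 0# x
    ... | inj₁ 0≤x = *-nonneg 0≤x 0≤x
    ... | inj₂ x≤0 = ≤-trans (*-nonneg (slack x≤0) (slack x≤0))
      (≤-reflexive (solve 1 (λ x → (#0 :- x) :* (#0 :- x) := x :* x) refl x))

    0≤1 : 0# ≤ 1#
    0≤1 = ≤-trans (square-nonneg 1#) (≤-reflexive (*-identityˡ 1#))

    0<1 : 0# < 1#
    0<1 = 0≤1 , 0≉1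

    pos⇒≉0 : ∀ {x} → 0# < x → ¬ x ≈ 0#
    pos⇒≉0 (_ , 0≉x) x≈0 = 0≉x (sym x≈0)

    *-inverse : ∀ {x} → 0# < x → x * x ⁻¹ ≈ 1#
    *-inverse {x} 0<x = ⁻¹-inverseʳ x (pos⇒≉0 0<x)

    *-pos : ∀ {x y} → 0# < x → 0# < y → 0# < x * y
    *-pos {x} {y} 0<x 0<y = *-nonneg (<⇒≤ 0<x) (<⇒≤ 0<y) , λ 0≈xy → proj₂ 0<y (sym (begin
      y                 ≈⟨ *-identityˡ y ⟨
      1# * y            ≈⟨ *-congʳ (*-inverse 0<x) ⟨
      (x * x ⁻¹) * y    ≈⟨ solve 3 (λ x i y → (x :* i) :* y := i :* (x :* y)) refl x (x ⁻¹) y ⟩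
      x ⁻¹ * (x * y)    ≈⟨ *-congˡ 0≈xy ⟨
      x ⁻¹ * 0#         ≈⟨ zeroʳ _ ⟩
      0#                ∎))
      where open import Relation.Binary.Reasoning.Setoid setoid

    ⁻¹-pos : ∀ {x} → 0# < x → 0# < x ⁻¹
    ⁻¹-pos {x} 0<x with em {x ⁻¹ ≤ 0#}
    ... | no  x⁻¹≰0 = ≰⇒> x⁻¹≰0
    ... | yes x⁻¹≤0 = contradiction (≤-antisym 0≤1 1≤0) 0≉1
      where
      1≤0 : 1# ≤ 0#
      1≤0 = ≤-trans (≤-reflexive (sym (*-inverse 0<x)))
              (≤-trans (*-monoʳ-≤ (<⇒≤ 0<x) x⁻¹≤0) (≤-reflexive (zeroʳ x)))

    +-pos : ∀ {x y} → 0# < x → 0# ≤ y → 0# < x + y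
    +-pos {x} {y} 0<x 0≤y = <-≤-trans 0<x (0≤y by refl)

    *-cancelʳ-≤ : ∀ {x y z} → 0# < z → x * z ≤ y * z → x ≤ y
    *-cancelʳ-≤ {x} {y} {z} 0<z xz≤yz with em {x ≤ y}
    ... | yes x≤y = x≤y
    ... | no  x≰y = contradiction xz≤yz (<⇒≱ (unslack< (<-≤-trans (*-pos (slack< (≰⇒> x≰y)) 0<z)
      (≤-reflexive (solve 3 (λ x y z → (x :- y) :* z := x :* z :- y :* z) refl x y z)))))

    *-cancelʳ-< : ∀ {x y z} → 0# ≤ z → x * z < y * z → x < y
    *-cancelʳ-< 0≤z xz<yz = ≰⇒> (λ y≤x → <⇒≱ xz<yz (*-monoˡ-≤ 0≤z y≤x))

    *-monoˡ-< : ∀ {x y z} → 0# < z → x < y → x * z < y * z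
    *-monoˡ-< 0<z x<y = ≰⇒> (λ yz≤xz → <⇒≱ x<y (*-cancelʳ-≤ 0<z yz≤xz))

    /-cancel : ∀ x {z} → 0# < z → (x / z) * z ≈ x
    /-cancel x {z} 0<z = trans (solve 3 (λ x z i → (x :* i) :* z := x :* (z :* i)) refl x z (z ⁻¹))
      (trans (*-congˡ (*-inverse 0<z)) (*-identityʳ x))

    /-≤ : ∀ {x y z} → 0# < z → x ≤ y * z → x / z ≤ y
    /-≤ 0<z x≤yz = *-cancelʳ-≤ 0<z (≤-trans (≤-reflexive (/-cancel _ 0<z)) x≤yz)

    ≤-/ : ∀ {x y z} → 0# < z → x * z ≤ y → x ≤ y / z
    ≤-/ 0<z xz≤y = *-cancelʳ-≤ 0<z (≤-trans xz≤y (≤-reflexive (sym (/-cancel _ 0<z))))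

    /-pos : ∀ {x z} → 0# < x → 0# < z → 0# < x / z
    /-pos 0<x 0<z = *-pos 0<x (⁻¹-pos 0<z)

    fromℕ-nonneg : ∀ n → 0# ≤ fromℕ n
    fromℕ-nonneg zero    = ≤-refl
    fromℕ-nonneg (suc n) = +-nonneg 0≤1 (fromℕ-nonneg n)

    fromℕ-suc-pos : ∀ n → 0# < fromℕ (suc n)
    fromℕ-suc-pos n = +-pos 0<1 (fromℕ-nonneg n)

    fromℕ-mono : ∀ {m n} → m ℕ.≤ n → fromℕ m ≤ fromℕ n
    fromℕ-mono {n = n} ℕ.z≤n = fromℕ-nonneg n
    fromℕ-mono (ℕ.s≤s m≤n)   = +-mono-≤ ≤-refl (fromℕ-mono m≤n)

    open MultProperties semiring using (×1-homo-*)

    fromℕ-* : ∀ m n → fromℕ (m ℕ.* n) ≈ fromℕ m * fromℕ n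
    fromℕ-* = ×1-homo-*

    fromℕ-cancel-≤ : ∀ {m n} → fromℕ m ≤ fromℕ n → m ℕ.≤ n
    fromℕ-cancel-≤ {m} {n} m≤n with m ℕ.≤? n
    ... | yes p = p
    ... | no  p = contradiction (≤-trans (fromℕ-mono (ℕ.≰⇒> p)) m≤n)
      (<⇒≱ (unslack< (<-≤-trans 0<1 (≤-reflexive (solve 1 (λ n → #1 := (#1 :+ n) :- n) refl (fromℕ n))))))

    fromℕ-cancel-< : ∀ {m n} → fromℕ m < fromℕ n → m ℕ.< n
    fromℕ-cancel-< m<n = ℕ.≰⇒> (λ n≤m → <⇒≱ m<n (fromℕ-mono n≤m))

    least : {P : ℕ → Set} → ∃ P → ∃[ n ] P n × (∀ m → P m → n ℕ.≤ m)
    least {P} (n , Pn) = search n n ℕ.≤-refl Pn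
      where
      search : ∀ b n → n ℕ.≤ b → P n → ∃[ n ] P n × (∀ m → P m → n ℕ.≤ m)
      search b n n≤b Pn with em {∃[ m ] m ℕ.< n × P m}
      search b       n n≤b Pn | no  none           = n , Pn , λ m Pm → ℕ.≮⇒≥ (λ m<n → none (m , m<n , Pm))
      search zero    n n≤b Pn | yes (m , m<n , Pm) = contradiction (ℕ.≤-trans m<n n≤b) λ ()
      search (suc b) n n≤b Pn | yes (m , m<n , Pm) = search b m (ℕ.≤-pred (ℕ.≤-trans m<n n≤b)) Pm

    -- If the naturals were bounded, their supremum s could be lowered to `s - 1#`, because n + 1 ≤
    -- s for every n.
    archimedean : ∀ x → ∃[ n ] x < fromℕ n
    archimedean x with em {∃[ n ] x < fromℕ n}
    ... | yes p = p
    ... | no  unbounded with complete (λ y → ∃[ n ] y ≈ fromℕ n) (0# , 0 , refl)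
                          (x , λ { y (n , y≈n) → ≤-trans (≤-reflexive y≈n) (≮⇒≥ (λ x<n → unbounded (n , x<n))) })
    ... | s , upper , lowest = contradiction s≤s-1 (<⇒≱ s-1<s)
      where
      s≤s-1 : s ≤ s - 1#
      s≤s-1 = lowest (s - 1#) λ { y (n , y≈n) → slack (upper (fromℕ (suc n)) (suc n , refl))
        by trans (+-congʳ y≈n) (solve 2 (λ n s → n :+ (s :- (#1 :+ n)) := s :- #1) refl (fromℕ n) s) }
      s-1<s : s - 1# < s
      s-1<s = unslack< (<-≤-trans 0<1 (≤-reflexive (solve 1 (λ s → #1 := s :- (s :- #1)) refl s)))

    ceiling : ∀ x → 0# ≤ x → ∃[ d ] x ≤ fromℕ d × fromℕ d ≤ x + 1#
    ceiling x 0≤x with archimedean x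
    ... | N , x<N with least {λ d → x ≤ fromℕ d} (N , <⇒≤ x<N)
    ... | zero  , x≤d , _   = zero , x≤d , +-nonneg 0≤x 0≤1
    ... | suc d , x≤d , min = suc d , x≤d ,
      ≤-trans (≤-reflexive (+-comm 1# (fromℕ d)))
        (+-monoˡ-≤ 1# (<⇒≤ (≰⇒> (λ x≤d′ → ℕ.<-irrefl ≡.refl (min d x≤d′)))))

    -- The maximality clause turns a real upper bound on a count into an integer one, as greedy
    -- colouring requires.
    floor : ∀ x → 0# ≤ x → ∃[ d ] fromℕ d ≤ x × (∀ n → fromℕ n ≤ x → n ℕ.≤ d)
    floor x 0≤x with least {λ d → x < fromℕ d} (archimedean x)
    ... | zero  , x<0 , _   = contradiction 0≤x (<⇒≱ x<0)
    ... | suc d , x<d , min = d , ≮⇒≥ (λ x<d′ → ℕ.<-irrefl ≡.refl (min d x<d′))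
      , λ n n≤x → ℕ.≤-pred (fromℕ-cancel-< (≤-<-trans n≤x x<d))

    open ExpProperties commutativeSemiring public using (^-homo-*; ^-assocʳ; ^-distrib-*; ^-congˡ)

    ^-nonneg : ∀ {x} n → 0# ≤ x → 0# ≤ x ^ n
    ^-nonneg zero    0≤x = 0≤1
    ^-nonneg (suc n) 0≤x = *-nonneg 0≤x (^-nonneg n 0≤x)

    ^-pos : ∀ {x} n → 0# < x → 0# < x ^ n
    ^-pos zero    0<x = 0<1
    ^-pos (suc n) 0<x = *-pos 0<x (^-pos n 0<x)

    ^-mono-base : ∀ {x y} n → 0# ≤ x → x ≤ y → x ^ n ≤ y ^ n
    ^-mono-base zero    0≤x x≤y = ≤-refl
    ^-mono-base (suc n) 0≤x x≤y =
      *-mono-≤ 0≤x (^-nonneg n (≤-trans 0≤x x≤y)) x≤y (^-mono-base n 0≤x x≤y)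

    1^ : ∀ n → 1# ^ n ≈ 1#
    1^ zero    = refl
    1^ (suc n) = trans (*-identityˡ _) (1^ n)

    ^≤1 : ∀ {x} n → 0# ≤ x → x ≤ 1# → x ^ n ≤ 1#
    ^≤1 n 0≤x x≤1 = ≤-trans (^-mono-base n 0≤x x≤1) (≤-reflexive (1^ n))

    ^-antitone : ∀ {x m n} → 0# ≤ x → x ≤ 1# → m ℕ.≤ n → x ^ n ≤ x ^ m
    ^-antitone {x} {n = n} 0≤x x≤1 ℕ.z≤n = ^≤1 n 0≤x x≤1
    ^-antitone 0≤x x≤1 (ℕ.s≤s m≤n) = *-monoʳ-≤ 0≤x (^-antitone 0≤x x≤1 m≤n)

    square-cancel-≤ : ∀ {x y} → 0# ≤ y → x * x ≤ y * y → x ≤ y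
    square-cancel-≤ {x} {y} 0≤y xx≤yy with em {x ≤ y}
    ... | yes x≤y = x≤y
    ... | no  x≰y = contradiction xx≤yy (<⇒≱ (≤-<-trans (*-monoʳ-≤ 0≤y (<⇒≤ y<x))
        (*-monoˡ-< (≤-<-trans 0≤y y<x) y<x)))
      where
      y<x : y < x
      y<x = ≰⇒> x≰y

  open OrderedField

  -- Finite sums, indicators and subsets.

  module Sums where

    private variable
      A B : Set

    ∑-cong-∈ : ∀ (xs : List A) {f g : A → Carrier} → (∀ x → x ∈ˡ xs → f x ≈ g x) → ∑ xs f ≈ ∑ xs g
    ∑-cong-∈ []       f≈g = refl
    ∑-cong-∈ (x ∷ xs) f≈g = +-cong (f≈g x (here ≡.refl)) (∑-cong-∈ xs λ y y∈ → f≈g y (there y∈))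

    ∑-cong : ∀ (xs : List A) {f g : A → Carrier} → (∀ x → f x ≈ g x) → ∑ xs f ≈ ∑ xs g
    ∑-cong xs f≈g = ∑-cong-∈ xs λ x _ → f≈g x

    ∑-mono-∈ : ∀ (xs : List A) {f g : A → Carrier} → (∀ x → x ∈ˡ xs → f x ≤ g x) → ∑ xs f ≤ ∑ xs g
    ∑-mono-∈ []       f≤g = ≤-refl
    ∑-mono-∈ (x ∷ xs) f≤g = +-mono-≤ (f≤g x (here ≡.refl)) (∑-mono-∈ xs λ y y∈ → f≤g y (there y∈))

    ∑-mono : ∀ (xs : List A) {f g : A → Carrier} → (∀ x → f x ≤ g x) → ∑ xs f ≤ ∑ xs g
    ∑-mono xs f≤g = ∑-mono-∈ xs λ x _ → f≤g x

    ∑-nonneg : ∀ (xs : List A) {f : A → Carrier} → (∀ x → 0# ≤ f x) → 0# ≤ ∑ xs f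
    ∑-nonneg []       0≤f = ≤-refl
    ∑-nonneg (x ∷ xs) 0≤f = +-nonneg (0≤f x) (∑-nonneg xs 0≤f)

    ∑-zero : ∀ (xs : List A) → ∑ xs (λ _ → 0#) ≈ 0#
    ∑-zero []       = refl
    ∑-zero (x ∷ xs) = trans (+-identityˡ _) (∑-zero xs)

    ∑-+ : ∀ (xs : List A) (f g : A → Carrier) → ∑ xs (λ x → f x + g x) ≈ ∑ xs f + ∑ xs g
    ∑-+ []       f g = sym (+-identityˡ 0#)
    ∑-+ (x ∷ xs) f g = trans (+-congˡ (∑-+ xs f g))
      (solve 4 (λ a b c d → (a :+ b) :+ (c :+ d) := (a :+ c) :+ (b :+ d)) refl (f x) (g x) (∑ xs f) (∑ xs g))

    ∑-*ˡ : ∀ (xs : List A) c (f : A → Carrier) → ∑ xs (λ x → c * f x) ≈ c * ∑ xs f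
    ∑-*ˡ []       c f = sym (zeroʳ c)
    ∑-*ˡ (x ∷ xs) c f = trans (+-congˡ (∑-*ˡ xs c f)) (sym (distribˡ c (f x) (∑ xs f)))

    ∑-*ʳ : ∀ (xs : List A) c (f : A → Carrier) → ∑ xs (λ x → f x * c) ≈ ∑ xs f * c
    ∑-*ʳ xs c f = trans (∑-cong xs λ x → *-comm (f x) c) (trans (∑-*ˡ xs c f) (*-comm c _))

    ∑-swap : ∀ (xs : List A) (ys : List B) (f : A → B → Carrier) →
      ∑ xs (λ x → ∑ ys (f x)) ≈ ∑ ys (λ y → ∑ xs (λ x → f x y))
    ∑-swap []       ys f = sym (∑-zero ys)
    ∑-swap (x ∷ xs) ys f = trans (+-congˡ (∑-swap xs ys f)) (sym (∑-+ ys (f x) _))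

    ∑-++ : ∀ (xs ys : List A) (f : A → Carrier) → ∑ (xs ++ ys) f ≈ ∑ xs f + ∑ ys f
    ∑-++ []       ys f = sym (+-identityˡ _)
    ∑-++ (x ∷ xs) ys f = trans (+-congˡ (∑-++ xs ys f)) (sym (+-assoc _ _ _))

    ∑-map : ∀ (h : A → B) (xs : List A) (f : B → Carrier) → ∑ (map h xs) f ≈ ∑ xs (f ∘ h)
    ∑-map h []       f = refl
    ∑-map h (x ∷ xs) f = +-congˡ (∑-map h xs f)

    ∑-tabulate : ∀ {n} (h : Fin n → A) (f : A → Carrier) → ∑ (tabulate h) f ≈ ∑ (allFin n) (f ∘ h)
    ∑-tabulate {n = zero}  h f = refl
    ∑-tabulate {n = suc n} h f = +-congˡ
      (trans (∑-tabulate (h ∘ Fin.suc) f) (sym (∑-tabulate Fin.suc (f ∘ h))))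

    ∑-allFin-suc : ∀ {n} (f : Fin (suc n) → Carrier) →
      ∑ (allFin (suc n)) f ≈ f Fin.zero + ∑ (allFin n) (f ∘ Fin.suc)
    ∑-allFin-suc f = +-congˡ (∑-tabulate Fin.suc f)

    term≤∑ : ∀ {xs : List A} {f : A → Carrier} {x} → (∀ y → 0# ≤ f y) → x ∈ˡ xs → f x ≤ ∑ xs f
    term≤∑ {xs = y ∷ xs} {f} 0≤f (here ≡.refl) = ∑-nonneg xs 0≤f by refl
    term≤∑ {xs = y ∷ xs} {f} 0≤f (there x∈)    = ≤-trans (term≤∑ 0≤f x∈)
      (0≤f y by +-comm _ _)

    ∑-single : ∀ {xs : List A} {f : A → Carrier} {x} → Unique xs → x ∈ˡ xs →
      (∀ y → y ≢ x → f y ≈ 0#) → ∑ xs f ≈ f x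
    ∑-single {xs = _ ∷ xs} {f} {x} (x∉ ∷ _) (here ≡.refl) f≈0 = trans
      (+-congˡ (trans (∑-cong-∈ xs λ y y∈ → f≈0 y λ y≡x → All.lookup x∉ y∈ (≡.sym y≡x)) (∑-zero xs)))
      (+-identityʳ _)
    ∑-single {xs = z ∷ xs} (z∉ ∷ uniq) (there x∈) f≈0 = trans
      (+-cong (f≈0 z λ z≡x → All.lookup z∉ x∈ z≡x) (∑-single uniq x∈ f≈0)) (+-identityˡ _)

    𝟙 : Set → Carrier
    𝟙 P with em {P}
    ... | yes _ = 1#
    ... | no  _ = 0#

    𝟙-true : ∀ {P} → P → 𝟙 P ≈ 1#
    𝟙-true {P} p with em {P}
    ... | yes _  = refl
    ... | no  ¬p = contradiction p ¬p

    𝟙-false : ∀ {P} → ¬ P → 𝟙 P ≈ 0#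
    𝟙-false {P} ¬p with em {P}
    ... | yes p = contradiction p ¬p
    ... | no  _ = refl

    𝟙-nonneg : ∀ P → 0# ≤ 𝟙 P
    𝟙-nonneg P with em {P}
    ... | yes _ = 0≤1
    ... | no  _ = ≤-refl

    𝟙-≤ : ∀ {P x} → 0# ≤ x → (P → 1# ≤ x) → 𝟙 P ≤ x
    𝟙-≤ {P} 0≤x P⇒ with em {P}
    ... | yes p = P⇒ p
    ... | no  _ = 0≤x

    𝟙≤1 : ∀ P → 𝟙 P ≤ 1#
    𝟙≤1 P = 𝟙-≤ 0≤1 λ _ → ≤-refl

    𝟙-mono : ∀ {P Q} → (P → Q) → 𝟙 P ≤ 𝟙 Q
    𝟙-mono {Q = Q} P⇒Q = 𝟙-≤ (𝟙-nonneg Q) λ p → ≤-reflexive (sym (𝟙-true (P⇒Q p)))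

    𝟙-cong : ∀ {P Q} → (P → Q) → (Q → P) → 𝟙 P ≈ 𝟙 Q
    𝟙-cong P⇒Q Q⇒P = ≤-antisym (𝟙-mono P⇒Q) (𝟙-mono Q⇒P)

    𝟙-× : ∀ {P Q : Set} → 𝟙 (P × Q) ≈ 𝟙 P * 𝟙 Q
    𝟙-× {P} {Q} with em {P} | em {Q}
    ... | yes p | yes q = trans (𝟙-true (p , q)) (sym (*-identityˡ 1#))
    ... | yes p | no ¬q = trans (𝟙-false (¬q ∘ proj₂)) (sym (zeroʳ 1#))
    ... | no ¬p | _     = trans (𝟙-false (¬p ∘ proj₁)) (sym (zeroˡ _))

    ∑-select : ∀ (P : A → Set) (xs : List A) (f : A → Carrier) →
      ∑ (select P xs) f ≈ ∑ xs (λ x → 𝟙 (P x) * f x)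
    ∑-select P []       f = refl
    ∑-select P (x ∷ xs) f with em {P x}
    ... | yes _ = +-cong (sym (*-identityˡ _)) (∑-select P xs f)
    ... | no  _ = trans (∑-select P xs f) (trans (sym (+-identityˡ _)) (+-congʳ (sym (zeroˡ _))))

    length-∑ : ∀ (xs : List A) → fromℕ (length xs) ≈ ∑ xs (λ _ → 1#)
    length-∑ []       = refl
    length-∑ (x ∷ xs) = +-congˡ (length-∑ xs)

    ∑-const : ∀ (xs : List A) c → ∑ xs (λ _ → c) ≈ fromℕ (length xs) * c
    ∑-const xs c = trans (∑-cong xs λ _ → sym (*-identityˡ c))
      (trans (∑-*ʳ xs c (λ _ → 1#)) (*-congʳ (sym (length-∑ xs))))

    count-select : ∀ (P : A → Set) (xs : List A) →
      fromℕ (length (select P xs)) ≈ ∑ xs (λ x → 𝟙 (P x))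
    count-select P xs = trans (length-∑ (select P xs))
      (trans (∑-select P xs _) (∑-cong xs λ x → *-identityʳ _))

    -- At most one entry contributes, and an entry that does forces `Q`. The indicator of `Q` on the
    -- right, rather than `1#`, allows a sum of charges to be absorbed by an event.
    ∑𝟙-unique : ∀ {P : A → Set} {Q : Set} (xs : List A) → Unique xs →
      (∀ {x y} → P x → P y → x ≡ y) → (∀ {x} → P x → Q) → ∑ xs (λ x → 𝟙 (P x)) ≤ 𝟙 Q
    ∑𝟙-unique {Q = Q} []       _    _    _   = 𝟙-nonneg Q
    ∑𝟙-unique {P = P} (x ∷ xs) (x∉ ∷ uniq) same P⇒Q with em {P x}
    ... | no  _  = ≤-trans (≤-reflexive (+-identityˡ _)) (∑𝟙-unique xs uniq same P⇒Q)
    ... | yes px = ≤-reflexive (trans (+-congˡ (trans (∑-cong-∈ xs λ y y∈ → 𝟙-false λ py →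
      All.lookup x∉ y∈ (same px py)) (∑-zero xs))) (trans (+-identityʳ 1#) (sym (𝟙-true (P⇒Q px)))))

    1≤∑𝟙 : ∀ {P : A → Set} {xs : List A} {x} → x ∈ˡ xs → P x → 1# ≤ ∑ xs (λ y → 𝟙 (P y))
    1≤∑𝟙 {P = P} x∈ px = ≤-trans (≤-reflexive (sym (𝟙-true px))) (term≤∑ (λ y → 𝟙-nonneg (P y)) x∈)

    ∈-select⁺ : ∀ (P : A → Set) {xs x} → x ∈ˡ xs → P x → x ∈ˡ select P xs
    ∈-select⁺ P = ∈ˡ.∈-filter⁺ (λ x → em {P x})

    ∈-select⁻ : ∀ (P : A → Set) xs {x} → x ∈ˡ select P xs → x ∈ˡ xs × P x
    ∈-select⁻ P xs = ∈ˡ.∈-filter⁻ (λ x → em {P x}) {xs = xs}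

    ∈-subsets : ∀ {n} (S : Subset n) → S ∈ˡ subsets n
    ∈-subsets []            = here ≡.refl
    ∈-subsets (outside ∷ S) = ∈ˡ.∈-++⁺ˡ (∈ˡ.∈-map⁺ _ (∈-subsets S))
    ∈-subsets (inside ∷ S)  = ∈ˡ.∈-++⁺ʳ _ (∈ˡ.∈-map⁺ _ (∈-subsets S))

    subsets-unique : ∀ n → Unique (subsets n)
    subsets-unique zero    = [] ∷ []
    subsets-unique (suc n) = Unique.++⁺ (Unique.map⁺ Vec.∷-injectiveʳ (subsets-unique n))
      (Unique.map⁺ Vec.∷-injectiveʳ (subsets-unique n)) disjoint
      where
      disjoint : ∀ {S} → S ∈ˡ map (outside ∷_) (subsets n) × S ∈ˡ map (inside ∷_) (subsets n) → ⊥
      disjoint (o∈ , i∈) with ∈ˡ.∈-map⁻ _ o∈ | ∈ˡ.∈-map⁻ _ i∈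
      ... | _ , _ , ≡.refl | _ , _ , ()

    ∑-subsets-suc : ∀ {n} (f : Subset (suc n) → Carrier) →
      ∑ (subsets (suc n)) f ≈ ∑ (subsets n) (f ∘ (outside ∷_)) + ∑ (subsets n) (f ∘ (inside ∷_))
    ∑-subsets-suc {n} f = trans (∑-++ (map (outside ∷_) (subsets n)) _ f)
      (+-cong (∑-map _ (subsets n) f) (∑-map _ (subsets n) f))

    ⟪_⟫ : ∀ {n} → (Fin n → Set) → Subset n
    ⟪ P ⟫ = Vec.tabulate λ x → does (em {P x})

    ∈⟪⟫⁺ : ∀ {n} (P : Fin n → Set) {x} → P x → x ∈ ⟪ P ⟫
    ∈⟪⟫⁺ P {x} px = Vec.lookup⇒[]= x ⟪ P ⟫ (≡.trans (Vec.lookup∘tabulate _ x) does≡)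
      where
      does≡ : does (em {P x}) ≡ inside
      does≡ with em {P x}
      ... | yes _  = ≡.refl
      ... | no ¬px = contradiction px ¬px

    ∈⟪⟫⁻ : ∀ {n} (P : Fin n → Set) {x} → x ∈ ⟪ P ⟫ → P x
    ∈⟪⟫⁻ P {x} x∈ = does⇒ (≡.trans (≡.sym (Vec.lookup∘tabulate _ x)) (Vec.[]=⇒lookup x∈))
      where
      does⇒ : does (em {P x}) ≡ inside → P x
      does⇒ eq with em {P x}
      ... | yes px = px
      does⇒ () | no _

    𝟙-∈ : ∀ {n} (P : Fin n → Set) x → 𝟙 (x ∈ ⟪ P ⟫) ≈ 𝟙 (P x)
    𝟙-∈ P x = 𝟙-cong (∈⟪⟫⁻ P) (∈⟪⟫⁺ P)

    ∣∣-∑ : ∀ {n} (S : Subset n) → fromℕ ∣ S ∣ ≈ ∑ (allFin n) (λ x → 𝟙 (x ∈ S))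
    ∣∣-∑ []            = refl
    ∣∣-∑ {suc n} (s ∷ S) = trans (split s) (sym (∑-allFin-suc {n} (λ x → 𝟙 (x ∈ s ∷ S))))
      where
      rest : ∀ {s} → fromℕ ∣ S ∣ ≈ ∑ (allFin n) (λ x → 𝟙 (Fin.suc x ∈ s ∷ S))
      rest = trans (∣∣-∑ S) (∑-cong (allFin n) λ x → 𝟙-cong Vec.there drop-there)
      split : ∀ s → fromℕ ∣ s ∷ S ∣ ≈ 𝟙 (Fin.zero ∈ s ∷ S) + ∑ (allFin n) (λ x → 𝟙 (Fin.suc x ∈ s ∷ S))
      split outside = trans rest (trans (sym (+-identityˡ _)) (+-congʳ (sym (𝟙-false λ ()))))
      split inside  = +-cong (sym (𝟙-true Vec.here)) rest

  open Sums

  -- Linear programming duality by Fourier-Motzkin elimination.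

  module LinearProgramming where

    private variable
      n : ℕ

    _·_ : (Fin n → Carrier) → (Fin n → Carrier) → Carrier
    _·_ {n} a x = ∑ (allFin n) λ v → a v * x v

    -- This solves a system in one unknown: a point below all upper bounds is raised to each lower
    -- bound that it violates, and compatibility keeps it below the upper bounds.
    between : {A : Set} (l u : A → Carrier) (ls us : List A) →
      (∀ {p q} → p ∈ˡ ls → q ∈ˡ us → l p ≤ u q) →
      ∃[ x ] (∀ {p} → p ∈ˡ ls → l p ≤ x) × (∀ {q} → q ∈ˡ us → x ≤ u q)
    between l u [] [] _ = 0# , (λ ()) , (λ ())
    between l u [] (q ∷ us) l≤u with between l u [] us (λ ())
    ... | x , _ , x≤ with ≤-total x (u q)
    ... | inj₁ x≤uq = x , (λ ()) , λ { (here ≡.refl) → x≤uq ; (there q∈) → x≤ q∈ }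
    ... | inj₂ uq≤x = u q , (λ ()) , λ { (here ≡.refl) → ≤-refl ; (there q∈) → ≤-trans uq≤x (x≤ q∈) }
    between l u (p ∷ ls) us l≤u with between l u ls us (λ p∈ q∈ → l≤u (there p∈) q∈)
    ... | x , ≤x , x≤ with ≤-total x (l p)
    ... | inj₁ x≤lp = l p , (λ { (here ≡.refl) → ≤-refl ; (there p∈) → ≤-trans (≤x p∈) x≤lp })
                    , λ q∈ → l≤u (here ≡.refl) q∈
    ... | inj₂ lp≤x = x , (λ { (here ≡.refl) → lp≤x ; (there p∈) → ≤x p∈ }) , x≤

    -- (a , c) stands for the constraint a · x ≤ c.
    Constraint : ℕ → Set
    Constraint n = (Fin n → Carrier) × Carrier

    -- An abstract stand-in for the consequences of a system. Elimination never has to build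
    -- multipliers; it only needs a set of constraints that is closed under nonnegative combinations
    -- and contains no contradiction of the form 0 ≤ c with c negative.
    record Cone (Q : Constraint n → Set) : Set where
      field
        combine : ∀ {a b c d k l} → 0# ≤ k → 0# ≤ l → Q (a , c) → Q (b , d) →
                  Q ((λ v → k * a v + l * b v) , k * c + l * d)
        valid   : ∀ {a c} → Q (a , c) → (∀ v → a v ≈ 0#) → 0# ≤ c

    open Cone

    private
      neg-pos : ∀ {x} → x < 0# → 0# < - x
      neg-pos x<0 = <-≤-trans (slack< x<0) (≤-reflexive (+-identityˡ _))

    module Elimination {n : ℕ} (cs : List (Constraint (suc n))) where

      lead : Constraint (suc n) → Carrier
      lead (a , _) = a Fin.zero

      tail : Constraint (suc n) → Constraint n
      tail (a , c) = a ∘ Fin.suc , c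

      -- The multipliers are the two leading coefficients, crosswise and with one sign changed. They
      -- cancel the first unknown, and both are nonnegative when a positive constraint meets a
      -- negative one.
      eliminate : Constraint (suc n) → Constraint (suc n) → Constraint (suc n)
      eliminate (a , c) (b , d) =
        (λ v → - b Fin.zero * a v + a Fin.zero * b v) , - b Fin.zero * c + a Fin.zero * d

      Positive Negative Neutral : Constraint (suc n) → Set
      Positive k = 0# < lead k
      Negative k = lead k < 0#
      Neutral  k = lead k ≈ 0#

      positives negatives neutral : List (Constraint (suc n))
      positives = select Positive cs
      negatives = select Negative cs
      neutral   = select Neutral cs
                ++ concatMap (λ p → map (eliminate p) negatives) positives

      module _ {Q : Constraint (suc n) → Set} (cone : Cone Q) (Qcs : ∀ {k} → k ∈ˡ cs → Q k) where

        -- The slice of the cone with leading coefficient zero, that is, the consequences in which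
        -- the first unknown does not occur.
        Q′ : Constraint n → Set
        Q′ (a , c) = ∃[ b ] Q (b , c) × b Fin.zero ≈ 0# × (∀ v → b (Fin.suc v) ≈ a v)

        cone′ : Cone Q′
        combine cone′ 0≤k 0≤l (a , Qa , a₀ , a≈) (b , Qb , b₀ , b≈) =
          _ , combine cone 0≤k 0≤l Qa Qb
          , trans (+-cong (*-congˡ a₀) (*-congˡ b₀)) (trans (+-cong (zeroʳ _) (zeroʳ _)) (+-identityˡ 0#))
          , λ v → +-cong (*-congˡ (a≈ v)) (*-congˡ (b≈ v))
        valid cone′ (a , Qa , a₀ , a≈) a≈0 =
          valid cone Qa λ { Fin.zero → a₀ ; (Fin.suc v) → trans (a≈ v) (a≈0 v) }

        neutral-∈ : ∀ {k} → k ∈ˡ neutral → Q k × lead k ≈ 0#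
        neutral-∈ k∈ with ∈ˡ.∈-++⁻ (select Neutral cs) k∈
        ... | inj₁ k∈₀ = let k∈cs , k₀ = ∈-select⁻ Neutral cs k∈₀ in Qcs k∈cs , k₀
        ... | inj₂ k∈₁ with find (∈ˡ.∈-concatMap⁻ (λ p → map (eliminate p) negatives) {xs = positives} k∈₁)
        ... | p , p∈ , k∈p with ∈ˡ.∈-map⁻ (eliminate p) k∈p
        ... | q , q∈ , ≡.refl =
          let p∈cs , 0<p = ∈-select⁻ Positive cs p∈
              q∈cs , q<0 = ∈-select⁻ Negative cs q∈
          in combine cone (<⇒≤ (neg-pos q<0)) (<⇒≤ 0<p) (Qcs p∈cs) (Qcs q∈cs)
           , solve 2 (λ x y → :- y :* x :+ x :* y := #0) refl (lead p) (lead q)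

        neutral-tails : ∀ {k} → k ∈ˡ map tail neutral → Q′ k
        neutral-tails k∈ with ∈ˡ.∈-map⁻ tail k∈
        ... | (a , c) , a∈ , ≡.refl = let Qa , a₀ = neutral-∈ a∈ in a , Qa , a₀ , λ v → refl

      module _ (x′ : Fin n → Carrier) (solves′ : ∀ {a c} → (a , c) ∈ˡ map tail neutral → a · x′ ≤ c) where

        tail· : Constraint (suc n) → Carrier
        tail· (a , c) = (a ∘ Fin.suc) · x′

        -- The value of the first unknown that makes the constraint tight. It is an upper bound if
        -- the leading coefficient is positive and a lower bound if it is negative.
        bound : Constraint (suc n) → Carrier
        bound k = (proj₂ k - tail· k) / lead k

        tail·-eliminate : ∀ p q → tail· (eliminate p q) ≈ - lead q * tail· p + lead p * tail· q
        tail·-eliminate (a , c) (b , d) = trans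
          (∑-cong (allFin n) λ v → solve 5 (λ q a p b x → (:- q :* a :+ p :* b) :* x := :- q :* (a :* x) :+ p :* (b :* x))
            refl (b Fin.zero) (a (Fin.suc v)) (a Fin.zero) (b (Fin.suc v)) (x′ v))
          (trans (∑-+ (allFin n) _ _) (+-cong (∑-*ˡ (allFin n) _ _) (∑-*ˡ (allFin n) _ _)))

        private
          -- The denominators are cleared with the positive factors p and - q. What remains is the
          -- hypothesis, up to a multiple of `1# - q * q ⁻¹`, which vanishes.
          cross-multiply : ∀ {q p dq dp sq sp} → q < 0# → 0# < p →
            - q * sp + p * sq ≤ - q * dp + p * dq → (dq - sq) / q ≤ (dp - sp) / p
          cross-multiply {q} {p} {dq} {dp} {sq} {sp} q<0 0<p h =
            ≤-/ 0<p (*-cancelʳ-≤ (neg-pos q<0) (slack h by trans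
              (solve 7 (λ dq q i p sq dp sp →
                ((dq :- sq) :* i) :* p :* :- q :+ (:- q :* dp :+ p :* dq :- (:- q :* sp :+ p :* sq))
                := (#1 :- q :* i) :* (p :* (dq :- sq)) :+ (dp :- sp) :* :- q) refl dq q (q ⁻¹) p sq dp sp)
              (trans (+-congʳ (trans (*-congʳ (trans (+-congˡ (-‿cong (⁻¹-inverseʳ q (proj₂ q<0)))) (-‿inverseʳ 1#)))
                (zeroˡ _))) (+-identityˡ _))))

        compatible : ∀ {q p} → q ∈ˡ negatives → p ∈ˡ positives → bound q ≤ bound p
        compatible {q} {p} q∈ p∈ = cross-multiply (proj₂ (∈-select⁻ Negative cs q∈)) (proj₂ (∈-select⁻ Positive cs p∈))
          (≤-trans (≤-reflexive (sym (tail·-eliminate p q)))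
            (solves′ (∈ˡ.∈-map⁺ tail (∈ˡ.∈-++⁺ʳ (select Neutral cs)
              (∈ˡ.∈-concatMap⁺ (λ p → map (eliminate p) negatives)
                (lose p∈ (∈ˡ.∈-map⁺ (eliminate p) q∈)))))))

        module _ (x₀ : Carrier) (≤x₀ : ∀ {q} → q ∈ˡ negatives → bound q ≤ x₀)
                 (x₀≤ : ∀ {p} → p ∈ˡ positives → x₀ ≤ bound p) where

          extension : Fin (suc n) → Carrier
          extension Fin.zero    = x₀
          extension (Fin.suc v) = x′ v

          fromTail : ∀ {a c} → a Fin.zero * x₀ ≤ c - tail· (a , c) → a · extension ≤ c
          fromTail {a} {c} h = slack h by trans (+-congʳ (∑-allFin-suc (λ v → a v * extension v)))
            (solve 3 (λ y s c → (y :+ s) :+ ((c :- s) :- y) := c) refl (a Fin.zero * x₀) (tail· (a , c)) c)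

          solves : ∀ {a c} → (a , c) ∈ˡ cs → a · extension ≤ c
          solves {a} {c} k∈ with em {0# < a Fin.zero}
          ... | yes 0<a = fromTail {a} {c} (≤-trans (*-monoʳ-≤ (<⇒≤ 0<a) (x₀≤ {a , c} (∈-select⁺ Positive k∈ 0<a)))
            (≤-reflexive (trans (*-comm (a Fin.zero) _) (/-cancel _ 0<a))))
          ... | no  0≮a with em {a Fin.zero ≈ 0#}
          ... | yes a≈0 = fromTail {a} {c} (≤-trans (≤-reflexive (trans (*-congʳ a≈0) (zeroˡ x₀)))
            (slack (solves′ {a ∘ Fin.suc} {c} (∈ˡ.∈-map⁺ tail (∈ˡ.∈-++⁺ˡ (∈-select⁺ Neutral k∈ a≈0))))))
          ... | no  a≉0 = fromTail {a} {c} (slack (*-monoʳ-≤ (<⇒≤ (neg-pos a<0)) (≤x₀ {a , c} (∈-select⁺ Negative k∈ a<0)))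
            by trans (solve 4 (λ a x r i → a :* x :+ (:- a :* x :- :- a :* (r :* i)) := (a :* i) :* r) refl
                 (a Fin.zero) x₀ (c - tail· (a , c)) (a Fin.zero ⁻¹))
               (trans (*-congʳ (⁻¹-inverseʳ _ a≉0)) (*-identityˡ _)))
            where
            a<0 : a Fin.zero < 0#
            a<0 = ≮⇒≥ 0≮a , a≉0

    -- Each round passes from the cone to its slice and then extends a solution by one coordinate.
    -- Once no unknowns are left, `valid` is precisely the claim that every remaining constraint
    -- holds.
    fourierMotzkin : ∀ n {Q : Constraint n → Set} → Cone Q → (cs : List (Constraint n)) →
      (∀ {k} → k ∈ˡ cs → Q k) → ∃[ x ] ∀ {a c} → (a , c) ∈ˡ cs → a · x ≤ c
    fourierMotzkin zero    cone cs Qcs = (λ ()) , λ k∈ → valid cone (Qcs k∈) λ ()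
    fourierMotzkin (suc n) cone cs Qcs = extend (fourierMotzkin n (cone′ cone Qcs) (map tail neutral) (neutral-tails cone Qcs))
      where
      open Elimination cs
      extend : (∃[ x′ ] ∀ {a c} → (a , c) ∈ˡ map tail neutral → a · x′ ≤ c) →
               ∃[ x ] ∀ {a c} → (a , c) ∈ˡ cs → a · x ≤ c
      extend (x′ , solves′) = choose (between (bound x′ solves′) (bound x′ solves′) negatives positives (compatible x′ solves′))
        where
        choose : (∃[ x₀ ] (∀ {q} → q ∈ˡ negatives → bound x′ solves′ q ≤ x₀)
                        × (∀ {p} → p ∈ˡ positives → x₀ ≤ bound x′ solves′ p)) →
                 ∃[ x ] ∀ {a c} → (a , c) ∈ˡ cs → a · x ≤ c
        choose (x₀ , ≤x₀ , x₀≤) = extension x′ solves′ x₀ ≤x₀ x₀≤ , solves x′ solves′ x₀ ≤x₀ x₀≤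

    -- The system y ≥ 0, ∑ y ≥ t, y(I) ≤ 1 is solvable because no contradiction follows from it: one
    -- with multiplier β > 0 would, after division by β, be a fractional cover of weight less than
    -- t, and with β = 0 none is possible as w ≥ 0. The multipliers of y ≥ 0 are kept only as slack
    -- in the covering inequality of `Q`.
    duality : (Is : List (Subset n)) → Unique Is → (t : Carrier) →
      (∀ w → (∀ I → 0# ≤ w I) → (∀ v → 1# ≤ ∑ Is λ I → 𝟙 (v ∈ I) * w I) → t ≤ ∑ Is w) →
      ∃[ y ] (∀ v → 0# ≤ y v) × t ≤ ∑ (allFin n) y
           × (∀ {I} → I ∈ˡ Is → ∑ (allFin n) (λ v → 𝟙 (v ∈ I) * y v) ≤ 1#)
    duality {n} Is uniq t t≤ = y , nonneg , total , independent
      where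
      -- The constraints that are implied by y ≥ 0, ∑ y ≥ t (with multiplier β) and y(I) ≤ 1 (with multiplier w I).
      Q : Constraint n → Set
      Q (a , c) = ∃[ β ] ∃[ w ] 0# ≤ β × (∀ I → 0# ≤ w I)
        × (∀ v → a v + β ≤ ∑ Is λ I → 𝟙 (v ∈ I) * w I) × ∑ Is w ≤ c + β * t

      cone : Cone Q
      combine cone {a} {b} {c} {d} {k} {l} 0≤k 0≤l (β , w , 0≤β , 0≤w , a≤ , c≥) (β′ , w′ , 0≤β′ , 0≤w′ , b≤ , d≥) =
        k * β + l * β′ , (λ I → k * w I + l * w′ I)
        , +-nonneg (*-nonneg 0≤k 0≤β) (*-nonneg 0≤l 0≤β′)
        , (λ I → +-nonneg (*-nonneg 0≤k (0≤w I)) (*-nonneg 0≤l (0≤w′ I)))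
        , (λ v → ≤-trans (≤-reflexive (solve 6 (λ k a l b β β′ → (k :* a :+ l :* b) :+ (k :* β :+ l :* β′)
              := k :* (a :+ β) :+ l :* (b :+ β′)) refl k (a v) l (b v) β β′))
            (≤-trans (+-mono-≤ (*-monoʳ-≤ 0≤k (a≤ v)) (*-monoʳ-≤ 0≤l (b≤ v)))
              (≤-reflexive (sym (trans (∑-cong Is λ I → solve 5 (λ i k w l w′ → i :* (k :* w :+ l :* w′)
                  := k :* (i :* w) :+ l :* (i :* w′)) refl (𝟙 (v ∈ I)) k (w I) l (w′ I)) (linear _ _))))))
        , ≤-trans (≤-reflexive (linear w w′)) (≤-trans (+-mono-≤ (*-monoʳ-≤ 0≤k c≥) (*-monoʳ-≤ 0≤l d≥))
            (≤-reflexive (solve 7 (λ k c l d β β′ t → k :* (c :+ β :* t) :+ l :* (d :+ β′ :* t)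
              := (k :* c :+ l :* d) :+ (k :* β :+ l :* β′) :* t) refl k c l d β β′ t)))
        where
        linear : ∀ f g → ∑ Is (λ I → k * f I + l * g I) ≈ k * ∑ Is f + l * ∑ Is g
        linear f g = trans (∑-+ Is _ _) (+-cong (∑-*ˡ Is k f) (∑-*ˡ Is l g))
      valid cone {a} {c} (β , w , 0≤β , 0≤w , a≤ , c≥) a≈0 with em {0# < β}
      ... | no  0≮β = ≤-trans (∑-nonneg Is 0≤w) (≤-trans c≥ (≤-reflexive
        (trans (+-congˡ (trans (*-congʳ (≤-antisym (≮⇒≥ 0≮β) 0≤β)) (zeroˡ t))) (+-identityʳ c))))
      -- Since a vanishes, w / β covers every vertex, so the hypothesis on t applies to it.
      ... | yes 0<β = slack (≤-trans (*-monoˡ-≤ 0≤β (t≤ (λ I → w I / β) (λ I → *-nonneg (0≤w I) (<⇒≤ (⁻¹-pos 0<β))) covered))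
          (≤-trans (≤-reflexive (trans (*-congʳ (∑-*ʳ Is (β ⁻¹) w)) (/-cancel _ 0<β))) c≥))
        by solve 3 (λ t β c → #0 :+ ((c :+ β :* t) :- t :* β) := c) refl t β c
        where
        covered : ∀ v → 1# ≤ ∑ Is λ I → 𝟙 (v ∈ I) * (w I / β)
        covered v = ≤-trans (≤-/ 0<β (≤-trans (≤-reflexive (trans (*-identityˡ β)
            (trans (sym (+-identityˡ β)) (+-congʳ (sym (a≈0 v)))))) (a≤ v)))
          (≤-reflexive (trans (sym (∑-*ʳ Is (β ⁻¹) _)) (∑-cong Is λ I → *-assoc _ _ _)))

      nonnegative : Fin n → Constraint n
      nonnegative v = (λ u → - 𝟙 (u ≡ v)) , 0#

      large : Constraint n
      large = (λ _ → - 1#) , - t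

      small : Subset n → Constraint n
      small I = (λ v → 𝟙 (v ∈ I)) , 1#

      cs : List (Constraint n)
      cs = large ∷ map nonnegative (allFin n) ++ map small Is

      ∑𝟙*0 : ∀ v → ∑ Is (λ I → 𝟙 (v ∈ I) * 0#) ≈ 0#
      ∑𝟙*0 v = trans (∑-cong Is λ I → zeroʳ _) (∑-zero Is)

      -- The constraint on the total weight has β = 1 and w = 0, that of I has β = 0 and w the
      -- indicator of I, and y ≥ 0 lives on slack alone.
      Qcs : ∀ {k} → k ∈ˡ cs → Q k
      Qcs (here ≡.refl) = 1# , (λ _ → 0#) , 0≤1 , (λ _ → ≤-refl)
        , (λ v → ≤-reflexive (trans (-‿inverseˡ 1#) (sym (∑𝟙*0 v))))
        , ≤-reflexive (trans (∑-zero Is) (solve 1 (λ t → #0 := :- t :+ #1 :* t) refl t))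
      Qcs (there k∈) with ∈ˡ.∈-++⁻ (map nonnegative (allFin n)) k∈
      ... | inj₁ k∈₁ with ∈ˡ.∈-map⁻ nonnegative k∈₁
      ... | v , _ , ≡.refl = 0# , (λ _ → 0#) , ≤-refl , (λ _ → ≤-refl)
        , (λ u → ≤-trans (≤-reflexive (+-identityʳ _)) (≤-trans (𝟙-nonneg (u ≡ v)
            by -‿inverseˡ _) (≤-reflexive (sym (∑𝟙*0 u)))))
        , ≤-reflexive (trans (∑-zero Is) (solve 1 (λ t → #0 := #0 :+ #0 :* t) refl t))
      Qcs (there k∈) | inj₂ k∈₂ with ∈ˡ.∈-map⁻ small k∈₂
      ... | I , I∈ , ≡.refl = 0# , (λ J → 𝟙 (J ≡ I)) , ≤-refl , (λ J → 𝟙-nonneg _)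
        , (λ v → ≤-reflexive (trans (+-identityʳ _) (sym (trans (∑-single uniq I∈ λ J J≢I →
            trans (*-congˡ (𝟙-false J≢I)) (zeroʳ _)) (trans (*-congˡ (𝟙-true ≡.refl)) (*-identityʳ _))))))
        , ≤-reflexive (trans (trans (∑-single uniq I∈ λ J J≢I → 𝟙-false J≢I) (𝟙-true ≡.refl))
            (solve 1 (λ t → #1 := #1 :+ #0 :* t) refl t))

      solution = fourierMotzkin n cone cs Qcs

      y : Fin n → Carrier
      y = proj₁ solution

      nonneg : ∀ v → 0# ≤ y v
      nonneg v = slack (proj₂ solution (there (∈ˡ.∈-++⁺ˡ (∈ˡ.∈-map⁺ nonnegative (∈ˡ.∈-allFin v)))))
        by trans (+-congˡ (+-congˡ (-‿cong (trans (∑-single {x = v} (Unique.allFin⁺ n) (∈ˡ.∈-allFin v)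
               λ u u≢v → trans (*-congʳ (-‿cong (𝟙-false u≢v))) (solve 1 (λ y → :- #0 :* y := #0) refl (y u)))
             (*-congʳ (-‿cong (𝟙-true ≡.refl)))))))
           (solve 1 (λ y → #0 :+ (#0 :- :- #1 :* y) := y) refl (y v))

      total : t ≤ ∑ (allFin n) y
      total = slack (proj₂ solution (here ≡.refl))
        by trans (+-congˡ (+-congˡ (-‿cong (∑-*ˡ (allFin n) (- 1#) y))))
           (solve 2 (λ t s → t :+ (:- t :- :- #1 :* s) := s) refl t (∑ (allFin n) y))

      independent : ∀ {I} → I ∈ˡ Is → ∑ (allFin n) (λ v → 𝟙 (v ∈ I) * y v) ≤ 1#
      independent I∈ = proj₂ solution (there (∈ˡ.∈-++⁺ʳ (map nonnegative (allFin n)) (∈ˡ.∈-map⁺ small I∈)))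

  open LinearProgramming

  -- Expectation over random edge sets.

  module Probability where

    private variable
      m : ℕ
      A : Set

    module Expectation (p : Carrier) (0≤p : 0# ≤ p) (p≤1 : p ≤ 1#) where

      0≤1-p : 0# ≤ 1# - p
      0≤1-p = slack p≤1

      1-p≤1 : 1# - p ≤ 1#
      1-p≤1 = 0≤p by solve 1 (λ p → (#1 :- p) :+ p := #1) refl p

      -- Expectation under the product measure, by conditioning on the first element. This form
      -- turns facts about independent edges into inductions; `marginal` ties it to the explicit sum
      -- in `Pr`.
      𝔼 : (Subset m → Carrier) → Carrier
      𝔼 {zero}  f = f []
      𝔼 {suc m} f = (1# - p) * 𝔼 (f ∘ (outside ∷_)) + p * 𝔼 (f ∘ (inside ∷_))

      𝔼-cong : {f g : Subset m → Carrier} → (∀ ω → f ω ≈ g ω) → 𝔼 f ≈ 𝔼 g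
      𝔼-cong {zero}  f≈g = f≈g []
      𝔼-cong {suc m} f≈g = +-cong (*-congˡ (𝔼-cong {m} (f≈g ∘ _))) (*-congˡ (𝔼-cong {m} (f≈g ∘ _)))

      𝔼-mono : {f g : Subset m → Carrier} → (∀ ω → f ω ≤ g ω) → 𝔼 f ≤ 𝔼 g
      𝔼-mono {zero}  f≤g = f≤g []
      𝔼-mono {suc m} f≤g =
        +-mono-≤ (*-monoʳ-≤ 0≤1-p (𝔼-mono {m} (f≤g ∘ _))) (*-monoʳ-≤ 0≤p (𝔼-mono {m} (f≤g ∘ _)))

      𝔼-const : ∀ c → 𝔼 {m} (λ _ → c) ≈ c
      𝔼-const {zero}  c = refl
      𝔼-const {suc m} c = trans (+-cong (*-congˡ (𝔼-const {m} c)) (*-congˡ (𝔼-const {m} c)))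
        (solve 2 (λ p c → (#1 :- p) :* c :+ p :* c := c) refl p c)

      𝔼-+ : (f g : Subset m → Carrier) → 𝔼 (λ ω → f ω + g ω) ≈ 𝔼 f + 𝔼 g
      𝔼-+ {zero}  f g = refl
      𝔼-+ {suc m} f g = trans (+-cong (*-congˡ (𝔼-+ {m} _ _)) (*-congˡ (𝔼-+ {m} _ _)))
        (solve 6 (λ q p a b c d → q :* (a :+ b) :+ p :* (c :+ d) := (q :* a :+ p :* c) :+ (q :* b :+ p :* d))
          refl (1# - p) p (𝔼 (f ∘ (outside ∷_))) (𝔼 (g ∘ (outside ∷_))) (𝔼 (f ∘ (inside ∷_))) (𝔼 (g ∘ (inside ∷_))))

      𝔼-∑ : (xs : List A) (f : A → Subset m → Carrier) →
        𝔼 (λ ω → ∑ xs (λ x → f x ω)) ≈ ∑ xs (λ x → 𝔼 (f x))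
      𝔼-∑ {m = m} []       f = 𝔼-const {m} 0#
      𝔼-∑ {m = m} (x ∷ xs) f = trans (𝔼-+ {m} (f x) _) (+-congˡ (𝔼-∑ xs f))

      -- The method of conditional expectations: fixing the first element one way or the other keeps
      -- the mean below c.
      below-mean : (f : Subset m → Carrier) → ∀ {c} → 𝔼 f < c → ∃[ ω ] f ω < c
      below-mean {zero}  f 𝔼f<c = [] , 𝔼f<c
      below-mean {suc m} f {c} 𝔼f<c with em {𝔼 (f ∘ (outside ∷_)) < c} | em {𝔼 (f ∘ (inside ∷_)) < c}
      ... | yes o<c | _       = let ω , fω<c = below-mean (f ∘ (outside ∷_)) o<c in outside ∷ ω , fω<c
      ... | no  _   | yes i<c = let ω , fω<c = below-mean (f ∘ (inside ∷_)) i<c in inside ∷ ω , fω<c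
      ... | no  o≮c | no  i≮c = contradiction 𝔼f<c λ 𝔼f<c → <⇒≱ 𝔼f<c
        (≤-trans (≤-reflexive (solve 2 (λ p c → c := (#1 :- p) :* c :+ p :* c) refl p c))
          (+-mono-≤ (*-monoʳ-≤ 0≤1-p (≮⇒≥ o≮c)) (*-monoʳ-≤ 0≤p (≮⇒≥ i≮c))))

      Avoids : Subset m → Subset m → Set
      Avoids ω S = ∀ x → x ∈ S → x ∉ ω

      private
        𝟙-avoids-outside : ∀ s (ω S : Subset m) → 𝟙 (Avoids (s ∷ ω) (outside ∷ S)) ≈ 𝟙 (Avoids ω S)
        𝟙-avoids-outside s ω S = 𝟙-cong (λ av x x∈S x∈ω → av (Fin.suc x) (Vec.there x∈S) (Vec.there x∈ω))
          λ { av (Fin.suc x) (Vec.there x∈S) (Vec.there x∈ω) → av x x∈S x∈ω }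

        𝟙-avoids-inside : ∀ s (ω S : Subset m) → 𝟙 (Avoids (outside ∷ ω) (s ∷ S)) ≈ 𝟙 (Avoids ω S)
        𝟙-avoids-inside s ω S = 𝟙-cong (λ av x x∈S x∈ω → av (Fin.suc x) (Vec.there x∈S) (Vec.there x∈ω))
          λ { av (Fin.suc x) (Vec.there x∈S) (Vec.there x∈ω) → av x x∈S x∈ω }

      𝔼-avoids : (S : Subset m) → 𝔼 (λ ω → 𝟙 (Avoids ω S)) ≈ (1# - p) ^ ∣ S ∣
      𝔼-avoids [] = 𝟙-true λ _ ()
      𝔼-avoids {m = suc m} (outside ∷ S) = trans
        (+-cong (*-congˡ (trans (𝔼-cong {m} λ ω → 𝟙-avoids-outside outside ω S) (𝔼-avoids S)))
                (*-congˡ (trans (𝔼-cong {m} λ ω → 𝟙-avoids-outside inside ω S) (𝔼-avoids S))))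
        (solve 2 (λ p x → (#1 :- p) :* x :+ p :* x := x) refl p ((1# - p) ^ ∣ S ∣))
      𝔼-avoids {m = suc m} (inside ∷ S) = trans
        (+-cong (*-congˡ (trans (𝔼-cong {m} λ ω → 𝟙-avoids-inside inside ω S) (𝔼-avoids S)))
                (*-congˡ (trans (𝔼-cong {m} λ ω → 𝟙-false λ av → av Fin.zero Vec.here Vec.here) (𝔼-const {m} 0#))))
        (trans (+-congˡ (zeroʳ p)) (+-identityʳ _))

      weight : Subset m → Subset m → Carrier
      weight F ω = p ^ ∣ ω ∣ * (1# - p) ^ ∣ F ─ ω ∣

      private
        𝟙-outside-⊆ : ∀ s (ω F : Subset m) → 𝟙 ((outside ∷ ω) ⊆ (s ∷ F)) ≈ 𝟙 (ω ⊆ F)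
        𝟙-outside-⊆ s ω F = 𝟙-cong {(outside ∷ ω) ⊆ (s ∷ F)} {ω ⊆ F}
          (λ h x∈ → drop-there (h (Vec.there x∈))) λ { h (Vec.there x∈) → Vec.there (h x∈) }

        𝟙-inside-⊆ : ∀ (ω F : Subset m) → 𝟙 ((inside ∷ ω) ⊆ (inside ∷ F)) ≈ 𝟙 (ω ⊆ F)
        𝟙-inside-⊆ ω F = 𝟙-cong {(inside ∷ ω) ⊆ (inside ∷ F)} {ω ⊆ F}
          (λ h x∈ → drop-there (h (Vec.there x∈))) λ { h Vec.here → Vec.here ; h (Vec.there x∈) → Vec.there (h x∈) }

        inside⊈outside : ∀ (ω F : Subset m) → ¬ (inside ∷ ω) ⊆ (outside ∷ F)
        inside⊈outside ω F i⊆o with i⊆o Vec.here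
        ... | ()

      -- The trace on `F` of a random subset of the whole edge set is a random subset of `F`. Thus
      -- all the graphs K[p] can be read off from one random edge set of the ambient graph.
      marginal : (F : Subset m) (g : Subset m → Carrier) →
        ∑ (subsets m) (λ ω → 𝟙 (ω ⊆ F) * (g ω * weight F ω)) ≈ 𝔼 (λ ω → g (F ∩ ω))
      marginal [] g = trans (+-identityʳ _) (trans (*-congʳ (𝟙-true {[] ⊆ []} λ x∈ → x∈))
        (solve 1 (λ g → #1 :* (g :* (#1 :* #1)) := g) refl (g [])))
      marginal {suc m} (outside ∷ F) g = trans (∑-subsets-suc {m} _)
        (trans (+-cong (trans (∑-cong (subsets m) λ ω → *-congʳ (𝟙-outside-⊆ outside ω F)) (marginal F (g ∘ (outside ∷_))))
          (trans (∑-cong (subsets m) λ ω → trans (*-congʳ (𝟙-false (inside⊈outside ω F))) (zeroˡ _))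
            (∑-zero (subsets m))))
          (solve 2 (λ p x → x :+ #0 := (#1 :- p) :* x :+ p :* x) refl p (𝔼 (λ ω → g (outside ∷ (F ∩ ω))))))
      marginal {suc m} (inside ∷ F) g = trans (∑-subsets-suc {m} _) (+-cong
        (trans (∑-cong (subsets m) λ ω → trans
            (*-congʳ (𝟙-outside-⊆ inside ω F))
            (solve 5 (λ i g a q b → i :* (g :* (a :* (q :* b))) := q :* (i :* (g :* (a :* b)))) refl
              (𝟙 (ω ⊆ F)) (g (outside ∷ ω)) (p ^ ∣ ω ∣) (1# - p) ((1# - p) ^ ∣ F ─ ω ∣)))
          (trans (∑-*ˡ (subsets m) _ _) (*-congˡ (marginal F (g ∘ (outside ∷_))))))
        (trans (∑-cong (subsets m) λ ω → trans
            (*-congʳ (𝟙-inside-⊆ ω F))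
            (solve 5 (λ i g a q b → i :* (g :* ((q :* a) :* b)) := q :* (i :* (g :* (a :* b)))) refl
              (𝟙 (ω ⊆ F)) (g (inside ∷ ω)) (p ^ ∣ ω ∣) p ((1# - p) ^ ∣ F ─ ω ∣)))
          (trans (∑-*ˡ (subsets m) _ _) (*-congˡ (marginal F (g ∘ (inside ∷_)))))))

      Pr-𝔼 : ∀ {G} (H : Subgraph G) (A : Subgraph G → Set) →
        Pr H p A ≈ 𝔼 (λ ω → 𝟙 (A (H ↾ (E H ∩ ω))))
      Pr-𝔼 {G} H A = trans (∑-select (λ ω → ω ⊆ E H × A (H ↾ ω)) (subsets (size G)) (weight (E H)))
        (trans (∑-cong (subsets (size G)) λ ω → trans (*-congʳ 𝟙-×) (*-assoc _ _ _))
          (marginal (E H) (λ ω → 𝟙 (A (H ↾ ω)))))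

  open Probability

  -- Cauchy products and the exponential series.

  module ExponentialSeries where

    private variable
      x y z w h : Carrier

    sumℕ : (ℕ → Carrier) → ℕ → Carrier
    sumℕ f zero    = 0#
    sumℕ f (suc n) = sumℕ f n + f n

    ∑-upTo : ∀ n f → ∑ (upTo n) f ≈ sumℕ f n
    ∑-upTo zero    f = refl
    ∑-upTo (suc n) f = trans (reflexive (≡.cong (λ xs → ∑ xs f) (≡.sym (List.upTo-∷ʳ n))))
      (trans (∑-++ (upTo n) (n ∷ []) f) (+-cong (∑-upTo n f) (+-identityʳ (f n))))

    sumℕ-front : ∀ f n → sumℕ f (suc n) ≈ f 0 + sumℕ (f ∘ suc) n
    sumℕ-front f zero    = +-comm _ _
    sumℕ-front f (suc n) = trans (+-congʳ (sumℕ-front f n)) (+-assoc _ _ _)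

    sumℕ-nonneg : ∀ {f} n → (∀ k → 0# ≤ f k) → 0# ≤ sumℕ f n
    sumℕ-nonneg zero    0≤f = ≤-refl
    sumℕ-nonneg (suc n) 0≤f = +-nonneg (sumℕ-nonneg n 0≤f) (0≤f n)

    sumℕ-mono : ∀ {f m n} → (∀ k → 0# ≤ f k) → m ℕ.≤ n → sumℕ f m ≤ sumℕ f n
    sumℕ-mono {f} {n = n} 0≤f ℕ.z≤n = sumℕ-nonneg n 0≤f
    sumℕ-mono {f} {suc m} {suc n} 0≤f m≤n with ℕ.m≤n⇒m<n∨m≡n m≤n
    ... | inj₁ m<n    = ≤-trans (sumℕ-mono {m = suc m} {n} 0≤f (ℕ.≤-pred m<n)) (0≤f n by refl)
    ... | inj₂ ≡.refl = ≤-refl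

    -- The coefficient of the Cauchy product, the sum of f i * g j over i + j = n.
    conv : (ℕ → Carrier) → (ℕ → Carrier) → ℕ → Carrier
    conv f g zero    = f 0 * g 0
    conv f g (suc n) = f 0 * g (suc n) + conv (f ∘ suc) g n

    -- The sum of f i * g j over i + j < n, arranged by rows.
    triangle : (ℕ → Carrier) → (ℕ → Carrier) → ℕ → Carrier
    triangle f g zero    = 0#
    triangle f g (suc n) = f 0 * sumℕ g (suc n) + triangle (f ∘ suc) g n

    triangle-suc : ∀ f g n → triangle f g (suc n) ≈ triangle f g n + conv f g n
    triangle-suc f g zero    = solve 2 (λ f g → f :* (#0 :+ g) :+ #0 := #0 :+ f :* g) refl (f 0) (g 0)
    triangle-suc f g (suc n) = trans (+-congˡ (triangle-suc (f ∘ suc) g n))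
      (solve 5 (λ f s g t c → f :* (s :+ g) :+ (t :+ c) := (f :* s :+ t) :+ (f :* g :+ c)) refl
        (f 0) (sumℕ g (suc n)) (g (suc n)) (triangle (f ∘ suc) g n) (conv (f ∘ suc) g n))

    triangle-sum : ∀ f g n → triangle f g n ≈ sumℕ (conv f g) n
    triangle-sum f g zero    = refl
    triangle-sum f g (suc n) = trans (triangle-suc f g n) (+-congʳ (triangle-sum f g n))

    -- The part of the rectangle {i < n, j < m} outside the triangle {i + j < n}.
    corner : (ℕ → Carrier) → (ℕ → Carrier) → ℕ → ℕ → Carrier
    corner f g zero    m = 0#
    corner f g (suc n) m = f 0 * (sumℕ g m - sumℕ g (suc n)) + corner (f ∘ suc) g n m

    rectangle : ∀ f g n m → sumℕ f n * sumℕ g m ≈ triangle f g n + corner f g n m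
    rectangle f g zero    m = trans (zeroˡ _) (sym (+-identityˡ _))
    rectangle f g (suc n) m = trans (*-congʳ (sumℕ-front f n))
      (trans (distribʳ _ _ _) (trans (+-congˡ (rectangle (f ∘ suc) g n m))
        (solve 5 (λ f s s′ t r → f :* s :+ (t :+ r) := (f :* s′ :+ t) :+ (f :* (s :- s′) :+ r)) refl
          (f 0) (sumℕ g m) (sumℕ g (suc n)) (triangle (f ∘ suc) g n) (corner (f ∘ suc) g n m))))

    -- Indices i < n and j < m satisfy i + j < n + m, and all further terms of the triangle are
    -- nonnegative.
    rectangle≤triangle : ∀ {f g} n m → (∀ k → 0# ≤ f k) → (∀ k → 0# ≤ g k) →
      sumℕ f n * sumℕ g m ≤ triangle f g (n ℕ.+ m)
    rectangle≤triangle {f} {g} zero    m 0≤f 0≤g = ≤-trans (≤-reflexive (zeroˡ _)) (triangle-nonneg m 0≤f)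
      where
      triangle-nonneg : ∀ {f} m → (∀ k → 0# ≤ f k) → 0# ≤ triangle f g m
      triangle-nonneg zero    0≤f = ≤-refl
      triangle-nonneg (suc m) 0≤f =
        +-nonneg (*-nonneg (0≤f 0) (sumℕ-nonneg {g} (suc m) 0≤g)) (triangle-nonneg m (0≤f ∘ suc))
    rectangle≤triangle {f} {g} (suc n) m 0≤f 0≤g = ≤-trans
      (≤-reflexive (trans (*-congʳ (sumℕ-front f n)) (distribʳ _ _ _)))
      (+-mono-≤ (*-monoʳ-≤ (0≤f 0) (sumℕ-mono {g} {m} {suc n ℕ.+ m} 0≤g (ℕ.m≤n+m m (suc n))))
        (rectangle≤triangle n m (0≤f ∘ suc) 0≤g))

    -- Absolute values are avoided: |f k| ≤ F k is stated as two inequalities.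
    Bounds : (ℕ → Carrier) → (ℕ → Carrier) → Set
    Bounds F f = ∀ k → f k ≤ F k × - f k ≤ F k

    bounds-self : ∀ {f} → (∀ k → 0# ≤ f k) → Bounds f f
    bounds-self {f} 0≤f k = ≤-refl , (+-nonneg (0≤f k) (0≤f k) by solve 1 (λ t → :- t :+ (t :+ t) := t) refl (f k))

    private
      neg-nonneg : ∀ {a} → a ≤ 0# → 0# ≤ - a
      neg-nonneg a≤0 = ≤-trans (slack a≤0) (≤-reflexive (+-identityˡ _))

      bound-nonneg : ∀ {b B} → b ≤ B → - b ≤ B → 0# ≤ B
      bound-nonneg {b} b≤ -b≤ with ≤-total 0# b
      ... | inj₁ 0≤b = ≤-trans 0≤b b≤
      ... | inj₂ b≤0 = ≤-trans (neg-nonneg b≤0) -b≤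

      product-bound : ∀ {a b A B} → a ≤ A → - a ≤ A → b ≤ B → - b ≤ B → a * b ≤ A * B
      product-bound {a} {b} {A} {B} a≤ -a≤ b≤ -b≤ with ≤-total 0# a
      ... | inj₁ 0≤a = ≤-trans (*-monoʳ-≤ 0≤a b≤) (*-monoˡ-≤ (bound-nonneg b≤ -b≤) a≤)
      ... | inj₂ a≤0 = ≤-trans (≤-reflexive (solve 2 (λ a b → a :* b := (:- a) :* (:- b)) refl a b))
        (≤-trans (*-monoʳ-≤ (neg-nonneg a≤0) -b≤) (*-monoˡ-≤ (bound-nonneg b≤ -b≤) -a≤))

      range-bound : ∀ {G g m n} → Bounds G g → m ℕ.≤ n → sumℕ g n - sumℕ g m ≤ sumℕ G n - sumℕ G m
      range-bound {G} {g} {m} {n} g≤ m≤n with ℕ.m≤n⇒m<n∨m≡n m≤n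
      ... | inj₂ ≡.refl = ≤-reflexive (trans (-‿inverseʳ _) (sym (-‿inverseʳ _)))
      range-bound {G} {g} {m} {suc n} g≤ m≤n | inj₁ m<n = ≤-trans
        (≤-reflexive (solve 3 (λ s x t → (s :+ x) :- t := (s :- t) :+ x) refl (sumℕ g n) (g n) (sumℕ g m)))
        (≤-trans (+-mono-≤ (range-bound {m = m} {n} g≤ (ℕ.≤-pred m<n)) (proj₁ (g≤ n)))
        (≤-reflexive (solve 3 (λ s x t → (s :- t) :+ x := (s :+ x) :- t) refl (sumℕ G n) (G n) (sumℕ G m))))

      Bounds-neg : ∀ {G g} → Bounds G g → Bounds G (λ k → - g k)
      Bounds-neg {G} {g} g≤ k = proj₂ (g≤ k)
        , ≤-trans (≤-reflexive (solve 1 (λ g → :- :- g := g) refl (g k))) (proj₁ (g≤ k))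

      sumℕ-neg : ∀ f n → sumℕ (λ k → - f k) n ≈ - sumℕ f n
      sumℕ-neg f zero    = solve 0 (#0 := :- #0) refl
      sumℕ-neg f (suc n) = trans (+-congʳ (sumℕ-neg f n))
        (solve 2 (λ a b → :- a :+ :- b := :- (a :+ b)) refl (sumℕ f n) (f n))

    -- Every term of the corner is a product f i * g j, and n ≤ m guarantees that the differences of
    -- partial sums in its rows are sums of actual terms, so that the bounds may be applied term by
    -- term.
    corner-bound : ∀ {F G f g} n m → n ℕ.≤ m → Bounds F f → Bounds G g → corner f g n m ≤ corner F G n m
    corner-bound zero m n≤m f≤ g≤ = ≤-refl
    corner-bound {F} {G} {f} {g} (suc n) m n≤m f≤ g≤ = +-mono-≤
      (product-bound (proj₁ (f≤ 0)) (proj₂ (f≤ 0)) (range-bound {m = suc n} {m} g≤ n≤m)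
        (≤-trans (≤-reflexive (trans (solve 2 (λ a b → :- (a :- b) := :- a :- :- b) refl (sumℕ g m) (sumℕ g (suc n)))
            (sym (+-cong (sumℕ-neg g m) (-‿cong (sumℕ-neg g (suc n)))))))
          (range-bound {m = suc n} {m} (Bounds-neg {G} {g} g≤) n≤m)))
      (corner-bound n m (ℕ.≤-trans (ℕ.n≤1+n n) n≤m) (f≤ ∘ suc) g≤)

    -- The formal derivative of a power series, on coefficients.
    ∂ : (ℕ → Carrier) → ℕ → Carrier
    ∂ f k = fromℕ (suc k) * f (suc k)

    conv-cong : ∀ {f f′ g g′} n → (∀ k → f k ≈ f′ k) → (∀ k → g k ≈ g′ k) → conv f g n ≈ conv f′ g′ n
    conv-cong zero    f≈ g≈ = *-cong (f≈ 0) (g≈ 0)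
    conv-cong (suc n) f≈ g≈ = +-cong (*-cong (f≈ 0) (g≈ (suc n))) (conv-cong n (f≈ ∘ suc) g≈)

    conv-+ˡ : ∀ f f′ g n → conv (λ k → f k + f′ k) g n ≈ conv f g n + conv f′ g n
    conv-+ˡ f f′ g zero    = distribʳ _ _ _
    conv-+ˡ f f′ g (suc n) = trans (+-congˡ (conv-+ˡ (f ∘ suc) (f′ ∘ suc) g n))
      (solve 5 (λ a b c d e → (a :+ b) :* c :+ (d :+ e) := (a :* c :+ d) :+ (b :* c :+ e)) refl
        (f 0) (f′ 0) (g (suc n)) (conv (f ∘ suc) g n) (conv (f′ ∘ suc) g n))

    conv-*ˡ : ∀ c f g n → conv (λ k → c * f k) g n ≈ c * conv f g n
    conv-*ˡ c f g zero    = *-assoc _ _ _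
    conv-*ˡ c f g (suc n) = trans (+-cong (*-assoc _ _ _) (conv-*ˡ c (f ∘ suc) g n)) (sym (distribˡ _ _ _))

    conv-*ʳ : ∀ c f g n → conv f (λ k → c * g k) n ≈ c * conv f g n
    conv-*ʳ c f g zero    = solve 3 (λ f c g → f :* (c :* g) := c :* (f :* g)) refl (f 0) c (g 0)
    conv-*ʳ c f g (suc n) = trans (+-congˡ (conv-*ʳ c (f ∘ suc) g n))
      (solve 4 (λ f c g s → f :* (c :* g) :+ c :* s := c :* (f :* g :+ s)) refl (f 0) c (g (suc n)) (conv (f ∘ suc) g n))

    -- The product rule for formal power series: on i + j = n + 1 the factor n + 1 splits into i and
    -- j.
    leibniz : ∀ f g n → fromℕ (suc n) * conv f g (suc n) ≈ conv (∂ f) g n + conv f (∂ g) n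
    leibniz f g zero = solve 4 (λ f₀ f₁ g₀ g₁ → (#1 :+ #0) :* (f₀ :* g₁ :+ f₁ :* g₀)
      := ((#1 :+ #0) :* f₁) :* g₀ :+ f₀ :* ((#1 :+ #0) :* g₁)) refl (f 0) (f 1) (g 0) (g 1)
    leibniz f g (suc n) = begin
      (1# + N) * (f 0 * g₂ + conv f′ g (suc n))
        ≈⟨ solve 4 (λ N a b c → (#1 :+ N) :* (a :* b :+ c) := a :* ((#1 :+ N) :* b) :+ (N :* c :+ c)) refl N (f 0) g₂ (conv f′ g (suc n)) ⟩
      f 0 * ((1# + N) * g₂) + (N * conv f′ g (suc n) + conv f′ g (suc n))
        ≈⟨ +-congˡ (+-congʳ (leibniz f′ g n)) ⟩
      f 0 * ((1# + N) * g₂) + ((conv (∂ f′) g n + conv f′ (∂ g) n) + (f 1 * g (suc n) + conv (f′ ∘ suc) g n))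
        ≈⟨ solve 5 (λ X a b c d → X :+ ((a :+ b) :+ (c :+ d)) := (c :+ (a :+ d)) :+ (X :+ b)) refl
             (f 0 * ((1# + N) * g₂)) (conv (∂ f′) g n) (conv f′ (∂ g) n) (f 1 * g (suc n)) (conv (f′ ∘ suc) g n) ⟩
      (f 1 * g (suc n) + (conv (∂ f′) g n + conv (f′ ∘ suc) g n)) + (f 0 * ((1# + N) * g₂) + conv f′ (∂ g) n)
        ≈⟨ +-congʳ (+-cong (*-congʳ (solve 1 (λ f → f := (#1 :+ #0) :* f) refl (f 1)))
             (trans (sym (conv-+ˡ (∂ f′) (f′ ∘ suc) g n)) (conv-cong n ∂-suc λ _ → refl))) ⟩
      (∂ f 0 * g (suc n) + conv (∂ f ∘ suc) g n) + (f 0 * ((1# + N) * g₂) + conv f′ (∂ g) n)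
        ∎
      where
      open import Relation.Binary.Reasoning.Setoid setoid
      f′ = f ∘ suc
      N  = fromℕ (suc n)
      g₂ = g (suc (suc n))
      ∂-suc : ∀ k → ∂ f′ k + f′ (suc k) ≈ ∂ f (suc k)
      ∂-suc k = solve 2 (λ N f → N :* f :+ f := (#1 :+ N) :* f) refl (fromℕ (suc k)) (f (suc (suc k)))

    expTerm : Carrier → ℕ → Carrier
    expTerm x k = x ^ k / fromℕ (k !)

    expSum : Carrier → ℕ → Carrier
    expSum x = sumℕ (expTerm x)

    *-cancelʳ : ∀ {x y z} → 0# < z → x * z ≈ y * z → x ≈ y
    *-cancelʳ 0<z xz≈yz = ≤-antisym (*-cancelʳ-≤ 0<z (≤-reflexive xz≈yz)) (*-cancelʳ-≤ 0<z (≤-reflexive (sym xz≈yz)))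

    factorial-pos : ∀ k → 0# < fromℕ (k !)
    factorial-pos k = <-≤-trans 0<1 (≤-trans (≤-reflexive (sym (+-identityʳ 1#))) (fromℕ-mono {1} {k !} (ℕ.1≤n! k)))

    expTerm-! : ∀ x k → expTerm x k * fromℕ (k !) ≈ x ^ k
    expTerm-! x k = /-cancel (x ^ k) (factorial-pos k)

    ∂-expTerm : ∀ x k → ∂ (expTerm x) k ≈ x * expTerm x k
    ∂-expTerm x k = *-cancelʳ (factorial-pos k) (begin
      (fromℕ (suc k) * expTerm x (suc k)) * fromℕ (k !)
        ≈⟨ solve 3 (λ a b c → (a :* b) :* c := b :* (a :* c)) refl (fromℕ (suc k)) (expTerm x (suc k)) (fromℕ (k !)) ⟩
      expTerm x (suc k) * (fromℕ (suc k) * fromℕ (k !)) ≈⟨ *-congˡ (fromℕ-* (suc k) (k !)) ⟨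
      expTerm x (suc k) * fromℕ (suc k !)               ≈⟨ expTerm-! x (suc k) ⟩
      x * x ^ k                                         ≈⟨ *-congˡ (expTerm-! x k) ⟨
      x * (expTerm x k * fromℕ (k !))                   ≈⟨ *-assoc _ _ _ ⟨
      x * expTerm x k * fromℕ (k !)                     ∎)
      where open import Relation.Binary.Reasoning.Setoid setoid

    expTerm-0 : ∀ x → expTerm x 0 ≈ 1#
    expTerm-0 x = trans (sym (trans (*-congˡ (+-identityʳ 1#)) (*-identityʳ _))) (expTerm-! x 0)

    expTerm-nonneg : 0# ≤ x → ∀ k → 0# ≤ expTerm x k
    expTerm-nonneg 0≤x k = *-nonneg (^-nonneg k 0≤x) (<⇒≤ (⁻¹-pos (factorial-pos k)))

    -- In place of the binomial theorem, a formal differential equation: both sides have constant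
    -- term 1 and derivative (x + y) times themselves, which determines each coefficient from the
    -- one before it.
    expTerm-+ : ∀ x y n → conv (expTerm x) (expTerm y) n ≈ expTerm (x + y) n
    expTerm-+ x y zero    = trans (*-cong (expTerm-0 x) (expTerm-0 y)) (trans (*-identityˡ 1#) (sym (expTerm-0 (x + y))))
    expTerm-+ x y (suc n) = *-cancelʳ (fromℕ-suc-pos n) (begin
      conv X Y (suc n) * fromℕ (suc n)      ≈⟨ *-comm _ _ ⟩
      fromℕ (suc n) * conv X Y (suc n)      ≈⟨ leibniz X Y n ⟩
      conv (∂ X) Y n + conv X (∂ Y) n       ≈⟨ +-cong (conv-cong n (∂-expTerm x) λ _ → refl) (conv-cong {X} n (λ _ → refl) (∂-expTerm y)) ⟩
      conv (λ k → x * X k) Y n + conv X (λ k → y * Y k) n ≈⟨ +-cong (conv-*ˡ x X Y n) (conv-*ʳ y X Y n) ⟩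
      x * conv X Y n + y * conv X Y n       ≈⟨ distribʳ _ _ _ ⟨
      (x + y) * conv X Y n                  ≈⟨ *-congˡ (expTerm-+ x y n) ⟩
      (x + y) * expTerm (x + y) n           ≈⟨ ∂-expTerm (x + y) n ⟨
      fromℕ (suc n) * expTerm (x + y) (suc n) ≈⟨ *-comm _ _ ⟩
      expTerm (x + y) (suc n) * fromℕ (suc n) ∎)
      where
      open import Relation.Binary.Reasoning.Setoid setoid
      X = expTerm x
      Y = expTerm y

    sumℕ-cong : ∀ {f g} n → (∀ k → f k ≈ g k) → sumℕ f n ≈ sumℕ g n
    sumℕ-cong zero    f≈g = refl
    sumℕ-cong (suc n) f≈g = +-cong (sumℕ-cong n f≈g) (f≈g n)

    expSum-triangle : ∀ x y n → triangle (expTerm x) (expTerm y) n ≈ expSum (x + y) n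
    expSum-triangle x y n = trans (triangle-sum (expTerm x) (expTerm y) n) (sumℕ-cong n (expTerm-+ x y))

    expSum-0 : ∀ n → expSum 0# (suc n) ≈ 1#
    expSum-0 zero    = trans (+-identityˡ _) (expTerm-0 0#)
    expSum-0 (suc n) = trans (+-cong (expSum-0 n) (trans (*-congʳ (zeroˡ _)) (zeroˡ _))) (+-identityʳ _)

  open ExponentialSeries

  -- The exponential function and the logarithm.

  module Exponential where

    private variable
      x y : Carrier

    half : Carrier
    half = 1# / fromℕ 2

    0<half : 0# < half
    0<half = /-pos 0<1 (fromℕ-suc-pos 1)

    half+half : ∀ x → x * half + x * half ≈ x
    half+half x = trans (solve 2 (λ x i → x :* (#1 :* i) :+ x :* (#1 :* i) := x :* (#2 :* i)) refl x (fromℕ 2 ⁻¹))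
      (trans (*-congˡ (*-inverse (fromℕ-suc-pos 1))) (*-identityʳ x))

    limit-≤ : ∀ {a b l m} → ConvergesTo a l → ConvergesTo b m → (∀ k → a k ≤ b k) → l ≤ m
    limit-≤ {a} {b} {l} {m} a→l b→m a≤b with em {l ≤ m}
    ... | yes l≤m = l≤m
    ... | no  l≰m = contradiction (a≤b k) (<⇒≱ (<-trans b<mid mid<a))
      where
      ε : Carrier
      ε = (l - m) * half
      0<ε : 0# < ε
      0<ε = *-pos (slack< (≰⇒> l≰m)) 0<half
      near-l = a→l ε 0<ε
      near-m = b→m ε 0<ε
      k = proj₁ near-l ℕ.⊔ proj₁ near-m
      b<mid : b k < m + ε
      b<mid = proj₂ (proj₂ near-m k (ℕ.m≤n⊔m (proj₁ near-l) (proj₁ near-m)))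
      mid<a : m + ε < a k
      mid<a = ≤-<-trans (≤-reflexive (trans (solve 3 (λ l m e → m :+ e := m :- l :+ e :+ l) refl l m ε)
          (trans (+-congʳ (+-congʳ (sym (trans (-‿cong (half+half (l - m))) (solve 2 (λ l m → :- (l :- m) := m :- l) refl l m)))))
            (solve 2 (λ e l → :- (e :+ e) :+ e :+ l := l :- e) refl ε l))))
        (proj₁ (proj₂ near-l k (ℕ.m≤m⊔n (proj₁ near-l) (proj₁ near-m))))

    limit-unique : ∀ {a l m} → ConvergesTo a l → ConvergesTo a m → l ≈ m
    limit-unique a→l a→m = ≤-antisym (limit-≤ a→l a→m λ _ → ≤-refl) (limit-≤ a→m a→l λ _ → ≤-refl)

    the-spec : ∀ (P : Carrier → Set) → ∃ P → P (the P)
    the-spec P ∃P with em {∃ P}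
    ... | yes (x , Px) = Px
    ... | no  ¬∃P      = contradiction ∃P ¬∃P

    IsSup : (ℕ → Carrier) → Carrier → Set
    IsSup a s = (∀ n → a n ≤ s) × (∀ u → (∀ n → a n ≤ u) → s ≤ u)

    sup-approached : ∀ {a s h} → IsSup a s → h < s → ∃[ n ] h < a n
    sup-approached {a} {s} {h} (_ , least-upper) h<s with em {∃[ n ] h < a n}
    ... | yes p  = p
    ... | no  ¬p = contradiction (least-upper h λ n → ≮⇒≥ λ h<a → ¬p (n , h<a)) (<⇒≱ h<s)

    monotone-limit : ∀ {a s} → (∀ {m n} → m ℕ.≤ n → a m ≤ a n) → IsSup a s → ConvergesTo a s
    monotone-limit {a} {s} mono sup@(upper , _) ε 0<ε with sup-approached sup s-ε<s
      where
      s-ε<s : s - ε < s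
      s-ε<s = unslack< (<-≤-trans 0<ε (≤-reflexive (solve 2 (λ s e → e := s :- (s :- e)) refl s ε)))
    ... | N , s-ε<aN = N , λ k N≤k → <-≤-trans s-ε<aN (mono N≤k)
      , ≤-<-trans (upper k) (unslack< (<-≤-trans 0<ε (≤-reflexive (solve 2 (λ s e → e := (s :+ e) :- s) refl s ε))))

    expSum-mono : 0# ≤ x → ∀ {m n} → m ℕ.≤ n → expSum x m ≤ expSum x n
    expSum-mono {x} 0≤x {m} {n} = sumℕ-mono {expTerm x} {m} {n} (expTerm-nonneg 0≤x)

    -- Past n ≥ 2x the terms at least halve, so expSum x n + 2 expTerm x n no longer increases.
    expSum-bounded : 0# ≤ x → ∃[ u ] ∀ n → expSum x n ≤ u
    expSum-bounded {x} 0≤x with archimedean (fromℕ 2 * x)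
    ... | N , 2x<N = expSum x N + fromℕ 2 * expTerm x N , bounded
      where
      halve : ∀ k → N ℕ.≤ k → fromℕ 2 * expTerm x (suc k) ≤ expTerm x k
      halve k N≤k = *-cancelʳ-≤ (fromℕ-suc-pos k) (≤-trans
        (≤-reflexive (trans (solve 3 (λ t T m → (t :* T) :* m := t :* (m :* T)) refl (fromℕ 2) (expTerm x (suc k)) (fromℕ (suc k)))
          (trans (*-congˡ (∂-expTerm x k)) (solve 3 (λ t x T → t :* (x :* T) := T :* (t :* x)) refl (fromℕ 2) x (expTerm x k)))))
        (*-monoʳ-≤ (expTerm-nonneg 0≤x k) (≤-trans (<⇒≤ 2x<N) (fromℕ-mono {N} {suc k} (ℕ.≤-trans N≤k (ℕ.n≤1+n k))))))
      decreasing : ∀ k → expSum x (N ℕ.+ k) + fromℕ 2 * expTerm x (N ℕ.+ k) ≤ expSum x N + fromℕ 2 * expTerm x N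
      decreasing zero    = ≤-reflexive (reflexive (≡.cong (λ n → expSum x n + fromℕ 2 * expTerm x n) (ℕ.+-identityʳ N)))
      decreasing (suc k) = ≤-trans
        (≤-reflexive (reflexive (≡.cong (λ n → expSum x n + fromℕ 2 * expTerm x n) (ℕ.+-suc N k))))
        (≤-trans (slack (halve (N ℕ.+ k) (ℕ.m≤m+n N k))
          by solve 3 (λ S T T′ → ((S :+ T) :+ #2 :* T′) :+ (T :- #2 :* T′) := S :+ #2 :* T) refl
               (expSum x (N ℕ.+ k)) (expTerm x (N ℕ.+ k)) (expTerm x (suc (N ℕ.+ k))))
          (decreasing k))
      bounded : ∀ n → expSum x n ≤ expSum x N + fromℕ 2 * expTerm x N
      bounded n = ≤-trans (expSum-mono 0≤x (ℕ.m≤n+m n N))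
        (≤-trans (*-nonneg (fromℕ-nonneg 2) (expTerm-nonneg 0≤x (N ℕ.+ n)) by refl) (decreasing n))

    expSeries : Carrier → ℕ → Carrier
    expSeries x N = ∑ (upTo N) λ k → x ^ k / fromℕ (k !)

    ConvergesTo-cong : ∀ {a b l} → (∀ k → a k ≈ b k) → ConvergesTo a l → ConvergesTo b l
    ConvergesTo-cong a≈b a→l ε 0<ε = let N , near = a→l ε 0<ε in
      N , λ k N≤k → let l-ε<a , a<l+ε = near k N≤k in
        <-≤-trans l-ε<a (≤-reflexive (a≈b k)) , ≤-<-trans (≤-reflexive (sym (a≈b k))) a<l+ε

    -- For nonnegative x the partial sums increase, so the limit described by `exp` exists and is
    -- their supremum. Upper bounds on `exp x` then reduce to upper bounds on all partial sums.
    exp-sup : 0# ≤ x → IsSup (expSum x) (exp x)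
    exp-sup {x} 0≤x with complete (λ y → ∃[ n ] y ≈ expSum x n) (_ , 0 , refl)
      (let u , ≤u = expSum-bounded 0≤x in u , λ { y (n , y≈) → ≤-trans (≤-reflexive y≈) (≤u n) })
    ... | s , upper , lowest = (λ n → ≤-trans (proj₁ sup n) (≤-reflexive s≈exp))
                             , λ u ≤u → ≤-trans (≤-reflexive (sym s≈exp)) (proj₂ sup u ≤u)
      where
      sup : IsSup (expSum x) s
      sup = (λ n → upper _ (n , refl)) , λ u ≤u → lowest u λ { y (n , y≈) → ≤-trans (≤-reflexive y≈) (≤u n) }
      converges : ConvergesTo (expSeries x) s
      converges = ConvergesTo-cong {expSum x} (λ k → sym (∑-upTo k (expTerm x))) (monotone-limit (λ {m} {n} → expSum-mono 0≤x {m} {n}) sup)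
      s≈exp : s ≈ exp x
      s≈exp = limit-unique converges (the-spec (ConvergesTo (expSeries x)) (s , converges))

    expSum≤exp : 0# ≤ x → ∀ n → expSum x n ≤ exp x
    expSum≤exp 0≤x = proj₁ (exp-sup 0≤x)

    expTerm≤exp : 0# ≤ x → ∀ n → expTerm x n ≤ exp x
    expTerm≤exp {x} 0≤x n = ≤-trans (sumℕ-nonneg n (expTerm-nonneg 0≤x) by +-comm _ _) (expSum≤exp 0≤x (suc n))

    1+x≤exp : 0# ≤ x → 1# + x ≤ exp x
    1+x≤exp {x} 0≤x = ≤-trans (≤-reflexive (sym (trans (+-congʳ (+-identityˡ _)) (+-cong (expTerm-0 x) expTerm-1))))
      (expSum≤exp 0≤x 2)
      where
      expTerm-1 : expTerm x 1 ≈ x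
      expTerm-1 = trans (solve 1 (λ t → t := (#1 :+ #0) :* t) refl (expTerm x 1))
        (trans (∂-expTerm x 0) (trans (*-congˡ (expTerm-0 x)) (*-identityʳ x)))

    1≤exp : 0# ≤ x → 1# ≤ exp x
    1≤exp 0≤x = ≤-trans (0≤x by refl) (1+x≤exp 0≤x)

    0<exp : 0# ≤ x → 0# < exp x
    0<exp 0≤x = <-≤-trans 0<1 (1≤exp 0≤x)

    exp-mono : 0# ≤ x → x ≤ y → exp x ≤ exp y
    exp-mono {x} {y} 0≤x x≤y = proj₂ (exp-sup 0≤x) (exp y) λ n → ≤-trans (go n) (expSum≤exp (≤-trans 0≤x x≤y) n)
      where
      go : ∀ n → expSum x n ≤ expSum y n
      go zero    = ≤-refl
      go (suc n) = +-mono-≤ (go n) (*-monoˡ-≤ (<⇒≤ (⁻¹-pos (factorial-pos n))) (^-mono-base n 0≤x x≤y))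

    exp-cong : 0# ≤ x → x ≈ y → exp x ≈ exp y
    exp-cong 0≤x x≈y = ≤-antisym (exp-mono 0≤x (≤-reflexive x≈y))
      (exp-mono (≤-trans 0≤x (≤-reflexive x≈y)) (≤-reflexive (sym x≈y)))

    exp-0 : exp 0# ≈ 1#
    exp-0 = ≤-antisym (proj₂ (exp-sup ≤-refl) 1# go) (1≤exp ≤-refl)
      where
      go : ∀ n → expSum 0# n ≤ 1#
      go zero    = 0≤1
      go (suc n) = ≤-reflexive (expSum-0 n)

    -- A triangle fits into a square and a rectangle fits into a larger triangle. For the second
    -- estimate the suprema are taken in one variable at a time, after dividing by the other factor.
    exp-+ : 0# ≤ x → 0# ≤ y → exp (x + y) ≈ exp x * exp y
    exp-+ {x} {y} 0≤x 0≤y = ≤-antisym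
      (proj₂ (exp-sup 0≤x+y) _ λ n → ≤-trans (≤-reflexive (sym (expSum-triangle x y n))) (triangle≤ n))
      (≤-trans (*-monoˡ-≤ 0≤ey (proj₂ (exp-sup 0≤x) (exp (x + y) / exp y) λ n → ≤-/ (0<exp 0≤y)
          (≤-trans (≤-reflexive (*-comm _ _)) (row n))))
        (≤-reflexive (/-cancel _ (0<exp 0≤y))))
      where
      0≤x+y = +-nonneg 0≤x 0≤y
      0≤ey = <⇒≤ (0<exp 0≤y)
      Sx≥0 : ∀ n → 0# ≤ expSum x n
      Sx≥0 n = sumℕ-nonneg n (expTerm-nonneg 0≤x)
      -- The zero sequence is bounded by any nonnegative one, and its corner vanishes.
      corner-nonneg : ∀ n → 0# ≤ corner (expTerm x) (expTerm y) n n
      corner-nonneg n = ≤-trans (≤-reflexive (sym (corner-zero n n (expTerm y))))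
        (corner-bound {expTerm x} {expTerm y} {λ _ → 0#} {expTerm y} n n ℕ.≤-refl
          (λ k → expTerm-nonneg 0≤x k , ≤-trans (≤-reflexive (solve 0 (:- #0 := #0) refl)) (expTerm-nonneg 0≤x k))
          (bounds-self (expTerm-nonneg 0≤y)))
        where
        corner-zero : ∀ n m g → corner (λ _ → 0#) g n m ≈ 0#
        corner-zero zero    m g = refl
        corner-zero (suc n) m g = trans (+-cong (zeroˡ _) (corner-zero n m g)) (+-identityˡ _)
      triangle≤ : ∀ n → triangle (expTerm x) (expTerm y) n ≤ exp x * exp y
      triangle≤ n = ≤-trans (corner-nonneg n by sym (rectangle (expTerm x) (expTerm y) n n))
        (*-mono-≤ (Sx≥0 n) 0≤ey (expSum≤exp 0≤x n) (expSum≤exp 0≤y n))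
      row : ∀ n → exp y * expSum x n ≤ exp (x + y)
      -- The empty partial sum is zero and cannot be divided by; from one term on the sums are at
      -- least 1.
      row zero    = ≤-trans (≤-reflexive (zeroʳ _)) (<⇒≤ (0<exp 0≤x+y))
      row (suc n) = ≤-trans (*-monoˡ-≤ (Sx≥0 (suc n)) (proj₂ (exp-sup 0≤y) (exp (x + y) / expSum x (suc n))
          λ m → ≤-/ 0<Sx (≤-trans (≤-reflexive (*-comm _ _))
            (≤-trans (rectangle≤triangle {expTerm x} {expTerm y} (suc n) m (expTerm-nonneg 0≤x) (expTerm-nonneg 0≤y))
              (≤-trans (≤-reflexive (expSum-triangle x y (suc n ℕ.+ m))) (expSum≤exp 0≤x+y (suc n ℕ.+ m)))))))
        (≤-reflexive (/-cancel _ 0<Sx))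
        where
        0<Sx : 0# < expSum x (suc n)
        0<Sx = <-≤-trans 0<1 (≤-trans (≤-reflexive (sym (trans (+-identityˡ _) (expTerm-0 x)))) (expSum-mono 0≤x {1} {suc n} (ℕ.s≤s ℕ.z≤n)))

    exp-^ : 0# ≤ x → ∀ n → exp (fromℕ n * x) ≈ exp x ^ n
    exp-^ {x} 0≤x zero    = trans (exp-cong (≤-reflexive (sym (zeroˡ x))) (zeroˡ x)) exp-0
    exp-^ {x} 0≤x (suc n) = trans (exp-cong (*-nonneg (fromℕ-nonneg (suc n)) 0≤x)
        (solve 2 (λ n x → (#1 :+ n) :* x := x :+ n :* x) refl (fromℕ n) x))
      (trans (exp-+ 0≤x (*-nonneg (fromℕ-nonneg n) 0≤x)) (*-congˡ (exp-^ 0≤x n)))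

    exp-cancel-≤ : 0# ≤ y → exp x ≤ exp y → x ≤ y
    exp-cancel-≤ {y} {x} 0≤y ex≤ey with em {x ≤ y}
    ... | yes x≤y = x≤y
    ... | no  x≰y = contradiction ex≤ey (<⇒≱ (<-≤-trans ey< (≤-reflexive (trans (sym (exp-+ 0≤y 0≤h))
        (exp-cong (+-nonneg 0≤y 0≤h) (solve 2 (λ x y → y :+ (x :- y) := x) refl x y))))))
      where
      0<h : 0# < x - y
      0<h = slack< (≰⇒> x≰y)
      0≤h : 0# ≤ x - y
      0≤h = <⇒≤ 0<h
      ey< : exp y < exp y * exp (x - y)
      ey< = <-≤-trans (unslack< (<-≤-trans (*-pos (0<exp 0≤y) 0<h)
          (≤-reflexive (solve 2 (λ e h → e :* h := e :* (#1 :+ h) :- e) refl (exp y) (x - y)))))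
        (*-monoʳ-≤ (<⇒≤ (0<exp 0≤y)) (1+x≤exp 0≤h))

    -- The terms x^n / n! are at most those of the geometric series. The product form of e^x ≤ 1 /
    -- (1 - x) avoids a quotient.
    exp-geometric : 0# ≤ x → x < 1# → exp x * (1# - x) ≤ 1#
    exp-geometric {x} 0≤x x<1 = ≤-trans (*-monoˡ-≤ (<⇒≤ 0<1-x) (proj₂ (exp-sup 0≤x) (1# / (1# - x)) λ n → ≤-/ 0<1-x
        (≤-trans (go n) (^-nonneg n 0≤x by solve 1 (λ p → (#1 :- p) :+ p := #1) refl (x ^ n)))))
      (≤-reflexive (/-cancel 1# 0<1-x))
      where
      0<1-x = slack< x<1
      expTerm≤^ : ∀ n → expTerm x n ≤ x ^ n
      expTerm≤^ n = /-≤ (factorial-pos n) (≤-trans (≤-reflexive (sym (*-identityʳ _)))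
        (*-monoʳ-≤ (^-nonneg n 0≤x) (≤-trans (≤-reflexive (sym (+-identityʳ 1#))) (fromℕ-mono {1} {n !} (ℕ.1≤n! n)))))
      go : ∀ n → expSum x n * (1# - x) ≤ 1# - x ^ n
      go zero    = ≤-reflexive (solve 1 (λ x → #0 :* (#1 :- x) := #1 :- #1) refl x)
      go (suc n) = ≤-trans (≤-reflexive (distribʳ _ _ _))
        (≤-trans (+-mono-≤ (go n) (*-monoˡ-≤ (<⇒≤ 0<1-x) (expTerm≤^ n)))
          (≤-reflexive (solve 2 (λ x p → (#1 :- p) :+ p :* (#1 :- x) := #1 :- x :* p) refl x (x ^ n))))

    -- The partial sums at y and at - y have product 1 up to a vanishing corner. Convergence at
    -- negative arguments is not needed: exp y is 0# if the series diverges.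
    exp-negative : ∀ y → y ≤ 0# → exp y ≤ 1#
    exp-negative y y≤0 with em {∃ (ConvergesTo (expSeries y))}
    ... | no  _ = 0≤1
    ... | yes (l , y→l) = ≮⇒≥ λ 1<l → impossible 1<l
      where
      z = - y
      0≤z : 0# ≤ z
      0≤z = ≤-trans (slack y≤0) (≤-reflexive (+-identityˡ _))
      0≤z+z = +-nonneg 0≤z 0≤z
      absolute : ∀ k → expTerm y k ≤ expTerm z k × - expTerm y k ≤ expTerm z k
      absolute k = from (power k)
        where
        power : ∀ k → y ^ k ≈ z ^ k ⊎ y ^ k ≈ - (z ^ k)
        power zero = inj₁ refl
        power (suc k) with power k
        ... | inj₁ eq = inj₂ (trans (*-congˡ eq) (solve 2 (λ y p → y :* p := :- (:- y :* p)) refl y (z ^ k)))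
        ... | inj₂ eq = inj₁ (trans (*-congˡ eq) (solve 2 (λ y p → y :* :- p := :- y :* p) refl y (z ^ k)))
        from : y ^ k ≈ z ^ k ⊎ y ^ k ≈ - (z ^ k) → expTerm y k ≤ expTerm z k × - expTerm y k ≤ expTerm z k
        from (inj₁ eq) = ≤-reflexive eq′ , ≤-trans (≤-reflexive (-‿cong eq′)) (proj₂ (bounds-self {expTerm z} (expTerm-nonneg 0≤z) k))
          where
          eq′ : expTerm y k ≈ expTerm z k
          eq′ = *-congʳ eq
        from (inj₂ eq) = ≤-trans (≤-reflexive eq′) (proj₂ (bounds-self {expTerm z} (expTerm-nonneg 0≤z) k))
                       , ≤-reflexive (trans (-‿cong eq′) (solve 1 (λ t → :- :- t := t) refl (expTerm z k)))
          where
          eq′ : expTerm y k ≈ - expTerm z k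
          eq′ = trans (*-congʳ eq) (solve 2 (λ p i → :- p :* i := :- (p :* i)) refl (z ^ k) (fromℕ (k !) ⁻¹))
      corner≤ : ∀ n → corner (expTerm y) (expTerm z) n n ≤ exp (z + z) - expSum (z + z) n
      corner≤ n = ≤-trans (corner-bound {expTerm z} {expTerm z} n n ℕ.≤-refl absolute
          (bounds-self (expTerm-nonneg 0≤z)))
        (slack (≤-trans (rectangle≤triangle {expTerm z} {expTerm z} n n (expTerm-nonneg 0≤z) (expTerm-nonneg 0≤z))
            (≤-trans (≤-reflexive (expSum-triangle z z (n ℕ.+ n))) (expSum≤exp 0≤z+z (n ℕ.+ n))))
          by trans (+-congˡ (+-congˡ (-‿cong (trans (rectangle (expTerm z) (expTerm z) n n) (+-congʳ (expSum-triangle z z n))))))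
             (solve 3 (λ c e s → c :+ (e :- (s :+ c)) := e :- s) refl (corner (expTerm z) (expTerm z) n n) (exp (z + z)) (expSum (z + z) n)))
      product : ∀ n → expSum y (suc n) * expSum z (suc n) ≤ 1# + (exp (z + z) - expSum (z + z) (suc n))
      product n = ≤-trans (≤-reflexive (trans (rectangle (expTerm y) (expTerm z) (suc n) (suc n))
          (+-congʳ (trans (expSum-triangle y z (suc n)) (trans (sumℕ-cong (suc n) (λ k → *-congʳ (^-congˡ k (-‿inverseʳ y)))) (expSum-0 n))))))
        (+-mono-≤ ≤-refl (corner≤ (suc n)))
      impossible : ¬ 1# < l
      impossible 1<l = <⇒≱ (<-trans (proj₁ (proj₂ near-l k N≤k)) (≤-<-trans S≤ (small k N′≤k))) mid
        where
        -- Half the excess of l over 1, so that l - ε = 1 + ε. The partial sums at y would finally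
        -- exceed this value, but they are at most their product with the partial sums at z, which
        -- tends to 1.
        ε = (l - 1#) * half
        0<ε : 0# < ε
        0<ε = *-pos (slack< 1<l) 0<half
        near-l = y→l ε 0<ε
        approached = sup-approached (exp-sup 0≤z+z) (unslack< {exp (z + z) - ε} (<-≤-trans 0<ε
          (≤-reflexive (solve 2 (λ s e → e := s :- (s :- e)) refl (exp (z + z)) ε))))
        N = proj₁ near-l
        N′ = proj₁ approached
        k = suc (N ℕ.⊔ N′)
        N≤k : N ℕ.≤ k
        N≤k = ℕ.≤-trans (ℕ.m≤m⊔n N N′) (ℕ.n≤1+n _)
        N′≤k : N′ ℕ.≤ k
        N′≤k = ℕ.≤-trans (ℕ.m≤n⊔m N N′) (ℕ.n≤1+n _)
        small : ∀ k → N′ ℕ.≤ k → 1# + (exp (z + z) - expSum (z + z) k) < 1# + ε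
        small k N′≤k = unslack< (<-≤-trans (slack< (<-≤-trans (proj₂ approached) (expSum-mono 0≤z+z N′≤k)))
          (≤-reflexive (solve 3 (λ s e E → s :- (E :- e) := (#1 :+ e) :- (#1 :+ (E :- s))) refl (expSum (z + z) k) ε (exp (z + z)))))
        1≤Sz : 1# ≤ expSum z k
        1≤Sz = ≤-trans (≤-reflexive (sym (trans (+-identityˡ _) (expTerm-0 z)))) (expSum-mono 0≤z {1} {k} (ℕ.s≤s ℕ.z≤n))
        mid : 1# + ε ≤ l - ε
        mid = ≤-reflexive (trans (solve 2 (λ e l → #1 :+ e := (#1 :- l :+ (e :+ e)) :+ (l :- e)) refl ε l)
          (trans (+-congʳ (trans (+-congˡ (half+half (l - 1#))) (solve 1 (λ l → #1 :- l :+ (l :- #1) := #0) refl l))) (+-identityˡ _)))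
        0<Sy : 0# ≤ expSum y k
        0<Sy = ≤-trans (<⇒≤ (<-≤-trans (+-pos 0<1 (<⇒≤ 0<ε)) mid))
          (≤-trans (<⇒≤ (proj₁ (proj₂ near-l k N≤k))) (≤-reflexive (∑-upTo k (expTerm y))))
        S≤ : expSeries y k ≤ 1# + (exp (z + z) - expSum (z + z) k)
        S≤ = ≤-trans (≤-reflexive (trans (∑-upTo k (expTerm y)) (sym (*-identityʳ _))))
          (≤-trans (*-monoʳ-≤ 0<Sy 1≤Sz) (product (N ℕ.⊔ N′)))

    -- Continuity of the exponential in multiplicative form, with a modulus that does not depend on
    -- x.
    exp-step : ∀ {h} → 0# ≤ x → 0# ≤ h → h < 1# → exp (x + h) * (1# - h) ≤ exp x
    exp-step {x} {h} 0≤x 0≤h h<1 = begin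
      exp (x + h) * (1# - h)      ≈⟨ *-congʳ (exp-+ 0≤x 0≤h) ⟩
      exp x * exp h * (1# - h)    ≈⟨ *-assoc _ _ _ ⟩
      exp x * (exp h * (1# - h))  ≤⟨ *-monoʳ-≤ (<⇒≤ (0<exp 0≤x)) (exp-geometric 0≤h h<1) ⟩
      exp x * 1#                  ≈⟨ *-identityʳ _ ⟩
      exp x                       ∎
      where open ≤-Reasoning

    private
      -- The choice h = (b - a) / 2b makes b (1 - h) the midpoint of a and b.
      below-by-half : ∀ {a b} → 0# < a → a < b → ∃[ h ] 0# < h × h < 1# × a < b * (1# - h)
      below-by-half {a} {b} 0<a a<b = h , 0<h , unslack< 0<1-h , a<
        where
        0<b = <-trans 0<a a<b
        d = (b - a) * half
        0<d : 0# < d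
        0<d = *-pos (slack< a<b) 0<half
        h = d / b
        0<h : 0# < h
        0<h = /-pos 0<d 0<b
        split : b * (1# - h) ≈ a + d
        split = trans (solve 2 (λ b h → b :* (#1 :- h) := b :- h :* b) refl b h)
          (trans (+-congˡ (-‿cong (/-cancel d 0<b))) (trans (solve 3 (λ b a d → b :- d := a :+ ((b :- a) :- d)) refl b a d)
            (+-congˡ (trans (+-congʳ (sym (half+half (b - a)))) (solve 1 (λ d → (d :+ d) :- d := d) refl d)))))
        a< : a < b * (1# - h)
        a< = <-≤-trans (unslack< (<-≤-trans 0<d (≤-reflexive (solve 2 (λ d a → d := (a :+ d) :- a) refl d a))))
          (≤-reflexive (sym split))
        0<1-h : 0# < 1# - h
        0<1-h = *-cancelʳ-< (<⇒≤ 0<b) (≤-<-trans (≤-reflexive (zeroˡ b))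
          (<-trans 0<a (<-≤-trans a< (≤-reflexive (*-comm _ _)))))

    private
      -- If `exp s` exceeds x by a definite factor, nothing within h of s has exponential at most x,
      -- so s - h is an upper bound as well.
      sup-not-above : ∀ {x s h} → 0# ≤ s → 0# < h → h < 1# → x < exp s * (1# - h) →
        ∀ y → 0# ≤ y → exp y ≤ x → y ≤ s - h
      sup-not-above {x} {s} {h} 0≤s 0<h h<1 x< y 0≤y ey≤x = ≮⇒≥ λ s-h<y → <⇒≱ x< (chain (shift s-h<y))
        where
        open ≤-Reasoning
        shift : s - h < y → s ≤ y + h
        shift s-h<y = slack (<⇒≤ s-h<y) by solve 3 (λ s h y → s :+ (y :- (s :- h)) := y :+ h) refl s h y
        chain : s ≤ y + h → exp s * (1# - h) ≤ x
        chain s≤y+h = begin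
          exp s * (1# - h)        ≤⟨ *-monoˡ-≤ (<⇒≤ (slack< h<1)) (exp-mono 0≤s s≤y+h) ⟩
          exp (y + h) * (1# - h)  ≤⟨ exp-step 0≤y (<⇒≤ 0<h) h<1 ⟩
          exp y                   ≤⟨ ey≤x ⟩
          x                       ∎

      sup-not-below : ∀ {x s h} → 0# ≤ s → 0# < h → h < 1# → exp s < x * (1# - h) → exp (s + h) ≤ x
      sup-not-below 0≤s 0<h h<1 es< = *-cancelʳ-≤ (slack< h<1) (≤-trans (exp-step 0≤s (<⇒≤ 0<h) h<1) (<⇒≤ es<))

      s-h<s : ∀ s {h} → 0# < h → s - h < s
      s-h<s s {h} 0<h = unslack< (<-≤-trans 0<h (≤-reflexive (solve 2 (λ s h → h := s :- (s :- h)) refl s h)))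

      s<s+h : ∀ s {h} → 0# < h → s < s + h
      s<s+h s {h} 0<h = unslack< (<-≤-trans 0<h (≤-reflexive (solve 2 (λ s h → h := (s :+ h) :- s) refl s h)))

    -- An intermediate value argument with the supremum of the y ≥ 0 that have exp y ≤ x. This set
    -- contains 0 because 1 ≤ x, and 1 + y ≤ exp y bounds it by x.
    exp-onto : 1# ≤ x → ∃[ y ] exp y ≈ x
    exp-onto {x} 1≤x = attained (complete Below (0# , ≤-refl , exp0≤x) (x , bounded))
      where
      Below : Carrier → Set
      Below y = 0# ≤ y × exp y ≤ x

      exp0≤x : exp 0# ≤ x
      exp0≤x = ≤-trans (≤-reflexive exp-0) 1≤x

      bounded : ∀ y → Below y → y ≤ x
      bounded y (0≤y , ey≤x) = ≤-trans (0≤1 by +-comm y 1#) (≤-trans (1+x≤exp 0≤y) ey≤x)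

      attained : (∃[ s ] (∀ y → Below y → y ≤ s) × (∀ u → (∀ y → Below y → y ≤ u) → s ≤ u)) → ∃[ y ] exp y ≈ x
      attained (s , upper , lowest) = s , ≤-antisym (≮⇒≥ x≮) (≮⇒≥ ≮x)
        where
        0≤s : 0# ≤ s
        0≤s = upper 0# (≤-refl , exp0≤x)

        x≮ : ¬ x < exp s
        x≮ x<es = let h , 0<h , h<1 , x< = below-by-half (<-≤-trans 0<1 1≤x) x<es in
          <⇒≱ (s-h<s s 0<h) (lowest (s - h) λ y (0≤y , ey≤x) → sup-not-above 0≤s 0<h h<1 x< y 0≤y ey≤x)

        ≮x : ¬ exp s < x
        ≮x es<x = let h , 0<h , h<1 , es< = below-by-half (0<exp 0≤s) es<x in
          <⇒≱ (s<s+h s 0<h) (upper (s + h) (+-nonneg 0≤s (<⇒≤ 0<h) , sup-not-below 0≤s 0<h h<1 es<))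

    exp-ln : 1# ≤ x → exp (ln x) ≈ x
    exp-ln {x} 1≤x = the-spec (λ y → exp y ≈ x) (exp-onto 1≤x)

    -- `ln x` is merely some solution of exp y ≈ x, possibly negative as far as its description
    -- goes. Its sign comes from the bound of `exp` by 1 on nonpositive arguments.
    ln-pos : 1# < x → 0# < ln x
    ln-pos {x} 1<x = ≰⇒> ln≰0
      where
      ln≰0 : ¬ (ln x ≤ 0#)
      ln≰0 ln≤0 = <⇒≱ {1#} {x} 1<x (≤-trans {x} {exp (ln x)} {1#}
        (≤-reflexive {x} {exp (ln x)} (sym {exp (ln x)} {x} (exp-ln {x} (<⇒≤ 1<x)))) (exp-negative (ln x) ln≤0))

    exp-ln-^ : 1# < x → ∀ n → exp (fromℕ n * ln x) ≈ x ^ n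
    exp-ln-^ {x} 1<x n = trans {exp (fromℕ n * ln x)} {exp (ln x) ^ n} {x ^ n}
      (exp-^ {ln x} (<⇒≤ (ln-pos {x} 1<x)) n) (^-congˡ n {exp (ln x)} {x} (exp-ln {x} (<⇒≤ 1<x)))

    -- Logarithms enter only through comparisons of natural powers, so powers with real exponents
    -- never have to be defined.
    ^-ln-≤ : ∀ {x y} m n → 1# < x → 1# < y → fromℕ m * ln x ≤ fromℕ n * ln y → x ^ m ≤ y ^ n
    ^-ln-≤ {x} {y} m n 1<x 1<y m≤n = ≤-trans {x ^ m} {exp (fromℕ m * ln x)} {y ^ n}
      (≤-reflexive (sym {exp (fromℕ m * ln x)} {x ^ m} (exp-ln-^ 1<x m)))
      (≤-trans {exp (fromℕ m * ln x)} {exp (fromℕ n * ln y)} {y ^ n}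
        (exp-mono (*-nonneg (fromℕ-nonneg m) (<⇒≤ (ln-pos 1<x))) m≤n)
        (≤-reflexive (exp-ln-^ 1<y n)))

    -- n^n / n! is a single term of the series of e^n. This is the bound k! ≥ (k/e)^k behind the
    -- estimate of binomial coefficients.
    self-power≤ : ∀ n → fromℕ n ^ n ≤ fromℕ (n !) * exp 1# ^ n
    self-power≤ n = begin
      fromℕ n ^ n                             ≈⟨ expTerm-! (fromℕ n) n ⟨
      expTerm (fromℕ n) n * fromℕ (n !)       ≤⟨ *-monoˡ-≤ (fromℕ-nonneg (n !)) (expTerm≤exp {fromℕ n} (fromℕ-nonneg n) n) ⟩
      exp (fromℕ n) * fromℕ (n !)             ≈⟨ *-comm _ _ ⟩
      fromℕ (n !) * exp (fromℕ n)             ≈⟨ *-congˡ (exp-cong {fromℕ n} {fromℕ n * 1#} (fromℕ-nonneg n) (sym (*-identityʳ _))) ⟩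
      fromℕ (n !) * exp (fromℕ n * 1#)        ≈⟨ *-congˡ (exp-^ {1#} 0≤1 n) ⟩
      fromℕ (n !) * exp 1# ^ n                ∎
      where open ≤-Reasoning

  open Exponential

  -- Counting, greedy colouring and Abel summation on lists.

  module Lists where

    private variable
      A B : Set
      n : ℕ

    -- Double counting of the related pairs: every x occurs in at least one, every y in at most one.
    -- A relation saves choosing images by a function.
    length-injection : ∀ {xs : List A} {ys : List B} (R : A → B → Set) → Unique xs →
      (∀ {x} → x ∈ˡ xs → ∃[ y ] y ∈ˡ ys × R x y) → (∀ {x x′ y} → R x y → R x′ y → x ≡ x′) →
      length xs ℕ.≤ length ys
    length-injection {xs = xs} {ys} R uniq image injective = fromℕ-cancel-≤ (begin
      fromℕ (length xs)                      ≈⟨ length-∑ xs ⟩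
      ∑ xs (λ _ → 1#)                        ≤⟨ ∑-mono-∈ xs (λ x x∈ → let y , y∈ , Rxy = image x∈ in 1≤∑𝟙 {P = R x} y∈ Rxy) ⟩
      ∑ xs (λ x → ∑ ys (λ y → 𝟙 (R x y)))    ≈⟨ ∑-swap xs ys _ ⟩
      ∑ ys (λ y → ∑ xs (λ x → 𝟙 (R x y)))    ≤⟨ ∑-mono ys (λ y → ≤-trans (∑𝟙-unique {P = λ x → R x y} {Q = Unit} xs uniq injective (λ _ → tt)) (𝟙≤1 Unit)) ⟩
      ∑ ys (λ _ → 1#)                        ≈⟨ length-∑ ys ⟨
      fromℕ (length ys)                      ∎)
      where open ≤-Reasoning

    ∑-unique-list : ∀ {xs : List (Fin n)} → Unique xs → (f : Fin n → Carrier) →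
      ∑ xs f ≈ ∑ (allFin n) (λ v → 𝟙 (v ∈ˡ xs) * f v)
    ∑-unique-list {n} {xs} uniq f = begin
      ∑ xs f
        ≈⟨ ∑-cong xs (λ x → sym (trans (∑-single {f = λ v → 𝟙 (v ≡ x) * f v} (Unique.allFin⁺ n) (∈ˡ.∈-allFin x)
             (λ v v≢x → trans (*-congʳ (𝟙-false v≢x)) (zeroˡ _))) (trans (*-congʳ (𝟙-true ≡.refl)) (*-identityˡ _)))) ⟩
      ∑ xs (λ x → ∑ (allFin n) (λ v → 𝟙 (v ≡ x) * f v))  ≈⟨ ∑-swap xs (allFin n) _ ⟩
      ∑ (allFin n) (λ v → ∑ xs (λ x → 𝟙 (v ≡ x) * f v))  ≈⟨ ∑-cong (allFin n) (λ v → trans (∑-*ʳ xs (f v) _) (*-congʳ (count v))) ⟩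
      ∑ (allFin n) (λ v → 𝟙 (v ∈ˡ xs) * f v)             ∎
      where
      open import Relation.Binary.Reasoning.Setoid setoid
      count : ∀ v → ∑ xs (λ x → 𝟙 (v ≡ x)) ≈ 𝟙 (v ∈ˡ xs)
      count v with em {v ∈ˡ xs}
      ... | yes v∈ = trans (∑-single {f = λ x → 𝟙 (v ≡ x)} uniq v∈ (λ x x≢v → 𝟙-false (x≢v ∘ ≡.sym))) (𝟙-true ≡.refl)
      ... | no  v∉ = trans (∑-cong-∈ xs λ x x∈ → 𝟙-false λ { ≡.refl → v∉ x∈ }) (∑-zero xs)

    fresh : ∀ (cs : List ℕ) d → length cs ℕ.< d → ∃[ c ] c ℕ.< d × c ∉ˡ cs
    fresh cs d cs<d with em {∃[ c ] c ℕ.< d × c ∉ˡ cs}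
    ... | yes found = found
    ... | no  none  = contradiction (length-injection {xs = upTo d} {cs} _≡_ (Unique.upTo⁺ d) used λ { ≡.refl ≡.refl → ≡.refl })
      (ℕ.<⇒≱ (≡.subst (length cs ℕ.<_) (≡.sym (List.length-upTo d)) cs<d))
      where
      used : ∀ {c} → c ∈ˡ upTo d → ∃[ c′ ] c′ ∈ˡ cs × c ≡ c′
      used {c} c∈ with em {c ∈ˡ cs}
      ... | yes c∈cs = c , c∈cs , ≡.refl
      ... | no  c∉cs = contradiction (c , ∈ˡ.∈-upTo⁻ c∈ , c∉cs) none

    module Colouring (_~_ : A → A → Set) (~-sym : ∀ {x y} → x ~ y → y ~ x) where

      degree : A → List A → ℕ
      degree x xs = length (select (x ~_) xs)

      -- A degeneracy order: each entry has fewer than d neighbours after it, so greedy colouring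
      -- from the end of the list always has a free colour among d.
      data Degenerate (d : ℕ) : List A → Set where
        []  : Degenerate d []
        _∷_ : ∀ {x xs} → degree x xs ℕ.< d → Degenerate d xs → Degenerate d (x ∷ xs)

      IsColouring : (A → ℕ) → ℕ → List A → Set
      IsColouring col d xs = (∀ {x} → x ∈ˡ xs → col x ℕ.< d)
        × (∀ {x y} → x ∈ˡ xs → y ∈ˡ xs → x ≢ y → x ~ y → col x ≢ col y)

      greedy : ∀ {d xs} → Unique xs → Degenerate d xs → ∃[ col ] IsColouring col d xs
      greedy {xs = []} _ _ = (λ _ → 0) , (λ ()) , (λ ())
      greedy {d} {x ∷ xs} (x∉ ∷ uniq) (deg ∷ degs) with greedy uniq degs
      ... | col , col<d , proper
        with fresh (map col (select (x ~_) xs)) d (≡.subst (ℕ._< d) (≡.sym (List.length-map col (select (x ~_) xs))) deg)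
      ... | c , c<d , c∉ = col′ , col′<d , proper′
        where
        col′ : A → ℕ
        col′ z with em {z ≡ x}
        ... | yes _ = c
        ... | no  _ = col z
        col′-x : col′ x ≡ c
        col′-x with em {x ≡ x}
        ... | yes _   = ≡.refl
        ... | no  x≢x = contradiction ≡.refl x≢x
        col′-xs : ∀ {z} → z ∈ˡ xs → col′ z ≡ col z
        col′-xs {z} z∈ with em {z ≡ x}
        ... | yes ≡.refl = contradiction ≡.refl (All.lookup x∉ z∈)
        ... | no  _      = ≡.refl
        new : ∀ {y} → y ∈ˡ xs → x ~ y → col′ x ≢ col′ y
        new {y} y∈ x~y eq = c∉ (≡.subst (_∈ˡ _) (≡.trans (≡.sym (col′-xs y∈)) (≡.trans (≡.sym eq) col′-x))
          (∈ˡ.∈-map⁺ col (∈-select⁺ (x ~_) y∈ x~y)))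
        col′<d : ∀ {z} → z ∈ˡ x ∷ xs → col′ z ℕ.< d
        col′<d (here ≡.refl) = ≡.subst (ℕ._< d) (≡.sym col′-x) c<d
        col′<d (there z∈)    = ≡.subst (ℕ._< d) (≡.sym (col′-xs z∈)) (col<d z∈)
        proper′ : ∀ {y z} → y ∈ˡ x ∷ xs → z ∈ˡ x ∷ xs → y ≢ z → y ~ z → col′ y ≢ col′ z
        proper′ (here ≡.refl) (here ≡.refl) y≢z _   = contradiction ≡.refl y≢z
        proper′ (here ≡.refl) (there z∈)    _   x~z = new z∈ x~z
        proper′ (there y∈)    (here ≡.refl) _   y~x = new y∈ (~-sym y~x) ∘ ≡.sym
        proper′ (there y∈)    (there z∈)    y≢z y~z eq =
          proper y∈ z∈ y≢z y~z (≡.trans (≡.sym (col′-xs y∈)) (≡.trans eq (col′-xs z∈)))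

    -- The summand also sees the list behind the current entry, so it can speak of later neighbours.
    tailSum : (A → List A → Carrier) → List A → Carrier
    tailSum φ []       = 0#
    tailSum φ (v ∷ vs) = φ v vs + tailSum φ vs

    tailSum-cong : ∀ {φ ψ : A → List A → Carrier} xs → (∀ v vs → φ v vs ≈ ψ v vs) → tailSum φ xs ≈ tailSum ψ xs
    tailSum-cong []       φ≈ψ = refl
    tailSum-cong (v ∷ vs) φ≈ψ = +-cong (φ≈ψ v vs) (tailSum-cong vs φ≈ψ)

    tailSum-mono : ∀ {φ ψ : A → List A → Carrier} xs → (∀ v vs → φ v vs ≤ ψ v vs) → tailSum φ xs ≤ tailSum ψ xs
    tailSum-mono []       φ≤ψ = ≤-refl
    tailSum-mono (v ∷ vs) φ≤ψ = +-mono-≤ (φ≤ψ v vs) (tailSum-mono vs φ≤ψ)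

    tailSum-+ : ∀ (φ ψ : A → List A → Carrier) xs →
      tailSum (λ v vs → φ v vs + ψ v vs) xs ≈ tailSum φ xs + tailSum ψ xs
    tailSum-+ φ ψ []       = sym (+-identityˡ 0#)
    tailSum-+ φ ψ (v ∷ vs) = trans (+-congˡ (tailSum-+ φ ψ vs))
      (solve 4 (λ a b c d → (a :+ b) :+ (c :+ d) := (a :+ c) :+ (b :+ d)) refl (φ v vs) (ψ v vs) (tailSum φ vs) (tailSum ψ vs))

    tailSum-*ˡ : ∀ c (φ : A → List A → Carrier) xs → tailSum (λ v vs → c * φ v vs) xs ≈ c * tailSum φ xs
    tailSum-*ˡ c φ []       = sym (zeroʳ c)
    tailSum-*ˡ c φ (v ∷ vs) = trans (+-congˡ (tailSum-*ˡ c φ vs)) (sym (distribˡ c _ _))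

    tailSum-∑ : ∀ (f : A → Carrier) xs → tailSum (λ v _ → f v) xs ≈ ∑ xs f
    tailSum-∑ f []       = refl
    tailSum-∑ f (v ∷ vs) = +-congˡ (tailSum-∑ f vs)

    data Suffix {A : Set} (zs : List A) : List A → Set where
      all : Suffix zs zs
      drop  : ∀ {y ys} → Suffix zs ys → Suffix zs (y ∷ ys)

    Suffix-length : ∀ {zs ys : List A} → Suffix zs ys → length zs ℕ.≤ length ys
    Suffix-length all    = ℕ.≤-refl
    Suffix-length (drop s) = ℕ.m≤n⇒m≤1+n (Suffix-length s)

    -- The weighted sum is m times the whole sum plus nonnegative increments of y times suffix sums,
    -- which are nonpositive. The lower bound m is a parameter because the induction raises it to
    -- the weight just passed.
    abel : ∀ (y : A → Carrier) (φ : A → List A → Carrier) {xs} → AllPairs (λ u v → y u ≤ y v) xs →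
      (∀ {zs} → Suffix zs xs → tailSum φ zs ≤ 0#) → ∀ m → All (λ v → m ≤ y v) xs →
      tailSum (λ v vs → y v * φ v vs) xs ≤ m * tailSum φ xs
    abel y φ [] _ m _ = ≤-reflexive (sym (zeroʳ m))
    abel y φ {v ∷ vs} (v≤ ∷ sorted) nonpos m (m≤v ∷ _) = ≤-trans
      (+-mono-≤ ≤-refl (abel y φ sorted (nonpos ∘ drop) (y v) v≤))
      (*-nonneg (slack m≤v) (≤-trans (slack (nonpos all)) (≤-reflexive (+-identityˡ _)))
        by solve 4 (λ y m f s → (y :* f :+ y :* s) :+ (y :- m) :* :- (f :+ s) := m :* (f :+ s)) refl (y v) m (φ v vs) (tailSum φ vs))

    positive-suffix : ∀ (y : A → Carrier) (φ : A → List A → Carrier) {xs} → (∀ v → 0# ≤ y v) →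
      AllPairs (λ u v → y u ≤ y v) xs → 0# < tailSum (λ v vs → y v * φ v vs) xs →
      ∃[ zs ] Suffix zs xs × 0# < tailSum φ zs
    positive-suffix y φ {xs} 0≤y sorted pos with em {∃[ zs ] Suffix zs xs × 0# < tailSum φ zs}
    ... | yes found = found
    ... | no  none  = contradiction
      (≤-trans (abel y φ sorted (λ {zs} s → ≮⇒≥ λ 0< → none (zs , s , 0<)) 0# (All.universal 0≤y xs)) (≤-reflexive (zeroˡ _)))
      (<⇒≱ pos)

    sorted-enumeration : ∀ (y : Fin n → Carrier) →
      ∃[ ys ] AllPairs (λ u v → y u ≤ y v) ys × Unique ys × (∀ v → v ∈ˡ ys)
    sorted-enumeration {n} y = sort (allFin n)
      , SortedProperties.Sorted⇒AllPairs totalOrder (sort-↗ (allFin n))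
      , Unique-resp-↭ (Permutation.↭⇒↭ₛ (↭-sym (sort-↭ (allFin n)))) (Unique.allFin⁺ n)
      , λ v → ∈-resp-↭ (↭-sym (sort-↭ (allFin n))) (∈ˡ.∈-allFin v)
      where
      ℝ-order : DecTotalOrder 0ℓ 0ℓ 0ℓ
      ℝ-order = record { isDecTotalOrder = record { isTotalOrder = isTotalOrder ; _≟_ = λ _ _ → em ; _≤?_ = λ _ _ → em } }
      open DecTotalOrder (On.decTotalOrder ℝ-order y) using (totalOrder)
      open Sort (On.decTotalOrder ℝ-order y)
      open Permutation using (↭-sym)
      open PermutationProperties using (∈-resp-↭)
      open PermutationSetoidProperties (≡.setoid (Fin n)) using (Unique-resp-↭)

    choose : ℕ → List A → List (List A)
    choose zero    _        = [] ∷ []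
    choose (suc k) []       = []
    choose (suc k) (x ∷ xs) = map (x ∷_) (choose k xs) ++ choose (suc k) xs

    choose-suffix : ∀ k {zs ys : List A} → Suffix zs ys → ∀ {W} → W ∈ˡ choose k zs → W ∈ˡ choose k ys
    choose-suffix k       all    W∈ = W∈
    choose-suffix zero    (drop s) W∈ = W∈
    choose-suffix (suc k) (drop s) W∈ = ∈ˡ.∈-++⁺ʳ _ (choose-suffix (suc k) s W∈)

    ∈-choose-select : ∀ (P : A → Set) xs → select P xs ∈ˡ choose (length (select P xs)) xs
    ∈-choose-select P []       = here ≡.refl
    ∈-choose-select P (x ∷ xs) with em {P x}
    ... | yes _ = ∈ˡ.∈-++⁺ˡ (∈ˡ.∈-map⁺ _ (∈-choose-select P xs))
    ... | no  _ = choose-suffix (length (select P xs)) (drop all) (∈-choose-select P xs)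

    -- The right-hand side contains these two terms in its binomial expansion. They match the two
    -- branches of Pascal's recursion in `choose`.
    power-step : ∀ j k → suc k ℕ.* j ℕ.^ k ℕ.+ j ℕ.^ suc k ℕ.≤ suc j ℕ.^ suc k
    power-step j zero    = ℕ.≤-refl
    power-step j (suc k) = begin
      suc (suc k) ℕ.* (j ℕ.* j ℕ.^ k) ℕ.+ j ℕ.* (j ℕ.* j ℕ.^ k)
        ≡⟨ solveℕ 3 (λ j k p → (conℕ 2 ⊕ k) ⊗ (j ⊗ p) ⊕ j ⊗ (j ⊗ p) ⊜ j ⊗ p ⊕ j ⊗ ((conℕ 1 ⊕ k) ⊗ p ⊕ j ⊗ p)) ≡.refl j k (j ℕ.^ k) ⟩
      j ℕ.^ suc k ℕ.+ j ℕ.* (suc k ℕ.* j ℕ.^ k ℕ.+ j ℕ.^ suc k)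
        ≤⟨ ℕ.+-mono-≤ (ℕ.^-monoˡ-≤ (suc k) (ℕ.n≤1+n j)) (ℕ.*-monoʳ-≤ j (power-step j k)) ⟩
      suc j ℕ.^ suc k ℕ.+ j ℕ.* suc j ℕ.^ suc k
        ∎
      where
      open ℕ.≤-Reasoning
      open import Data.Nat.Solver using (module +-*-Solver)
      open +-*-Solver using () renaming (solve to solveℕ; con to conℕ; _:+_ to _⊕_; _:*_ to _⊗_; _:=_ to _⊜_)

    choose-length : ∀ k (xs : List A) → k ! ℕ.* length (choose k xs) ℕ.≤ length xs ℕ.^ k
    choose-length zero    xs       = ℕ.≤-refl
    choose-length (suc k) []       = ℕ.≤-reflexive (ℕ.*-zeroʳ (suc k !))
    choose-length (suc k) (x ∷ xs) = begin
      suc k ! ℕ.* length (map (x ∷_) (choose k xs) ++ choose (suc k) xs)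
        ≡⟨ ≡.cong (suc k ! ℕ.*_) (≡.trans (List.length-++ (map (x ∷_) (choose k xs))) (≡.cong (ℕ._+ _) (List.length-map _ (choose k xs)))) ⟩
      suc k ! ℕ.* (length (choose k xs) ℕ.+ length (choose (suc k) xs))
        ≡⟨ ℕ.*-distribˡ-+ (suc k !) (length (choose k xs)) _ ⟩
      suc k ! ℕ.* length (choose k xs) ℕ.+ suc k ! ℕ.* length (choose (suc k) xs)
        ≡⟨ ≡.cong (ℕ._+ suc k ! ℕ.* length (choose (suc k) xs)) (ℕ.*-assoc (suc k) (k !) _) ⟩
      suc k ℕ.* (k ! ℕ.* length (choose k xs)) ℕ.+ suc k ! ℕ.* length (choose (suc k) xs)
        ≤⟨ ℕ.+-mono-≤ (ℕ.*-monoʳ-≤ (suc k) (choose-length k xs)) (choose-length (suc k) xs) ⟩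
      suc k ℕ.* length xs ℕ.^ k ℕ.+ length xs ℕ.^ suc k
        ≤⟨ power-step (length xs) k ⟩
      suc (length xs) ℕ.^ suc k
        ∎
      where open ℕ.≤-Reasoning

    -- The longest suffix that satisfies the length bound. Every suffix that is short enough is a
    -- suffix of it, so a single pool of vertices serves each cardinality.
    trim : Carrier → List A → List A
    trim bound []       = []
    trim bound (x ∷ xs) with em {fromℕ 2 * fromℕ (length (x ∷ xs)) ≤ bound}
    ... | yes _ = x ∷ xs
    ... | no  _ = trim bound xs

    trim-length : ∀ {bound} → 0# ≤ bound → (xs : List A) → fromℕ 2 * fromℕ (length (trim bound xs)) ≤ bound
    trim-length {bound = bound} 0≤b [] = ≤-trans (≤-reflexive (zeroʳ _)) 0≤b
    trim-length {bound = bound} 0≤b (x ∷ xs) with em {fromℕ 2 * fromℕ (length (x ∷ xs)) ≤ bound}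
    ... | yes short = short
    ... | no  _     = trim-length 0≤b xs

    trim-suffix : ∀ {bound} {zs xs : List A} → Suffix zs xs → fromℕ 2 * fromℕ (length zs) ≤ bound → Suffix zs (trim bound xs)
    trim-suffix {xs = []} all _ = all
    trim-suffix {bound = bound} {xs = x ∷ xs} s short with em {fromℕ 2 * fromℕ (length (x ∷ xs)) ≤ bound}
    ... | yes _ = s
    trim-suffix all    short | no long = contradiction short long
    trim-suffix (drop s) short | no _    = trim-suffix s short

  open Lists

  -- Fractional colourings, weak duality and the maximum `hf`.

  module Graphs where

    -- Completeness is an axiom about suprema, so the infimum arises as the supremum of the lower
    -- bounds.
    infimum-exists : ∀ (P : Carrier → Set) → ∃ P → (∀ s → P s → 0# ≤ s) → ∃ (IsInfimum P)
    infimum-exists P (s₀ , Ps₀) 0≤ with complete (λ l → ∀ s → P s → l ≤ s) (0# , 0≤) (s₀ , λ l l≤ → l≤ s₀ Ps₀)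
    ... | i , upper , lowest = i , (λ s Ps → lowest s λ l l≤ → l≤ s Ps) , λ l l≤ → upper l l≤

    module GraphTheory (G : Graph) where

      Vertex Edge : Set
      Vertex = Fin (order G)
      Edge   = Fin (size G)

      vertices : List Vertex
      vertices = allFin (order G)

      module _ {e : Edge} where

        Joins-sym : ∀ {u v} → Joins G e u v → Joins G e v u
        Joins-sym (inj₁ eq) = inj₂ eq
        Joins-sym (inj₂ eq) = inj₁ eq

        Joins-irreflexive : ∀ {u v} → Joins G e u v → u ≢ v
        Joins-irreflexive (inj₁ eq) ≡.refl = ℕ.<-irrefl ≡.refl (≡.subst (λ (a , b) → a Fin.< b) eq (ends-increasing G e))
        Joins-irreflexive (inj₂ eq) ≡.refl = ℕ.<-irrefl ≡.refl (≡.subst (λ (a , b) → a Fin.< b) eq (ends-increasing G e))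

        Joins-injective : ∀ {u v v′} → Joins G e u v → Joins G e u v′ → v ≡ v′
        Joins-injective (inj₁ p) (inj₁ q) = ≡.cong proj₂ (≡.trans (≡.sym p) q)
        Joins-injective (inj₂ p) (inj₂ q) = ≡.cong proj₁ (≡.trans (≡.sym p) q)
        Joins-injective (inj₁ p) (inj₂ q) with ≡.trans (≡.sym p) q
        ... | ≡.refl = ≡.refl
        Joins-injective (inj₂ p) (inj₁ q) with ≡.trans (≡.sym p) q
        ... | ≡.refl = ≡.refl

        ends-Joins : Joins G e (proj₁ (ends G e)) (proj₂ (ends G e))
        ends-Joins = inj₁ ≡.refl

        Joins-ends : ∀ {u v} {P : Vertex → Set} → Joins G e u v → P (proj₁ (ends G e)) → P (proj₂ (ends G e)) → P u × P v
        Joins-ends {P = P} (inj₁ eq) p q = ≡.subst P (≡.cong proj₁ eq) p , ≡.subst P (≡.cong proj₂ eq) q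
        Joins-ends {P = P} (inj₂ eq) p q = ≡.subst P (≡.cong proj₂ eq) q , ≡.subst P (≡.cong proj₁ eq) p

        ends-Joins⁻ : ∀ {u v} {P : Vertex → Set} → Joins G e u v → P u → P v → P (proj₁ (ends G e)) × P (proj₂ (ends G e))
        ends-Joins⁻ {P = P} (inj₁ eq) p q = ≡.subst P (≡.sym (≡.cong proj₁ eq)) p , ≡.subst P (≡.sym (≡.cong proj₂ eq)) q
        ends-Joins⁻ {P = P} (inj₂ eq) p q = ≡.subst P (≡.sym (≡.cong proj₁ eq)) q , ≡.subst P (≡.sym (≡.cong proj₂ eq)) p

      IndependentIn : (Edge → Set) → (Vertex → Set) → Set
      IndependentIn F P = ∀ {e} → F e → ¬ (P (proj₁ (ends G e)) × P (proj₂ (ends G e)))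

      independent-subsets : Subgraph G → List (Subset (order G))
      independent-subsets H = select (Independent H) (subsets (order G))

      HasTotalWeight : Subgraph G → Carrier → Set
      HasTotalWeight H s = ∃[ w ] FractionalColouring H w × totalWeight H w ≈ s

      coverage : ∀ H v w → ∑ (select (λ I → Independent H I × v ∈ I) (subsets (order G))) w
        ≈ ∑ (independent-subsets H) (λ I → 𝟙 (v ∈ I) * w I)
      coverage H v w = trans (∑-select (λ I → Independent H I × v ∈ I) (subsets (order G)) w)
        (trans (∑-cong (subsets (order G)) λ I → trans (*-congʳ 𝟙-×) (*-assoc _ _ _))
          (sym (∑-select (Independent H) (subsets (order G)) _)))

      singleton-independent : ∀ (H : Subgraph G) {v} → v ∈ V H → Independent H ⟪ _≡ v ⟫
      singleton-independent H {v} v∈ = (λ u∈ → ≡.subst (_∈ V H) (≡.sym (∈⟪⟫⁻ (_≡ v) u∈)) v∈)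
        , λ {e} _ (p , q) → Joins-irreflexive {e} (ends-Joins {e}) (≡.trans (∈⟪⟫⁻ (_≡ v) p) (≡.sym (∈⟪⟫⁻ (_≡ v) q)))

      -- Some fractional colouring exists: weight 1 on every set, since singletons are independent
      -- in a loopless graph. Total weights are nonnegative, so the infimum described by `χf`
      -- exists.
      χf-infimum : ∀ H → IsInfimum (HasTotalWeight H) (χf H)
      χf-infimum H = the-spec (IsInfimum (HasTotalWeight H)) (infimum-exists (HasTotalWeight H)
        (_ , ones , ((λ _ → 0≤1) , covers) , refl)
        λ s (w , (0≤w , _) , total) → ≤-trans (∑-nonneg (independent-subsets H) 0≤w) (≤-reflexive total))
        where
        ones : Subset (order G) → Carrier
        ones _ = 1#
        covers : ∀ v → v ∈ V H → 1# ≤ ∑ (select (λ I → Independent H I × v ∈ I) (subsets (order G))) ones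
        covers v v∈ = term≤∑ {f = ones} (λ _ → 0≤1)
          (∈-select⁺ (λ I → Independent H I × v ∈ I) (∈-subsets ⟪ _≡ v ⟫) (singleton-independent H v∈ , ∈⟪⟫⁺ (_≡ v) ≡.refl))

      measure : (Vertex → Carrier) → (Vertex → Set) → Carrier
      measure y P = ∑ vertices λ v → 𝟙 (P v) * y v

      module _ {y : Vertex → Carrier} (0≤y : ∀ v → 0# ≤ y v) where

        -- Summing y over the vertices covered by w and exchanging the sums gives ∑ w(I) y(I), in
        -- which each y(I) is at most M.
        weak-duality : ∀ H {M} → (∀ v → v ∈ V H) → 0# < M →
          (∀ I → Independent H I → measure y (_∈ I) ≤ M) → ∑ vertices y ≤ M * χf H
        weak-duality H {M} spanning 0<M y≤M = ≤-trans
          (≤-reflexive (sym (trans (*-comm _ _) (/-cancel _ 0<M))))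
          (*-monoʳ-≤ (<⇒≤ 0<M) (proj₂ (χf-infimum H) (∑ vertices y / M) λ { s (w , fc , total) →
            ≤-trans (/-≤ 0<M (≤-trans (bound w fc) (≤-reflexive (*-comm _ _)))) (≤-reflexive total) }))
          where
          Is = independent-subsets H
          bound : ∀ w → FractionalColouring H w → ∑ vertices y ≤ M * totalWeight H w
          bound w (0≤w , covers) = begin
            ∑ vertices y
              ≤⟨ ∑-mono vertices (λ v → ≤-trans (≤-reflexive (sym (*-identityˡ _)))
                   (*-monoˡ-≤ (0≤y v) (≤-trans (covers v (spanning v)) (≤-reflexive (coverage H v w))))) ⟩
            ∑ vertices (λ v → ∑ Is (λ I → 𝟙 (v ∈ I) * w I) * y v)
              ≈⟨ ∑-cong vertices (λ v → sym (∑-*ʳ Is (y v) _)) ⟩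
            ∑ vertices (λ v → ∑ Is (λ I → 𝟙 (v ∈ I) * w I * y v))
              ≈⟨ ∑-swap vertices Is _ ⟩
            ∑ Is (λ I → ∑ vertices (λ v → 𝟙 (v ∈ I) * w I * y v))
              ≈⟨ ∑-cong Is (λ I → trans (∑-cong vertices λ v →
                   solve 3 (λ i w y → i :* w :* y := w :* (i :* y)) refl (𝟙 (v ∈ I)) (w I) (y v)) (∑-*ˡ vertices (w I) _)) ⟩
            ∑ Is (λ I → w I * measure y (_∈ I))
              ≤⟨ ∑-mono-∈ Is (λ I I∈ → *-monoʳ-≤ (0≤w I) (y≤M I (proj₂ (∈-select⁻ (Independent H) (subsets (order G)) I∈)))) ⟩
            ∑ Is (λ I → w I * M)
              ≈⟨ trans (∑-*ʳ Is M w) (*-comm _ _) ⟩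
            M * totalWeight H w
              ∎
            where open ≤-Reasoning

        colour-classes : ∀ {P : Vertex → Set} {M} d (col : Vertex → ℕ) → (∀ v → P v → col v ℕ.< d) →
          (∀ c → measure y (λ v → P v × col v ≡ c) ≤ M) → measure y P ≤ fromℕ d * M
        colour-classes {P} {M} d col col<d class≤M = begin
          measure y P
            ≈⟨ ∑-cong vertices (λ v → sym (trans (∑-*ʳ (upTo d) (y v) _) (*-congʳ (one-class v)))) ⟩
          ∑ vertices (λ v → ∑ (upTo d) (λ c → 𝟙 (P v × col v ≡ c) * y v))
            ≈⟨ ∑-swap vertices (upTo d) _ ⟩
          ∑ (upTo d) (λ c → measure y (λ v → P v × col v ≡ c))
            ≤⟨ ∑-mono (upTo d) class≤M ⟩
          ∑ (upTo d) (λ _ → M)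
            ≈⟨ trans (∑-const (upTo d) M) (*-congʳ (reflexive (≡.cong fromℕ (List.length-upTo d)))) ⟩
          fromℕ d * M
            ∎
          where
          open ≤-Reasoning
          one-class : ∀ v → ∑ (upTo d) (λ c → 𝟙 (P v × col v ≡ c)) ≈ 𝟙 (P v)
          one-class v with em {P v}
          ... | no ¬p = trans (∑-cong (upTo d) λ c → 𝟙-false (¬p ∘ proj₁)) (∑-zero (upTo d))
          ... | yes p = trans (∑-single {f = λ c → 𝟙 (P v × col v ≡ c)} (Unique.upTo⁺ d) (∈ˡ.∈-upTo⁺ (col<d v p))
              λ c c≢ → 𝟙-false λ (_ , eq) → c≢ (≡.sym eq)) (𝟙-true (p , ≡.refl))

      -- An optimal solution of the linear program dual to χf.
      optimal-weights : ∃[ y ] (∀ v → 0# ≤ y v) × ∑ vertices y ≈ χf {G} whole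
        × (∀ P → IndependentIn (λ _ → Unit) P → measure y P ≤ 1#)
      optimal-weights = y , 0≤y , ≤-antisym
          (≤-trans (weak-duality 0≤y whole (λ _ → ∈⊤) 0<1 λ I ind → y≤1 (∈-select⁺ (Independent (whole {G})) (∈-subsets I) ind))
            (≤-reflexive (*-identityˡ _)))
          t≤y
        , λ P ind → ≤-trans (≤-reflexive (∑-cong vertices λ v → *-congʳ (sym (𝟙-∈ P v))))
            (y≤1 (∈-select⁺ (Independent (whole {G})) (∈-subsets ⟪ P ⟫) ((λ _ → ∈⊤) , λ _ (p , q) → ind tt (∈⟪⟫⁻ P p , ∈⟪⟫⁻ P q))))
        where
        dual = duality (independent-subsets whole)
          (Unique.filter⁺ (λ I → em {Independent (whole {G}) I}) (subsets-unique (order G))) (χf {G} whole)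
          λ w 0≤w cov → proj₁ (χf-infimum whole) _
            (w , (0≤w , λ v _ → ≤-trans (cov v) (≤-reflexive (sym (coverage whole v w)))) , refl)
        y = proj₁ dual
        0≤y = proj₁ (proj₂ dual)
        t≤y = proj₁ (proj₂ (proj₂ dual))
        y≤1 : ∀ {I} → I ∈ˡ independent-subsets whole → measure y (_∈ I) ≤ 1#
        y≤1 = proj₂ (proj₂ (proj₂ dual))

      girth-bound : ∀ {r} (H : Subgraph G) → (∀ k → HasCycle H k → r ℕ.≤ k) → [ r ] ≤⁺ girth {G} H
      girth-bound {r} H no-short with em {∃[ k ] HasCycle H k × (∀ l → HasCycle H l → k ℕ.≤ l)}
      ... | yes (k , cycle , _) = [ no-short k cycle ]
      ... | no  _               = [ r ] ≤⊤⁺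

      -- `hf` describes a maximum, which must first be attained. There are finitely many pairs of a
      -- vertex set and an edge set, and the given H shows that the competition is not empty.
      χf≤hf : ∀ {r} (H : Subgraph G) → [ r ] ≤⁺ girth {G} H → χf H ≤ hf r G
      χf≤hf {r} H long = proj₂ (the-spec (IsMaximum Value) maximum-exists)
        (χf H) (H , long , refl)
        where
        Value : Carrier → Set
        Value s = ∃[ H ] [ r ] ≤⁺ girth {G} H × χf H ≈ s

        Shape : Set
        Shape = Subset (order G) × Subset (size G)

        shape : Subgraph G → Shape
        shape H = V H , E H

        ValueIn : List Shape → Carrier → Set
        ValueIn xs s = ∃[ H ] shape H ∈ˡ xs × [ r ] ≤⁺ girth {G} H × χf H ≈ s

        -- Subgraphs also carry the proof `ends-in-V`, but `χf` reads only the two sets, so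
        -- searching through shapes loses no value.
        χf-shape : ∀ H H′ → shape H ≡ shape H′ → χf H ≡ χf H′
        χf-shape H H′ ≡.refl = ≡.refl

        maximum : ∀ xs → (∀ s → ¬ ValueIn xs s) ⊎ ∃ (IsMaximum (ValueIn xs))
        maximum [] = inj₁ λ { s (H , () , _) }
        maximum (x ∷ xs) with em {∃[ H ] shape H ≡ x × [ r ] ≤⁺ girth {G} H} | maximum xs
        ... | no none | inj₁ empty = inj₁ λ
          { s (H , here eq , long , _)     → none (H , eq , long)
          ; s (H , there H∈ , long , eq) → empty s (H , H∈ , long , eq) }
        ... | no none | inj₂ (m , (H , H∈ , long , eq) , ≤m) = inj₂ (m , (H , there H∈ , long , eq) , λ
          { s (H′ , here eq′ , long′ , _)    → contradiction (H′ , eq′ , long′) none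
          ; s (H′ , there H′∈ , long′ , eq′) → ≤m s (H′ , H′∈ , long′ , eq′) })
        ... | yes (H , ≡.refl , long) | inj₁ empty = inj₂ (χf H , (H , here ≡.refl , long , refl) , λ
          { s (H′ , here eq′ , _ , val)      → ≤-reflexive (trans (sym val) (reflexive (χf-shape H′ H eq′)))
          ; s (H′ , there H′∈ , long′ , eq′) → contradiction (H′ , H′∈ , long′ , eq′) (empty s) })
        ... | yes (H , ≡.refl , long) | inj₂ (m , (H₁ , H₁∈ , long₁ , eq₁) , ≤m) with ≤-total m (χf H)
        ... | inj₁ m≤ = inj₂ (χf H , (H , here ≡.refl , long , refl) , λ
          { s (H′ , here eq′ , _ , val)      → ≤-reflexive (trans (sym val) (reflexive (χf-shape H′ H eq′)))
          ; s (H′ , there H′∈ , long′ , eq′) → ≤-trans (≤m s (H′ , H′∈ , long′ , eq′)) m≤ })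
        ... | inj₂ ≤m′ = inj₂ (m , (H₁ , there H₁∈ , long₁ , eq₁) , λ
          { s (H′ , here eq′ , _ , val)      → ≤-trans (≤-reflexive (trans (sym val) (reflexive (χf-shape H′ H eq′)))) ≤m′
          ; s (H′ , there H′∈ , long′ , eq′) → ≤m s (H′ , H′∈ , long′ , eq′) })

        shapes : List Shape
        shapes = cartesianProduct (subsets (order G)) (subsets (size G))

        ∈-shapes : ∀ H → shape H ∈ˡ shapes
        ∈-shapes H = ∈ˡ.∈-cartesianProduct⁺ (∈-subsets (V H)) (∈-subsets (E H))

        maximum-exists : ∃ (IsMaximum Value)
        maximum-exists with maximum shapes
        ... | inj₁ empty = contradiction (H , ∈-shapes H , long , refl) (empty (χf H))
        ... | inj₂ (m , (H₁ , _ , long₁ , eq₁) , ≤m) = m , (H₁ , long₁ , eq₁) , λ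
          { s (H′ , long′ , eq′) → ≤m s (H′ , ∈-shapes H′ , long′ , eq′) }

  open Graphs

  -- Dense vertex sets inside heavy ones.

  module DenseSets (G : Graph) where

    open GraphTheory G

    _~_ : Vertex → Vertex → Set
    u ~ v = ∃[ e ] Joins G e u v

    ~-sym : ∀ {u v} → u ~ v → v ~ u
    ~-sym (e , joins) = e , Joins-sym {e} joins

    open Colouring _~_ (λ {u} {v} → ~-sym {u} {v})

    Within : List Vertex → Edge → Set
    Within W e = proj₁ (ends G e) ∈ˡ W × proj₂ (ends G e) ∈ˡ W

    within : List Vertex → Subset (size G)
    within W = ⟪ Within W ⟫

    ∣within∣ : ∀ W → fromℕ ∣ within W ∣ ≈ ∑ (allFin (size G)) (λ e → 𝟙 (Within W e))
    ∣within∣ W = trans (∣∣-∑ (within W)) (∑-cong (allFin (size G)) λ e → 𝟙-∈ (Within W) e)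

    module _ (X : Vertex → Set) (d : ℕ) where

      laterDegree : Vertex → List Vertex → ℕ
      laterDegree v vs = length (select (λ u → X u × v ~ u) vs)

      Heavy Light : Vertex → List Vertex → Set
      Heavy v vs = X v × d ℕ.≤ laterDegree v vs
      Light v vs = X v × laterDegree v vs ℕ.< d

      heavy+light : ∀ v vs → 𝟙 (Heavy v vs) + 𝟙 (Light v vs) ≈ 𝟙 (X v)
      heavy+light v vs with em {X v}
      ... | no ¬X = trans (+-cong (𝟙-false (¬X ∘ proj₁)) (𝟙-false (¬X ∘ proj₁))) (+-identityˡ 0#)
      ... | yes x with d ℕ.≤? laterDegree v vs
      ... | yes d≤ = trans (+-cong (𝟙-true (x , d≤)) (𝟙-false λ (_ , <d) → ℕ.<⇒≱ <d d≤)) (+-identityʳ 1#)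
      ... | no  d≰ = trans (+-cong (𝟙-false (d≰ ∘ proj₂)) (𝟙-true (x , ℕ.≰⇒> d≰))) (+-identityˡ 1#)

      -- `select` does not apply, as lightness of a vertex depends on the list behind it.
      light : List Vertex → List Vertex
      light []       = []
      light (v ∷ vs) with em {Light v vs}
      ... | yes _ = v ∷ light vs
      ... | no  _ = light vs

      light-∈ : ∀ {u} vs → u ∈ˡ light vs → u ∈ˡ vs × X u
      light-∈ (v ∷ vs) u∈ with em {Light v vs}
      light-∈ (v ∷ vs) (here ≡.refl) | yes (x , _) = here ≡.refl , x
      light-∈ (v ∷ vs) (there u∈)    | yes _       = let u∈vs , x = light-∈ vs u∈ in there u∈vs , x
      light-∈ (v ∷ vs) u∈            | no  _       = let u∈vs , x = light-∈ vs u∈ in there u∈vs , x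

      light-unique : ∀ {vs} → Unique vs → Unique (light vs)
      light-unique {[]}     _           = []
      light-unique {v ∷ vs} (v∉ ∷ uniq) with em {Light v vs}
      ... | no  _ = light-unique uniq
      ... | yes _ = All.tabulate (λ u∈ → All.lookup v∉ (proj₁ (light-∈ vs u∈))) ∷ light-unique uniq

      light-degenerate : ∀ {vs} → Unique vs → Degenerate d (light vs)
      light-degenerate {[]}     _          = []
      light-degenerate {v ∷ vs} (_ ∷ uniq) with em {Light v vs}
      ... | no  _          = light-degenerate uniq
      ... | yes (_ , deg<) = ℕ.<-≤-trans (ℕ.s≤s (length-injection {xs = select (v ~_) (light vs)} {select (λ u → X u × v ~ u) vs} _≡_
          (Unique.filter⁺ (λ u → em {v ~ u}) (light-unique uniq))
          (λ {u} u∈ → let u∈light , v~u = ∈-select⁻ (v ~_) (light vs) u∈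
                          u∈vs , x = light-∈ vs u∈light
                      in u , ∈-select⁺ (λ u → X u × v ~ u) u∈vs (x , v~u) , ≡.refl)
          (λ { ≡.refl ≡.refl → ≡.refl }))) deg<
        ∷ light-degenerate uniq

      light-sum : ∀ (y : Vertex → Carrier) vs → tailSum (λ v vs → y v * 𝟙 (Light v vs)) vs ≈ ∑ (light vs) y
      light-sum y []       = refl
      light-sum y (v ∷ vs) with em {Light v vs}
      ... | yes _ = +-cong (*-identityʳ _) (light-sum y vs)
      ... | no  _ = trans (+-cong (zeroʳ _) (light-sum y vs)) (+-identityˡ _)

      light-weight : ∀ {y : Vertex → Carrier} → (∀ v → 0# ≤ y v) →
        (∀ P → IndependentIn (λ _ → Unit) P → measure y P ≤ 1#) → ∀ {vs} → Unique vs →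
        tailSum (λ v vs → y v * 𝟙 (Light v vs)) vs ≤ fromℕ d
      light-weight {y} 0≤y y≤1 {vs} uniq with greedy (light-unique uniq) (light-degenerate uniq)
      ... | col , col<d , proper = begin
        tailSum (λ v vs → y v * 𝟙 (Light v vs)) vs  ≈⟨ light-sum y vs ⟩
        ∑ (light vs) y                              ≈⟨ ∑-unique-list (light-unique uniq) y ⟩
        measure y (_∈ˡ light vs)                    ≤⟨ colour-classes 0≤y d col (λ v v∈ → col<d v∈) (λ c → y≤1 _ (λ {e} → class c {e})) ⟩
        fromℕ d * 1#                                ≈⟨ *-identityʳ _ ⟩
        fromℕ d                                     ∎
        where
        open ≤-Reasoning
        class : ∀ c → IndependentIn (λ _ → Unit) (λ v → v ∈ˡ light vs × col v ≡ c)
        class c {e} _ ((u∈ , cu) , (v∈ , cv)) =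
          proper u∈ v∈ (Joins-irreflexive {e} (ends-Joins {e})) (e , ends-Joins {e}) (≡.trans cu (≡.sym cv))

      -- Every heavy vertex is charged with at least d edges to later vertices of X. An edge is
      -- charged at its earlier end only, so nothing is counted twice.
      heavy-edges : ∀ {vs} → Unique vs →
        fromℕ d * tailSum (λ v vs → 𝟙 (Heavy v vs)) vs ≤ fromℕ ∣ within (select X vs) ∣
      heavy-edges {[]}     _ = ≤-trans (≤-reflexive (zeroʳ _)) (fromℕ-nonneg ∣ within [] ∣)
      heavy-edges {v ∷ vs} (v∉ ∷ uniq) = begin
        fromℕ d * (𝟙 (Heavy v vs) + tailSum (λ v vs → 𝟙 (Heavy v vs)) vs)
          ≈⟨ distribˡ _ _ _ ⟩
        fromℕ d * 𝟙 (Heavy v vs) + fromℕ d * tailSum (λ v vs → 𝟙 (Heavy v vs)) vs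
          ≤⟨ +-mono-≤ at-v (≤-trans (heavy-edges uniq) (≤-reflexive (∣within∣ (select X vs)))) ⟩
        ∑ edges (λ e → ∑ W (λ u → 𝟙 (X v × Joins G e v u))) + ∑ edges (λ e → 𝟙 (Within W e))
          ≈⟨ ∑-+ edges _ _ ⟨
        ∑ edges (λ e → ∑ W (λ u → 𝟙 (X v × Joins G e v u)) + 𝟙 (Within W e))
          ≤⟨ ∑-mono edges per-edge ⟩
        ∑ edges (λ e → 𝟙 (Within (select X (v ∷ vs)) e))
          ≈⟨ ∣within∣ (select X (v ∷ vs)) ⟨
        fromℕ ∣ within (select X (v ∷ vs)) ∣
          ∎
        where
        open ≤-Reasoning
        edges = allFin (size G)
        W = select X vs

        W⊆ : ∀ {u} → u ∈ˡ W → u ∈ˡ select X (v ∷ vs)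
        W⊆ u∈ = let u∈vs , x = ∈-select⁻ X vs u∈ in ∈-select⁺ X (there u∈vs) x

        uniqueW : Unique W
        uniqueW = Unique.filter⁺ (λ u → em {X u}) uniq

        v∉W : v ∉ˡ W
        v∉W v∈ = All.lookup v∉ (proj₁ (∈-select⁻ X vs v∈)) ≡.refl

        at-v : fromℕ d * 𝟙 (Heavy v vs) ≤ ∑ edges (λ e → ∑ W (λ u → 𝟙 (X v × Joins G e v u)))
        at-v with em {Heavy v vs}
        ... | no  _        = ≤-trans (≤-reflexive (zeroʳ _)) (∑-nonneg edges λ e → ∑-nonneg W λ u → 𝟙-nonneg _)
        ... | yes (x , d≤) = begin
          fromℕ d * 1#
            ≈⟨ *-identityʳ _ ⟩
          fromℕ d
            ≤⟨ fromℕ-mono d≤ ⟩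
          fromℕ (laterDegree v vs)
            ≈⟨ count-select (λ u → X u × v ~ u) vs ⟩
          ∑ vs (λ u → 𝟙 (X u × v ~ u))
            ≈⟨ ∑-cong vs (λ u → 𝟙-×) ⟩
          ∑ vs (λ u → 𝟙 (X u) * 𝟙 (v ~ u))
            ≈⟨ ∑-select X vs (λ u → 𝟙 (v ~ u)) ⟨
          ∑ W (λ u → 𝟙 (v ~ u))
            ≤⟨ ∑-mono W (λ u → 𝟙-≤ {v ~ u} (∑-nonneg edges λ e → 𝟙-nonneg (X v × Joins G e v u))
                 λ (e , joins) → 1≤∑𝟙 {P = λ e → X v × Joins G e v u} (∈ˡ.∈-allFin e) (x , joins)) ⟩
          ∑ W (λ u → ∑ edges (λ e → 𝟙 (X v × Joins G e v u)))
            ≈⟨ ∑-swap W edges _ ⟩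
          ∑ edges (λ e → ∑ W (λ u → 𝟙 (X v × Joins G e v u)))
            ∎

        -- An edge within `W` misses v, and an edge at v has only one other end. So each edge
        -- contributes at most once to the left-hand side.
        per-edge : ∀ e → ∑ W (λ u → 𝟙 (X v × Joins G e v u)) + 𝟙 (Within W e) ≤ 𝟙 (Within (select X (v ∷ vs)) e)
        per-edge e with em {Within W e}
        ... | yes (p , q) = ≤-trans (≤-reflexive (trans (+-congʳ (trans (∑-cong-∈ W λ u u∈ → 𝟙-false λ (_ , joins) →
                v∉W (proj₁ (Joins-ends {e} {P = _∈ˡ W} joins p q))) (∑-zero W))) (+-identityˡ 1#)))
              (≤-reflexive (sym (𝟙-true (W⊆ p , W⊆ q))))
        ... | no  _ = ≤-trans (≤-reflexive (+-identityʳ _)) (≤-trans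
            (≤-reflexive (∑-cong-∈ W λ u u∈ → 𝟙-cong (λ (x , joins) → x , joins , u∈) λ (x , joins , _) → x , joins))
            (∑𝟙-unique {P = λ u → X v × Joins G e v u × u ∈ˡ W} W uniqueW
              (λ (_ , joins , _) (_ , joins′ , _) → Joins-injective {e} joins joins′)
              λ (x , joins , u∈) → ends-Joins⁻ {e} {P = _∈ˡ select X (v ∷ vs)} joins
                (∈-select⁺ X (here ≡.refl) x) (W⊆ u∈)))

      -- Light vertices of X weigh at most d, the heavy ones make up the rest. The sum of `φ`
      -- weighted by y is therefore at least t (y(X) - 2d - 2), which explains the threshold.
      dense-suffix : ∀ {y : Vertex → Carrier} {t} → (∀ v → 0# ≤ y v) →
        (∀ P → IndependentIn (λ _ → Unit) P → measure y P ≤ 1#) → 0# < t → ∑ vertices y ≈ t →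
        fromℕ 2 * fromℕ d + fromℕ 2 < measure y X →
        ∀ {ys} → AllPairs (λ u v → y u ≤ y v) ys → Unique ys → (∀ v → v ∈ˡ ys) →
        ∃[ zs ] Suffix zs ys × fromℕ 2 * fromℕ (length zs) < t * fromℕ (length (select X zs))
              × d ℕ.* length (select X zs) ℕ.≤ 2 ℕ.* ∣ within (select X zs) ∣
      dense-suffix {y} {t} 0≤y y≤1 0<t total heavyX {ys} sorted uniq complete′ =
        conclude (positive-suffix y φ 0≤y sorted positive)
        where
        φ : Vertex → List Vertex → Carrier
        -- On a suffix with j vertices, k of them in X and h of these heavy, `φ` sums to t (2h - k)
        -- - 2j. Positivity gives both conclusions at once: h ≤ k yields 2j < tk, and j ≥ 0 yields k
        -- ≤ 2h.
        φ v vs = t * (fromℕ 2 * 𝟙 (Heavy v vs) - 𝟙 (X v)) - fromℕ 2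

        ∑ys : ∀ f → ∑ ys f ≈ ∑ vertices f
        ∑ys f = trans (∑-unique-list uniq f)
          (∑-cong vertices λ v → trans (*-congʳ (𝟙-true (complete′ v))) (*-identityˡ _))

        lightSum : Carrier
        lightSum = tailSum (λ v vs → y v * 𝟙 (Light v vs)) ys

        weighted : tailSum (λ v vs → y v * φ v vs) ys ≈ t * measure y X + (- (fromℕ 2 * t) * lightSum + - fromℕ 2 * t)
        weighted = begin
          tailSum (λ v vs → y v * φ v vs) ys
            ≈⟨ tailSum-cong ys (λ v vs → trans
                 (solve 5 (λ y t h l x → y :* (t :* (#2 :* h :- x) :- #2)
                   := (t :* (x :* y) :+ (:- (#2 :* t) :* (y :* l) :+ :- #2 :* y)) :+ (#2 :* (t :* y)) :* ((h :+ l) :- x)) refl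
                   (y v) t (𝟙 (Heavy v vs)) (𝟙 (Light v vs)) (𝟙 (X v)))
                 (trans (+-congˡ (trans (*-congˡ (trans (+-congʳ (heavy+light v vs)) (-‿inverseʳ _))) (zeroʳ _))) (+-identityʳ _))) ⟩
          tailSum (λ v vs → t * (𝟙 (X v) * y v) + (- (fromℕ 2 * t) * (y v * 𝟙 (Light v vs)) + - fromℕ 2 * y v)) ys
            ≈⟨ trans (tailSum-+ _ _ ys) (+-cong (tailSum-*ˡ t _ ys)
                 (trans (tailSum-+ _ _ ys) (+-cong (tailSum-*ˡ (- (fromℕ 2 * t)) _ ys) (tailSum-*ˡ (- fromℕ 2) _ ys)))) ⟩
          t * tailSum (λ v _ → 𝟙 (X v) * y v) ys + (- (fromℕ 2 * t) * lightSum + - fromℕ 2 * tailSum (λ v _ → y v) ys)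
            ≈⟨ +-cong (*-congˡ (trans (tailSum-∑ _ ys) (∑ys _)))
                 (+-congˡ (*-congˡ (trans (tailSum-∑ y ys) (trans (∑ys y) total)))) ⟩
          t * measure y X + (- (fromℕ 2 * t) * lightSum + - fromℕ 2 * t)
            ∎
          where open import Relation.Binary.Reasoning.Setoid setoid

        positive : 0# < tailSum (λ v vs → y v * φ v vs) ys
        positive = <-≤-trans (*-pos 0<t (slack< heavyX)) (≤-trans
          (*-nonneg (*-nonneg (fromℕ-nonneg 2) (<⇒≤ 0<t)) (slack (light-weight 0≤y y≤1 uniq))
            by solve 4 (λ t m d l → t :* (m :- (#2 :* d :+ #2)) :+ (#2 :* t) :* (d :- l)
                 := t :* m :+ (:- (#2 :* t) :* l :+ :- #2 :* t)) refl t (measure y X) (fromℕ d) lightSum)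
          (≤-reflexive (sym weighted)))

        conclude : (∃[ zs ] Suffix zs ys × 0# < tailSum φ zs) →
          ∃[ zs ] Suffix zs ys × fromℕ 2 * fromℕ (length zs) < t * fromℕ (length (select X zs))
                × d ℕ.* length (select X zs) ℕ.≤ 2 ℕ.* ∣ within (select X zs) ∣
        conclude (zs , suffix , 0<φ) = zs , suffix , short , dense
          where
          k j h : Carrier
          k = fromℕ (length (select X zs))
          j = fromℕ (length zs)
          h = tailSum (λ v vs → 𝟙 (Heavy v vs)) zs

          k≈ : k ≈ tailSum (λ v _ → 𝟙 (X v)) zs
          k≈ = trans (count-select X zs) (sym (tailSum-∑ _ zs))

          value : tailSum φ zs ≈ t * (fromℕ 2 * h - k) - fromℕ 2 * j
          value = begin
            tailSum φ zs
              ≈⟨ tailSum-cong zs (λ v vs → solve 3 (λ t h x → t :* (#2 :* h :- x) :- #2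
                   := (#2 :* t) :* h :+ (:- t :* x :+ :- #2 :* #1)) refl t (𝟙 (Heavy v vs)) (𝟙 (X v))) ⟩
            tailSum (λ v vs → (fromℕ 2 * t) * 𝟙 (Heavy v vs) + (- t * 𝟙 (X v) + - fromℕ 2 * 1#)) zs
              ≈⟨ trans (tailSum-+ _ _ zs) (+-cong (tailSum-*ˡ (fromℕ 2 * t) _ zs)
                   (trans (tailSum-+ _ _ zs) (+-cong (tailSum-*ˡ (- t) _ zs) (tailSum-*ˡ (- fromℕ 2) _ zs)))) ⟩
            (fromℕ 2 * t) * h + (- t * tailSum (λ v _ → 𝟙 (X v)) zs + - fromℕ 2 * tailSum (λ _ _ → 1#) zs)
              ≈⟨ +-congˡ (+-cong (*-congˡ (sym k≈)) (*-congˡ (trans (tailSum-∑ _ zs) (sym (length-∑ zs))))) ⟩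
            (fromℕ 2 * t) * h + (- t * k + - fromℕ 2 * j)
              ≈⟨ solve 4 (λ t h k j → (#2 :* t) :* h :+ (:- t :* k :+ :- #2 :* j) := t :* (#2 :* h :- k) :- #2 :* j) refl t h k j ⟩
            t * (fromℕ 2 * h - k) - fromℕ 2 * j
              ∎
            where open import Relation.Binary.Reasoning.Setoid setoid

          h≤k : h ≤ k
          h≤k = ≤-trans (tailSum-mono zs λ v vs → 𝟙-mono {Heavy v vs} {X v} proj₁) (≤-reflexive (sym k≈))

          2j< : fromℕ 2 * j < t * (fromℕ 2 * h - k)
          2j< = unslack< (<-≤-trans 0<φ (≤-reflexive value))

          short : fromℕ 2 * j < t * k
          short = <-≤-trans 2j< (*-nonneg (*-nonneg (fromℕ-nonneg 2) (<⇒≤ 0<t)) (slack h≤k)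
            by solve 3 (λ t h k → t :* (#2 :* h :- k) :+ (#2 :* t) :* (k :- h) := t :* k) refl t h k)

          k≤2h : k ≤ fromℕ 2 * h
          k≤2h = unslack (*-cancelʳ-≤ 0<t (≤-trans (≤-reflexive (zeroˡ t))
            (≤-trans (*-nonneg (fromℕ-nonneg 2) (fromℕ-nonneg (length zs))) (≤-trans (<⇒≤ 2j<) (≤-reflexive (*-comm _ _))))))

          uniqueSuffix : ∀ {zs ys : List Vertex} → Suffix zs ys → Unique ys → Unique zs
          uniqueSuffix all      uniq       = uniq
          uniqueSuffix (drop s) (_ ∷ uniq) = uniqueSuffix s uniq

          dense : d ℕ.* length (select X zs) ℕ.≤ 2 ℕ.* ∣ within (select X zs) ∣
          dense = fromℕ-cancel-≤ (≤-trans (≤-reflexive (fromℕ-* d (length (select X zs))))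
            (≤-trans (*-monoʳ-≤ (fromℕ-nonneg d) k≤2h)
              (≤-trans (≤-reflexive (solve 2 (λ d h → d :* (#2 :* h) := #2 :* (d :* h)) refl (fromℕ d) h))
                (≤-trans (*-monoʳ-≤ (fromℕ-nonneg 2) (heavy-edges (uniqueSuffix suffix uniq)))
                  (≤-reflexive (sym (fromℕ-* 2 ∣ within (select X zs) ∣)))))))

  -- The union bound over dense sets.

  fromℕ-^ : ∀ m k → fromℕ (m ℕ.^ k) ≈ fromℕ m ^ k
  fromℕ-^ m zero    = +-identityʳ 1#
  fromℕ-^ m (suc k) = trans (fromℕ-* m (m ℕ.^ k)) (*-congˡ (fromℕ-^ m k))

  1≤^ : ∀ {x} n → 1# ≤ x → 1# ≤ x ^ n
  1≤^ n 1≤x = ≤-trans (≤-reflexive (sym (1^ n))) (^-mono-base n 0≤1 1≤x)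

  half*2 : half * fromℕ 2 ≈ 1#
  half*2 = /-cancel 1# (fromℕ-suc-pos 1)

  -- The estimate 4^(-k) ≤ 2^(-k-1) for k = i + 1, free of division. The shifted exponent makes the
  -- sum over all k ≥ 1 at most one half.
  quarter-powers : ∀ i → 1# ≤ half ^ suc (suc i) * fromℕ 4 ^ suc i
  quarter-powers zero = ≤-reflexive (sym (trans
    (solve 1 (λ h → (h :* (h :* #1)) :* (#4 :* #1) := (h :* #2) :* (h :* #2)) refl half)
    (trans (*-cong half*2 half*2) (*-identityˡ 1#))))
  quarter-powers (suc i) = ≤-trans (quarter-powers i) (*-nonneg (fromℕ-nonneg 1) 0≤x
    by trans (solve 1 (λ x → x :+ (#1 :+ #0) :* x := #1 :* (#2 :* x)) refl x)
       (trans (*-congʳ (sym half*2)) (solve 3 (λ h P Q → (h :* #2) :* (#2 :* (P :* Q)) := (h :* P) :* (#4 :* Q)) refl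
         half (half ^ suc (suc i)) (fromℕ 4 ^ suc i))))
    where
    x = half ^ suc (suc i) * fromℕ 4 ^ suc i
    0≤x : 0# ≤ x
    0≤x = *-nonneg (^-nonneg (suc (suc i)) (<⇒≤ 0<half)) (^-nonneg (suc i) (fromℕ-nonneg 4))

  -- The remainder of the series is kept on the left so that the induction closes with a fixed
  -- right-hand side.
  geometric-sum : ∀ (f : ℕ → Carrier) n → (∀ i → f i ≤ half ^ suc (suc i)) → sumℕ f n + half ^ suc n ≤ half
  geometric-sum f zero    f≤ = ≤-reflexive (trans (+-identityˡ _) (*-identityʳ half))
  geometric-sum f (suc n) f≤ = ≤-trans
    (+-mono-≤ (+-mono-≤ ≤-refl (f≤ n)) ≤-refl)
    (≤-trans (≤-reflexive (trans (+-assoc _ _ _) (+-congˡ (trans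
        (solve 2 (λ h x → h :* x :+ h :* x := (x :* h) :+ (x :* h)) refl half (half ^ suc n)) (half+half _)))))
      (geometric-sum f n f≤))

  module UnionBound (G : Graph) (y : Fin (order G) → Carrier) (0≤y : ∀ v → 0# ≤ y v)
    (t u p : Carrier) (d : ℕ) where

    open GraphTheory G
    open DenseSets G

    enumeration : List Vertex
    enumeration = proj₁ (sorted-enumeration y)

    -- The pool depends on k alone and not on the independent set, which is what makes a union bound
    -- possible.
    candidates : ℕ → List (List Vertex)
    candidates k = choose k (trim (t * fromℕ k) enumeration)

    -- Sizes start at 1: the empty set always counts as dense and avoided and would contribute 1. It
    -- cannot come from `dense-suffix`, where 2j < tk.
    sizes : List ℕ
    sizes = map suc (upTo (length enumeration))

    Dense : ℕ → List Vertex → Set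
    Dense k W = d ℕ.* k ℕ.≤ 2 ℕ.* ∣ within W ∣

    module _ (0≤p : 0# ≤ p) (p≤1 : p ≤ 1#) where

      open Expectation p 0≤p p≤1

      failures : Subset (size G) → Carrier
      failures ω = ∑ sizes λ k → ∑ (candidates k) λ W → 𝟙 (Dense k W × Avoids ω (within W))

      light-independent : 0# < t → ∑ vertices y ≈ t →
        (∀ P → IndependentIn (λ _ → Unit) P → measure y P ≤ 1#) →
        ∀ ω → failures ω < 1# → ∀ X → IndependentIn (_∈ ω) X →
        measure y X ≤ fromℕ 2 * fromℕ d + fromℕ 2
      light-independent 0<t total y≤1 ω few X independent = ≮⇒≥ λ heavyX →
        let ys , sorted , uniq , complete′ = sorted-enumeration y
            zs , suffix , short , dense = dense-suffix X d 0≤y y≤1 0<t total heavyX sorted uniq complete′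
        in <⇒≱ few (failure zs suffix short dense)
        where
        failure : ∀ zs → Suffix zs enumeration → fromℕ 2 * fromℕ (length zs) < t * fromℕ (length (select X zs)) →
          d ℕ.* length (select X zs) ℕ.≤ 2 ℕ.* ∣ within (select X zs) ∣ → 1# ≤ failures ω
        failure zs suffix short dense = begin
          1#
            ≤⟨ 1≤∑𝟙 {P = λ W → Dense k W × Avoids ω (within W)}
                 (choose-suffix k (trim-suffix suffix (<⇒≤ short)) (∈-choose-select X zs)) (dense , avoids) ⟩
          ∑ (candidates k) (λ W → 𝟙 (Dense k W × Avoids ω (within W)))
            ≤⟨ term≤∑ {f = λ k → ∑ (candidates k) λ W → 𝟙 (Dense k W × Avoids ω (within W))}
                 (λ k → ∑-nonneg (candidates k) λ W → 𝟙-nonneg _) (k∈ k k≢0 k≤) ⟩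
          failures ω
            ∎
          where
          open ≤-Reasoning
          k = length (select X zs)
          k≤ : k ℕ.≤ length enumeration
          k≤ = ℕ.≤-trans (List.length-filter (λ v → em {X v}) zs) (Suffix-length suffix)
          k≢0 : k ≢ 0
          k≢0 k≡0 = <⇒≱ short (≤-trans (≤-reflexive (trans (*-congˡ (reflexive (≡.cong fromℕ k≡0))) (zeroʳ t)))
            (*-nonneg (fromℕ-nonneg 2) (fromℕ-nonneg (length zs))))
          k∈ : ∀ k → k ≢ 0 → k ℕ.≤ length enumeration → k ∈ˡ sizes
          k∈ zero    k≢0 _  = contradiction ≡.refl k≢0
          k∈ (suc i) _   i< = ∈ˡ.∈-map⁺ suc (∈ˡ.∈-upTo⁺ i<)
          avoids : Avoids ω (within (select X zs))
          avoids e e∈ e∈ω = independent e∈ω (proj₂ (∈-select⁻ X zs (proj₁ ends∈)) , proj₂ (∈-select⁻ X zs (proj₂ ends∈)))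
            where
            ends∈ : Within (select X zs) e
            ends∈ = ∈⟪⟫⁻ (Within (select X zs)) e∈

      module _ (1≤t : 1# ≤ t) (u≈ : u ≈ fromℕ 2 * exp 1# * t) (1≤u : 1# ≤ u) (sparse : (1# - p) ^ d * u ^ 4 ≤ 1#) where

        0≤t : 0# ≤ t
        0≤t = ≤-trans 0≤1 1≤t

        -- With j the length of the pool, 2j ≤ tk and k^k ≤ k! e^k bound the count by (et/2)^k. The
        -- factor 4^k, reserved for summing over k, turns this into (2et)^k, the origin of 2et in
        -- the theorem.
        candidates-count : ∀ k → fromℕ (length (candidates k)) * fromℕ 4 ^ k ≤ u ^ k
        candidates-count k = *-cancelʳ-≤ (factorial-pos k) (begin
          c * fromℕ 4 ^ k * k!
            ≈⟨ *-congʳ (*-congˡ (trans (^-congˡ k 4≈2*2) (^-distrib-* (fromℕ 2) (fromℕ 2) k))) ⟩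
          c * (2^k * 2^k) * k!
            ≈⟨ solve 3 (λ c a k → c :* (a :* a) :* k := (k :* c) :* (a :* a)) refl c 2^k k! ⟩
          (k! * c) * (2^k * 2^k)
            ≤⟨ *-monoˡ-≤ (*-nonneg 0≤2^k 0≤2^k) (≤-trans (≤-reflexive (sym (fromℕ-* (k !) (length (candidates k)))))
                 (≤-trans (fromℕ-mono (choose-length k short)) (≤-reflexive (fromℕ-^ (length short) k)))) ⟩
          fromℕ (length short) ^ k * (2^k * 2^k)
            ≈⟨ trans (solve 2 (λ l a → l :* (a :* a) := (a :* l) :* a) refl (fromℕ (length short) ^ k) 2^k)
                 (*-congʳ (sym (^-distrib-* (fromℕ 2) (fromℕ (length short)) k))) ⟩
          (fromℕ 2 * fromℕ (length short)) ^ k * 2^k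
            ≤⟨ *-monoˡ-≤ 0≤2^k (^-mono-base k (*-nonneg (fromℕ-nonneg 2) (fromℕ-nonneg (length short)))
                 (trim-length (*-nonneg 0≤t (fromℕ-nonneg k)) enumeration)) ⟩
          (t * fromℕ k) ^ k * 2^k
            ≈⟨ *-congʳ (^-distrib-* t (fromℕ k) k) ⟩
          t ^ k * fromℕ k ^ k * 2^k
            ≤⟨ *-monoˡ-≤ 0≤2^k (*-monoʳ-≤ (^-nonneg k 0≤t) (self-power≤ k)) ⟩
          t ^ k * (k! * exp 1# ^ k) * 2^k
            ≈⟨ solve 4 (λ t k e a → t :* (k :* e) :* a := a :* e :* t :* k) refl (t ^ k) k! (exp 1# ^ k) 2^k ⟩
          2^k * exp 1# ^ k * t ^ k * k!
            ≈⟨ *-congʳ (trans (*-congʳ (sym (^-distrib-* (fromℕ 2) (exp 1#) k)))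
                 (trans (sym (^-distrib-* (fromℕ 2 * exp 1#) t k)) (^-congˡ k (sym u≈)))) ⟩
          u ^ k * k!
            ∎)
          where
          open ≤-Reasoning
          c k! 2^k : Carrier
          c   = fromℕ (length (candidates k))
          k!  = fromℕ (k !)
          2^k = fromℕ 2 ^ k
          0≤2^k : 0# ≤ 2^k
          0≤2^k = ^-nonneg k (fromℕ-nonneg 2)
          short = trim (t * fromℕ k) enumeration
          4≈2*2 : fromℕ 4 ≈ fromℕ 2 * fromℕ 2
          4≈2*2 = solve 0 (#4 := #2 :* #2) refl

        -- Half of dk need not be an integer, so squares are compared: (1-p)^(2m) is at most
        -- (1-p)^(dk), and the hypothesis `sparse` is raised to the power k.
        sparse-power : ∀ m k → d ℕ.* k ℕ.≤ 2 ℕ.* m → (1# - p) ^ m * (u ^ k * u ^ k) ≤ 1#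
        sparse-power m k dk≤2m = square-cancel-≤ 0≤1 (begin
          q ^ m * (u ^ k * u ^ k) * (q ^ m * (u ^ k * u ^ k))
            ≈⟨ solve 2 (λ a b → a :* (b :* b) :* (a :* (b :* b)) := (a :* a) :* (b :* (b :* (b :* (b :* #1))))) refl (q ^ m) (u ^ k) ⟩
          (q ^ m * q ^ m) * (u ^ k) ^ 4
            ≈⟨ *-cong (trans (sym (^-homo-* q m m)) (reflexive (≡.cong (q ^_) (≡.cong (m ℕ.+_) (≡.sym (ℕ.+-identityʳ m))))))
                 (trans (^-assocʳ u k 4) (trans (reflexive (≡.cong (u ^_) (ℕ.*-comm k 4))) (sym (^-assocʳ u 4 k)))) ⟩
          q ^ (2 ℕ.* m) * (u ^ 4) ^ k
            ≤⟨ *-monoˡ-≤ (^-nonneg k (^-nonneg 4 0≤u)) (^-antitone 0≤1-p 1-p≤1 dk≤2m) ⟩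
          q ^ (d ℕ.* k) * (u ^ 4) ^ k
            ≈⟨ trans (*-congʳ (sym (^-assocʳ q d k))) (sym (^-distrib-* (q ^ d) (u ^ 4) k)) ⟩
          (q ^ d * u ^ 4) ^ k
            ≤⟨ ^≤1 k (*-nonneg (^-nonneg d 0≤1-p) (^-nonneg 4 0≤u)) sparse ⟩
          1#
            ≈⟨ *-identityˡ 1# ⟨
          1# * 1#
            ∎)
          where
          open ≤-Reasoning
          q = 1# - p
          0≤u = ≤-trans 0≤1 1≤u

        few-of-size : ∀ i → let k = suc i in
          𝔼 (λ ω → ∑ (candidates k) λ W → 𝟙 (Dense k W × Avoids ω (within W))) ≤ half ^ suc (suc i)
        few-of-size i = *-cancelʳ-≤ (^-pos k (fromℕ-suc-pos 3)) (≤-trans bound (quarter-powers i))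
          where
          open ≤-Reasoning
          k : ℕ
          k = suc i
          U : Carrier
          U = u ^ k * u ^ k
          0<u^k : 0# < u ^ k
          0<u^k = ^-pos k (<-≤-trans 0<1 1≤u)
          0<U : 0# < U
          0<U = *-pos 0<u^k 0<u^k
          each : ∀ W → 𝔼 (λ ω → 𝟙 (Dense k W × Avoids ω (within W))) ≤ 1# / U
          each W with em {Dense k W}
          ... | no sparse′ = ≤-trans (≤-reflexive (trans (𝔼-cong {size G} λ ω → 𝟙-false (sparse′ ∘ proj₁)) (𝔼-const {size G} 0#)))
            (<⇒≤ (/-pos 0<1 0<U))
          ... | yes dense = ≤-trans
            (𝔼-mono {size G} {λ ω → 𝟙 (Dense k W × Avoids ω (within W))} {λ ω → 𝟙 (Avoids ω (within W))} λ ω → 𝟙-mono proj₂)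
            (≤-trans (≤-reflexive (𝔼-avoids (within W))) (≤-/ 0<U (sparse-power ∣ within W ∣ k dense)))
          bound : 𝔼 (λ ω → ∑ (candidates k) λ W → 𝟙 (Dense k W × Avoids ω (within W))) * fromℕ 4 ^ k ≤ 1#
          bound = begin
            𝔼 (λ ω → ∑ (candidates k) λ W → 𝟙 (Dense k W × Avoids ω (within W))) * fromℕ 4 ^ k
              ≈⟨ *-congʳ (𝔼-∑ (candidates k) (λ W ω → 𝟙 (Dense k W × Avoids ω (within W)))) ⟩
            ∑ (candidates k) (λ W → 𝔼 (λ ω → 𝟙 (Dense k W × Avoids ω (within W)))) * fromℕ 4 ^ k
              ≤⟨ *-monoˡ-≤ (^-nonneg k (fromℕ-nonneg 4)) (∑-mono (candidates k) each) ⟩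
            ∑ (candidates k) (λ _ → 1# / U) * fromℕ 4 ^ k
              ≈⟨ trans (*-congʳ (∑-const (candidates k) (1# / U)))
                   (solve 3 (λ c i f → (c :* i) :* f := (c :* f) :* i) refl (fromℕ (length (candidates k))) (1# / U) (fromℕ 4 ^ k)) ⟩
            fromℕ (length (candidates k)) * fromℕ 4 ^ k * (1# / U)
              ≤⟨ *-monoˡ-≤ (<⇒≤ (/-pos 0<1 0<U)) (candidates-count k) ⟩
            u ^ k * (1# / U)
              -- The missing edges save u^(2k), of which the count uses u^k. The other factor is at
              -- least 1 and is given away.
              ≤⟨ *-monoˡ-≤ (<⇒≤ (/-pos 0<1 0<U)) (≤-trans (≤-reflexive (sym (*-identityʳ _)))
                   (*-monoʳ-≤ (<⇒≤ 0<u^k) (1≤^ k 1≤u))) ⟩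
            U * (1# / U)
              ≈⟨ trans (*-comm _ _) (/-cancel 1# 0<U) ⟩
            1#
              ∎

        failures-rare : 𝔼 failures ≤ half
        failures-rare = begin
          𝔼 failures
            ≈⟨ 𝔼-∑ sizes (λ k ω → ∑ (candidates k) λ W → 𝟙 (Dense k W × Avoids ω (within W))) ⟩
          ∑ sizes mean
            ≈⟨ trans (∑-map suc (upTo N) mean) (∑-upTo N (mean ∘ suc)) ⟩
          sumℕ (mean ∘ suc) N
            ≤⟨ ^-nonneg (suc N) (<⇒≤ 0<half) by refl ⟩
          sumℕ (mean ∘ suc) N + half ^ suc N
            ≤⟨ geometric-sum (mean ∘ suc) N few-of-size ⟩
          half
            ∎
          where
          open ≤-Reasoning
          N = length enumeration
          mean : ℕ → Carrier
          mean k = 𝔼 λ ω → ∑ (candidates k) λ W → 𝟙 (Dense k W × Avoids ω (within W))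

  -- Deletion of short cycles.

  module Sparsification (r : ℕ) (G : Graph) {I : Set} (𝒦 : I → Clique G) (covers : IsCycleCliqueCover 𝒦 r)
    (b : ℕ) (fewCliques : ∀ v → ∃[ c ] HasCardinality (λ i → v ∈ V (proj₁ (𝒦 i))) c × c ℕ.≤ b) where

    open GraphTheory G

    K : I → Subgraph G
    K i = proj₁ (𝒦 i)

    cliquesAt : Vertex → List I
    cliquesAt v = proj₁ (proj₁ (proj₂ (fewCliques v)))

    cliquesAt-length : ∀ v → length (cliquesAt v) ℕ.≤ b
    cliquesAt-length v = let _ , (_ , _ , length≡ , _) , c≤b = fewCliques v in
      ℕ.≤-trans (ℕ.≤-reflexive length≡) c≤b

    cliquesAt-∈ : ∀ {v i} → v ∈ V (K i) → i ∈ˡ cliquesAt v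
    cliquesAt-∈ {v} {i} = let _ , (_ , _ , _ , members) , _ = fewCliques v in Equivalence.from (members i)

    cliquesAt-∋ : ∀ {v i} → i ∈ˡ cliquesAt v → v ∈ V (K i)
    cliquesAt-∋ {v} {i} = let _ , (_ , _ , _ , members) , _ = fewCliques v in Equivalence.to (members i)

    _≟_ : (i j : I) → Dec (i ≡ j)
    i ≟ j = em

    -- The family may be infinite, but each vertex lies in finitely many members, so those with a
    -- vertex form a finite list. Equal indices are merged because `SumAtMost` quantifies over lists
    -- without repetition.
    cliques : List I
    cliques = deduplicate _≟_ (concatMap cliquesAt vertices)

    cliques-unique : Unique cliques
    cliques-unique = deduplicate-! _≟_ (concatMap cliquesAt vertices)

    cliques-∈ : ∀ {v i} → v ∈ V (K i) → i ∈ˡ cliques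
    cliques-∈ {v} v∈ = ∈ˡ.∈-deduplicate⁺ _≟_
      (∈ˡ.∈-concatMap⁺ cliquesAt (lose (∈ˡ.∈-allFin v) (cliquesAt-∈ v∈)))

    Short : Subset (size G) → Set
    Short F = ∃[ k ] IsCycle G F k × k ℕ.< r

    -- The numbering of the edges singles out one edge of each cycle, so that a cycle accounts for a
    -- single deletion.
    First : Subset (size G) → Edge → Set
    First F e = e ∈ F × (∀ e′ → e′ ∈ F → toℕ e ℕ.≤ toℕ e′)

    First-unique : ∀ {F e e′} → First F e → First F e′ → e ≡ e′
    First-unique (e∈ , e≤) (e′∈ , e′≤) = Fin.toℕ-injective (ℕ.≤-antisym (e≤ _ e′∈) (e′≤ _ e∈))

    First-exists : ∀ {F} → Short F → ∃ (First F)
    First-exists {F} (k , (ℕ.s≤s (ℕ.s≤s _) , c , _ , steps , _) , _) =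
      let e , e∈ , _ = steps Fin.zero (Fin.suc Fin.zero) (inj₁ ≡.refl)
          _ , (e₀ , e₀∈ , toℕ≡) , minimal = least {P = λ n → ∃[ e ] e ∈ F × toℕ e ≡ n} (toℕ e , e , e∈ , ≡.refl)
      in e₀ , e₀∈ , λ e′ e′∈ → ≡.subst (ℕ._≤ toℕ e′) (≡.sym toℕ≡) (minimal (toℕ e′) (e′ , e′∈ , ≡.refl))

    Joins-OnEdges : ∀ {F e u v} → e ∈ F → Joins G e u v → OnEdges G u F
    Joins-OnEdges {e = e} e∈ (inj₁ eq) = e , e∈ , inj₁ (≡.cong proj₁ eq)
    Joins-OnEdges {e = e} e∈ (inj₂ eq) = e , e∈ , inj₂ (≡.cong proj₂ eq)

    module _ (ω : Subset (size G)) where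

      -- The second intersection with the edges of `K i` matches the form in which `Pr-𝔼` presents
      -- K[p].
      retained : I → Subgraph G
      retained i = K i ↾ (E (K i) ∩ ω)

      -- One edge is removed from every short cycle; as a vertex lies on few short cycles, few edges are removed at it.
      Removed : Edge → Set
      Removed e = ∃[ F ] F ⊆ ω × Short F × First F e

      H : Subgraph G
      H = record { V = ⊤ ; E = ⟪ (λ e → e ∈ ω × ¬ Removed e) ⟫ ; ends-in-V = λ _ → ∈⊤ , ∈⊤ }

      E-H : ∀ {e} → e ∈ E H → e ∈ ω × ¬ Removed e
      E-H = ∈⟪⟫⁻ (λ e → e ∈ ω × ¬ Removed e)

      H-girth : [ r ] ≤⁺ girth H
      H-girth = girth-bound H λ k (F , F⊆ , cycle) → ℕ.≮⇒≥ λ k<r →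
        let short = k , cycle , k<r
            e , first = First-exists {F} short
        in proj₂ (E-H (F⊆ (proj₁ first))) (F , (λ x∈ → proj₁ (E-H (F⊆ x∈))) , short , first)

      CycleAt : Vertex → Subset (size G) → Set
      CycleAt v F = F ⊆ ω × Short F × OnEdges G v F

      RetainedCycleAt : I → Vertex → Subset (size G) → Set
      RetainedCycleAt i v F = F ⊆ E (retained i) × Short F × OnEdges G v F

      -- A clique that contains the cycle contains its vertex v, so it is one of the at most b
      -- cliques at v. Each of these accounts for at most D cycles once ω is good.
      cycle-in-clique : ∀ {v F} → CycleAt v F → ∃[ i ] i ∈ˡ cliquesAt v × RetainedCycleAt i v F
      cycle-in-clique {v} {F} (F⊆ω , short@(k , cycle , k<r) , on@(e , e∈ , end)) =
        let i , F⊆K = covers F k cycle k<r in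
        i , cliquesAt-∈ (endpoint i (F⊆K e∈) end)
          , (λ x∈ → x∈p∩q⁺ (F⊆K x∈ , x∈p∩q⁺ (F⊆K x∈ , F⊆ω x∈))) , short , on
        where
        endpoint : ∀ i → e ∈ E (K i) → (proj₁ (ends G e) ≡ v ⊎ proj₂ (ends G e) ≡ v) → v ∈ V (K i)
        endpoint i e∈K (inj₁ eq) = ≡.subst (_∈ V (K i)) eq (proj₁ (ends-in-V (K i) e∈K))
        endpoint i e∈K (inj₂ eq) = ≡.subst (_∈ V (K i)) eq (proj₂ (ends-in-V (K i) e∈K))

      cyclesAt : Vertex → List (Subset (size G))
      cyclesAt v = select (CycleAt v) (subsets (size G))

      _~_ : Vertex → Vertex → Set
      u ~ v = ∃[ e ] Removed e × Joins G e u v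

      ~-sym : ∀ {u v} → u ~ v → v ~ u
      ~-sym (e , removed , joins) = e , removed , Joins-sym {e} joins

      open Colouring _~_ (λ {u} {v} → ~-sym {u} {v})

      -- A removed edge from v to u is charged to a cycle whose first edge it is. The cycle
      -- determines its first edge, and that edge together with v determines u.
      degree≤cycles : ∀ v {vs} → Unique vs → degree v vs ℕ.≤ length (cyclesAt v)
      degree≤cycles v {vs} uniq = length-injection {xs = select (v ~_) vs} {cyclesAt v}
        (λ u F → ∃[ e ] First F e × Joins G e v u) (Unique.filter⁺ (λ u → em {v ~ u}) uniq)
        (λ {u} u∈ → let e , (F , F⊆ , short , first) , joins = proj₂ (∈-select⁻ (v ~_) vs u∈) in
          F , ∈-select⁺ (CycleAt v) (∈-subsets F) (F⊆ , short , Joins-OnEdges (proj₁ first) joins) , e , first , joins)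
        λ { (e , first , joins) (e′ , first′ , joins′) → same (First-unique first first′) joins joins′ }
        where
        same : ∀ {e e′ u u′} → e ≡ e′ → Joins G e v u → Joins G e′ v u′ → u ≡ u′
        same {e} ≡.refl joins joins′ = Joins-injective {e} joins joins′

      module _ {D : Carrier} (0≤D : 0# ≤ D)
               (good : ∀ i v → v ∈ V (K i) → fromℕ (shortCyclesThrough r (retained i) v) ≤ D) where

        cycles≤bD : ∀ v → fromℕ (length (cyclesAt v)) ≤ fromℕ b * D
        cycles≤bD v = begin
          fromℕ (length (cyclesAt v))
            ≈⟨ count-select (CycleAt v) all-subsets ⟩
          ∑ all-subsets (λ F → 𝟙 (CycleAt v F))
            ≤⟨ ∑-mono all-subsets (λ F → 𝟙-≤ {CycleAt v F} (∑-nonneg (cliquesAt v) λ i → 𝟙-nonneg (RetainedCycleAt i v F))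
                 λ cycle → let i , i∈ , in-K = cycle-in-clique cycle in 1≤∑𝟙 {P = λ i → RetainedCycleAt i v F} i∈ in-K) ⟩
          ∑ all-subsets (λ F → ∑ (cliquesAt v) (λ i → 𝟙 (RetainedCycleAt i v F)))
            ≈⟨ ∑-swap all-subsets (cliquesAt v) _ ⟩
          ∑ (cliquesAt v) (λ i → ∑ all-subsets (λ F → 𝟙 (RetainedCycleAt i v F)))
            ≤⟨ ∑-mono-∈ (cliquesAt v) (λ i i∈ → ≤-trans (≤-reflexive (sym (count-select (RetainedCycleAt i v) all-subsets)))
                 (good i v (cliquesAt-∋ i∈))) ⟩
          ∑ (cliquesAt v) (λ _ → D)
            ≈⟨ ∑-const (cliquesAt v) D ⟩
          fromℕ (length (cliquesAt v)) * D
            ≤⟨ *-monoˡ-≤ 0≤D (fromℕ-mono (cliquesAt-length v)) ⟩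
          fromℕ b * D
            ∎
          where
          open ≤-Reasoning
          all-subsets = subsets (size G)

        module _ {y : Vertex → Carrier} (0≤y : ∀ v → 0# ≤ y v) {M : Carrier} (0<M : 0# < M)
                 (y≤M : ∀ X → IndependentIn (_∈ ω) X → measure y X ≤ M) where

          χf-bound : ∑ vertices y ≤ (fromℕ b * D + 1#) * M * χf H
          -- b D need not be an integer. The degrees are integers, hence at most its floor Δ, and Δ
          -- + 1 colours still number at most b D + 1.
          χf-bound with floor (fromℕ b * D) (*-nonneg (fromℕ-nonneg b) 0≤D)
          ... | Δ , Δ≤bD , maximal with greedy {suc Δ} (Unique.allFin⁺ (order G)) (degenerate (Unique.allFin⁺ (order G)))
            where
            degenerate : ∀ {vs} → Unique vs → Degenerate (suc Δ) vs
            degenerate []                          = []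
            degenerate {v ∷ vs} (_ ∷ uniq) =
              ℕ.s≤s (ℕ.≤-trans (degree≤cycles v uniq) (maximal _ (cycles≤bD v))) ∷ degenerate uniq
          ... | col , col<Δ , proper = weak-duality 0≤y H (λ _ → ∈⊤) (*-pos 0<bD+1 0<M) λ J ind → ≤-trans
              (colour-classes 0≤y (suc Δ) col (λ v _ → col<Δ (∈ˡ.∈-allFin v)) λ c → y≤M _ (λ {e} → class J ind c {e}))
              (*-monoˡ-≤ (<⇒≤ 0<M) (≤-trans (+-mono-≤ ≤-refl Δ≤bD) (≤-reflexive (+-comm 1# _))))
            where
            0<bD+1 : 0# < fromℕ b * D + 1#
            0<bD+1 = <-≤-trans (+-pos 0<1 (*-nonneg (fromℕ-nonneg b) 0≤D)) (≤-reflexive (+-comm 1# _))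
            class : ∀ J → Independent H J → ∀ c → IndependentIn (_∈ ω) (λ v → v ∈ J × col v ≡ c)
            -- An edge of ω inside the class was either kept, against the independence of J, or
            -- removed, against the colouring.
            class J (_ , ind) c {e} e∈ω ((u∈ , cu) , (v∈ , cv)) with em {Removed e}
            ... | no  kept    = ind (∈⟪⟫⁺ (λ e → e ∈ ω × ¬ Removed e) (e∈ω , kept)) (u∈ , v∈)
            ... | yes removed = proper (∈ˡ.∈-allFin _) (∈ˡ.∈-allFin _) (Joins-irreflexive {e} (ends-Joins {e}))
              (e , removed , ends-Joins {e}) (≡.trans cu (≡.sym cv))

  -- Estimates for the base 1/(1-p).

  module LogBase {p : Carrier} (0<p : 0# < p) (p<1 : p < 1#) where

    a : Carrier
    a = 1# / (1# - p)

    0<1-p : 0# < 1# - p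
    0<1-p = slack< p<1

    a*[1-p] : a * (1# - p) ≈ 1#
    a*[1-p] = /-cancel 1# 0<1-p

    1<a : 1# < a
    1<a = *-cancelʳ-< (<⇒≤ 0<1-p) (<-≤-trans (≤-<-trans (≤-reflexive (*-identityˡ _))
      (unslack< (<-≤-trans 0<p (≤-reflexive (solve 1 (λ p → p := #1 :- (#1 :- p)) refl p))))) (≤-reflexive (sym a*[1-p])))

    0<ln-a : 0# < ln a
    0<ln-a = ln-pos {a} 1<a

    -- The geometric bound says e^p ≤ 1/(1-p); monotonicity of the exponential does the rest.
    p≤ln-a : p ≤ ln a
    p≤ln-a = exp-cancel-≤ {ln a} {p} (<⇒≤ 0<ln-a) (≤-trans {exp p} {a} {exp (ln a)}
      (≤-/ 0<1-p (exp-geometric (<⇒≤ 0<p) p<1))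
      (≤-reflexive (sym {exp (ln a)} {a} (exp-ln {a} (<⇒≤ 1<a)))))

    -- Multiplied by ln a, the condition 4L ≤ d becomes 4 ln u ≤ d ln a, that is, u^4 ≤ a^d, and a
    -- is the inverse of 1 - p.
    sparse : ∀ {u d} → 1# < u → fromℕ 4 * log[ a ] u ≤ fromℕ d → (1# - p) ^ d * u ^ 4 ≤ 1#
    sparse {u} {d} 1<u 4L≤d = begin
      (1# - p) ^ d * u ^ 4   ≤⟨ *-monoʳ-≤ (^-nonneg d (<⇒≤ 0<1-p)) (^-ln-≤ {u} {a} 4 d 1<u 1<a 4ln≤) ⟩
      (1# - p) ^ d * a ^ d   ≈⟨ ^-distrib-* (1# - p) a d ⟨
      ((1# - p) * a) ^ d     ≈⟨ ^-congˡ d (trans (*-comm _ _) a*[1-p]) ⟩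
      1# ^ d                 ≈⟨ 1^ d ⟩
      1#                     ∎
      where
      open ≤-Reasoning
      4ln≤ : fromℕ 4 * ln u ≤ fromℕ d * ln a
      4ln≤ = ≤-trans (≤-reflexive (trans (*-congˡ (sym (/-cancel (ln u) 0<ln-a))) (sym (*-assoc _ _ _))))
        (*-monoˡ-≤ (<⇒≤ 0<ln-a) 4L≤d)

  -- The bound for a single cover.

  module Cover {r : ℕ} (S : SparseCover r) where

    open SparseCover S
    open GraphTheory G using (Vertex; vertices; IndependentIn; measure; optimal-weights; χf≤hf)
    open LogBase 0<p p<1
    open Sparsification r G 𝒦 covers b (proj₁ localOverlap)
      using (K; cliques; cliques-unique; cliques-∈; retained; H-girth; χf-bound) renaming (H to thinned)

    u L : Carrier
    u = fromℕ 2 * exp 1# * t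
    L = log[ a ] u

    0≤bD : 0# ≤ fromℕ b * D
    0≤bD = *-nonneg (fromℕ-nonneg b) 0≤D

    0<bD+1 : 0# < bD+1
    0<bD+1 = <-≤-trans (+-pos 0<1 0≤bD) (≤-reflexive (+-comm 1# _))

    module _ (2≤t : fromℕ 2 ≤ t) where

      1≤2 : 1# ≤ fromℕ 2
      1≤2 = fromℕ-nonneg 1 by refl

      1≤t : 1# ≤ t
      1≤t = ≤-trans 1≤2 2≤t

      0<t : 0# < t
      0<t = <-≤-trans 0<1 1≤t

      2≤u : fromℕ 2 ≤ u
      2≤u = ≤-trans (≤-reflexive (sym (trans (*-identityʳ _) (*-identityʳ _))))
        (*-mono-≤ (*-nonneg (fromℕ-nonneg 2) 0≤1) (≤-trans 0≤1 1≤t) (*-monoʳ-≤ (fromℕ-nonneg 2) (1≤exp 0≤1)) 1≤t)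

      1<u : 1# < u
      1<u = <-≤-trans (unslack< (<-≤-trans 0<1 (≤-reflexive (solve 0 (#1 := #2 :- #1) refl)))) 2≤u

      0<L : 0# < L
      0<L = /-pos (ln-pos {u} 1<u) 0<ln-a

      0≤4L : 0# ≤ fromℕ 4 * L
      0≤4L = *-nonneg (fromℕ-nonneg 4) (<⇒≤ 0<L)

      d : ℕ
      d = proj₁ (ceiling (fromℕ 4 * L) 0≤4L)

      -- This is 2d + 2 at the upper limit d = 4L + 1 that rounding up 4L allows.
      M : Carrier
      M = fromℕ 8 * L + fromℕ 4

      0<M : 0# < M
      0<M = <-≤-trans (+-pos (fromℕ-suc-pos 3) (*-nonneg (fromℕ-nonneg 8) (<⇒≤ 0<L))) (≤-reflexive (+-comm _ _))

      2d+2≤M : fromℕ 2 * fromℕ d + fromℕ 2 ≤ M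
      2d+2≤M = *-nonneg (fromℕ-nonneg 2) (slack (proj₂ (proj₂ (ceiling (fromℕ 4 * L) 0≤4L))))
        by solve 2 (λ d L → #2 :* d :+ #2 :+ #2 :* ((#4 :* L :+ #1) :- d) := #8 :* L :+ #4) refl (fromℕ d) L

      ξ<half : ξ < half
      ξ<half = *-cancelʳ-< (fromℕ-nonneg 2) (≤-<-trans
        (≤-trans (*-monoʳ-≤ (<⇒≤ 0<ξ) (≤-trans (≤-reflexive (sym (*-identityʳ _))) (*-monoʳ-≤ (fromℕ-nonneg 2) 1≤t))) ≤-refl)
        (<-≤-trans (*-monoˡ-< 0<2t ξ<1/2t) (≤-reflexive (trans (/-cancel 1# 0<2t) (sym half*2)))))
        where
        0<2t : 0# < fromℕ 2 * t
        0<2t = *-pos (fromℕ-suc-pos 1) 0<t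

      open Expectation p (<⇒≤ 0<p) (<⇒≤ p<1)

      Overloaded : I → Vertex → Subset (size G) → Set
      Overloaded i v ω = D < fromℕ (shortCyclesThrough r (retained ω i) v)

      verticesOf : I → List Vertex
      verticesOf i = select (_∈ V (K i)) vertices

      overloads : Subset (size G) → Carrier
      overloads ω = ∑ cliques λ i → ∑ (verticesOf i) λ v → 𝟙 (Overloaded i v ω)

      -- The hypothesis concerns a separate random graph for each clique; `Pr-𝔼` expresses all these
      -- probabilities by the common ω, after which linearity suffices.
      overloads-rare : 𝔼 overloads ≤ ξ
      overloads-rare = ≤-trans (≤-reflexive (trans
        (𝔼-∑ cliques (λ i ω → ∑ (verticesOf i) λ v → 𝟙 (Overloaded i v ω)))
        (∑-cong cliques λ i → trans (𝔼-∑ (verticesOf i) (λ v ω → 𝟙 (Overloaded i v ω)))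
          (∑-cong (verticesOf i) λ v → sym (Pr-𝔼 (K i) (λ H → D < fromℕ (shortCyclesThrough r H v)))))))
        (fewBad cliques cliques-unique)

      no-overload : ∀ {ω} → overloads ω < 1# → ∀ i v → v ∈ V (K i) → fromℕ (shortCyclesThrough r (retained ω i) v) ≤ D
      no-overload {ω} few i v v∈ = ≮⇒≥ λ D< → <⇒≱ few (begin
        1#
          ≤⟨ 1≤∑𝟙 {P = λ v → Overloaded i v ω} (∈-select⁺ (_∈ V (K i)) (∈ˡ.∈-allFin v) v∈) D< ⟩
        ∑ (verticesOf i) (λ v → 𝟙 (Overloaded i v ω))
          ≤⟨ term≤∑ {f = λ i → ∑ (verticesOf i) λ v → 𝟙 (Overloaded i v ω)}
               (λ i → ∑-nonneg (verticesOf i) λ v → 𝟙-nonneg (Overloaded i v ω)) (cliques-∈ v∈) ⟩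
        overloads ω
          ∎)
        where open ≤-Reasoning

      bound : t / (bD+1 * M) ≤ hf r G
      bound = fromWeights optimal-weights
        where
        fromWeights : (∃[ y ] (∀ v → 0# ≤ y v) × ∑ vertices y ≈ t × (∀ P → IndependentIn (λ _ → Unit) P → measure y P ≤ 1#)) →
          t / (bD+1 * M) ≤ hf r G
        -- Both kinds of failure are counted together, with mean below 1/2 + 1/2. An outcome with
        -- count below 1 has neither kind, since a failure contributes at least 1.
        fromWeights (y , 0≤y , total , y≤1) = fromOutcome (below-mean (λ ω → failures ω + overloads ω) mean<1)
          where
          module Bound = UnionBound G y 0≤y t u p d

          failures : Subset (size G) → Carrier
          failures = Bound.failures (<⇒≤ 0<p) (<⇒≤ p<1)

          mean<1 : 𝔼 (λ ω → failures ω + overloads ω) < 1#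
          mean<1 = ≤-<-trans (≤-trans (≤-reflexive (𝔼-+ {size G} failures overloads))
              (+-mono-≤ (Bound.failures-rare (<⇒≤ 0<p) (<⇒≤ p<1) 1≤t refl (<⇒≤ 1<u)
                (sparse {u} {d} 1<u (proj₁ (proj₂ (ceiling (fromℕ 4 * L) 0≤4L))))) overloads-rare))
            (unslack< (<-≤-trans (slack< ξ<half) (≤-reflexive (trans (solve 2 (λ h x → h :- x := (h :+ h) :- (h :+ x)) refl half ξ)
              (+-congʳ (trans (solve 1 (λ h → h :+ h := h :* #2) refl half) half*2))))))

          fromOutcome : (∃[ ω ] failures ω + overloads ω < 1#) → t / (bD+1 * M) ≤ hf r G
          fromOutcome (ω , few) = ≤-trans (/-≤ (*-pos 0<bD+1 0<M) (≤-trans (≤-reflexive (sym total))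
              (≤-trans (χf-bound ω 0≤D (no-overload few₂) 0≤y 0<M y≤M) (≤-reflexive (*-comm _ _)))))
            (χf≤hf (thinned ω) (H-girth ω))
            where
            0≤failures : 0# ≤ failures ω
            0≤failures = ∑-nonneg Bound.sizes λ k → ∑-nonneg (Bound.candidates k) λ W → 𝟙-nonneg _
            0≤overloads : 0# ≤ overloads ω
            0≤overloads = ∑-nonneg cliques λ i → ∑-nonneg (verticesOf i) λ v → 𝟙-nonneg _
            few₁ : failures ω < 1#
            few₁ = ≤-<-trans (0≤overloads by refl) few
            few₂ : overloads ω < 1#
            few₂ = ≤-<-trans (0≤failures by +-comm _ _) few
            y≤M : ∀ X → IndependentIn (_∈ ω) X → measure y X ≤ M
            y≤M X ind = ≤-trans (Bound.light-independent (<⇒≤ 0<p) (<⇒≤ p<1) 0<t total y≤1 ω few₁ X ind) 2d+2≤M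

      -- With x = ln t / p ≥ 1 and L ≤ 2x, the factor 8L + 4 is at most (8 * 2 + 4) x.
      scale : Carrier
      scale = fromℕ 8 * fromℕ 2 + fromℕ 4

      module _ (2e≤t : fromℕ 2 * exp 1# ≤ t) where

        e≤t : exp 1# ≤ t
        e≤t = ≤-trans (≤-trans (≤-reflexive (sym (*-identityˡ _))) (*-monoˡ-≤ (<⇒≤ (0<exp 0≤1)) 1≤2)) 2e≤t

        1<t : 1# < t
        1<t = <-≤-trans (unslack< (<-≤-trans 0<1 (≤-reflexive (solve 0 (#1 := (#1 :+ #1) :- #1) refl))))
          (≤-trans (1+x≤exp 0≤1) e≤t)

        0<ln-t : 0# < ln t
        0<ln-t = ln-pos {t} 1<t

        1≤ln-t : 1# ≤ ln t
        1≤ln-t = exp-cancel-≤ {ln t} {1#} (<⇒≤ 0<ln-t) (≤-trans {exp 1#} {t} {exp (ln t)} e≤t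
          (≤-reflexive (sym {exp (ln t)} {t} (exp-ln {t} 1≤t))))

        ln-u≤ : ln u ≤ fromℕ 2 * ln t
        ln-u≤ = exp-cancel-≤ {fromℕ 2 * ln t} {ln u} (*-nonneg (fromℕ-nonneg 2) (<⇒≤ 0<ln-t))
          (≤-trans {exp (ln u)} {u} {exp (fromℕ 2 * ln t)} (≤-reflexive (exp-ln {u} (<⇒≤ 1<u)))
            (≤-trans {u} {t ^ 2} {exp (fromℕ 2 * ln t)}
              (≤-trans (*-monoˡ-≤ (<⇒≤ 0<t) 2e≤t) (≤-reflexive (*-congˡ (sym (*-identityʳ t)))))
              (≤-reflexive (sym {exp (fromℕ 2 * ln t)} {t ^ 2} (exp-ln-^ {t} 1<t 2)))))

        L≤ : L ≤ fromℕ 2 * (ln t / p)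
        L≤ = /-≤ 0<ln-a (≤-trans ln-u≤ (≤-trans (≤-reflexive (trans (*-congˡ (sym (/-cancel (ln t) 0<p))) (sym (*-assoc _ _ _))))
          (*-monoʳ-≤ (*-nonneg (fromℕ-nonneg 2) (<⇒≤ (/-pos 0<ln-t 0<p))) p≤ln-a)))

        M≤ : M ≤ scale * (ln t / p)
        M≤ = ≤-trans (+-mono-≤ (*-monoʳ-≤ (fromℕ-nonneg 8) L≤)
            (≤-trans (≤-reflexive (sym (*-identityʳ _))) (*-monoʳ-≤ (fromℕ-nonneg 4) 1≤x)))
          (≤-reflexive (solve 1 (λ x → #8 :* (#2 :* x) :+ #4 :* x := (#8 :* #2 :+ #4) :* x) refl (ln t / p)))
          where
          1≤x : 1# ≤ ln t / p
          1≤x = ≤-/ 0<p (≤-trans (≤-reflexive (*-identityˡ p)) (≤-trans (<⇒≤ p<1) 1≤ln-t))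

        0<scale : 0# < scale
        0<scale = +-pos (*-pos (fromℕ-suc-pos 7) (fromℕ-suc-pos 1)) (fromℕ-nonneg 4)

        -- The assumption is the little-o condition at ε = 1/(scale m). In the product of m, `bD+1`
        -- and `M` everything except t then cancels.
        large : ∀ {m} → 0# < m → bD+1 ≤ 1# / (scale * m) * ((p * t) / ln t) → m ≤ hf r G
        large {m} 0<m small = ≤-trans (≤-/ (*-pos 0<bD+1 0<M) (begin
          m * (bD+1 * M)
            ≤⟨ *-monoʳ-≤ (<⇒≤ 0<m) (*-mono-≤ (<⇒≤ 0<bD+1) (≤-trans (<⇒≤ 0<M) M≤) small M≤) ⟩
          m * (1# / (scale * m) * ((p * t) / ln t) * (scale * (ln t / p)))
            ≈⟨ rearrange m (1# / (scale * m)) p t (ln t) scale (ln t ⁻¹) (p ⁻¹) ⟩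
          (1# / (scale * m) * (scale * m)) * ((ln t * ln t ⁻¹) * (p * p ⁻¹)) * t
            ≈⟨ *-congʳ (*-cong (/-cancel 1# (*-pos 0<scale 0<m)) (*-cong (*-inverse 0<ln-t) (*-inverse 0<p))) ⟩
          1# * (1# * 1#) * t
            ≈⟨ solve 1 (λ t → #1 :* (#1 :* #1) :* t := t) refl t ⟩
          t ∎)) bound
          where
          open ≤-Reasoning
          rearrange : ∀ m i p t l s l′ p′ → m * (i * ((p * t) * l′) * (s * (l * p′))) ≈ (i * (s * m)) * ((l * l′) * (p * p′)) * t
          rearrange = solve 8 (λ m i p t l s l′ p′ → m :* (i :* ((p :* t) :* l′) :* (s :* (l :* p′)))
            := (i :* (s :* m)) :* ((l :* l′) :* (p :* p′)) :* t) refl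

  -- The limit statement.

  module Asymptotics {r : ℕ} (S : ℕ → SparseCover r) where

    open SparseCover using (G; t; bD+1; p)

    hf→∞ : TendsTo∞ (λ k → t (S k)) → LittleO (λ k → bD+1 (S k)) (λ k → (p (S k) * t (S k)) / ln (t (S k))) →
      TendsTo∞ (λ k → hf r (G (S k)))
    hf→∞ t→∞ little m with archimedean m
    -- The target m may be negative or zero, while ε has to be positive; hence m is replaced by the
    -- positive integer n + 1 above it.
    ... | n , m<n with t→∞ (fromℕ 2 * exp 1#) | little (1# / (c * m⁺)) (/-pos 0<1 (*-pos 0<c 0<m⁺))
      where
      c m⁺ : Carrier
      c  = fromℕ 8 * fromℕ 2 + fromℕ 4
      m⁺ = fromℕ (suc n)
      0<m⁺ : 0# < m⁺
      0<m⁺ = fromℕ-suc-pos n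
      0<c : 0# < c
      0<c = +-pos (*-pos (fromℕ-suc-pos 7) (fromℕ-suc-pos 1)) (fromℕ-nonneg 4)
    ... | N₁ , large-t | N₂ , small = N₁ ℕ.⊔ N₂ , λ k N≤k →
      let 2e≤t = large-t k (ℕ.≤-trans (ℕ.m≤m⊔n N₁ N₂) N≤k)
          2≤t  = ≤-trans (≤-trans (≤-reflexive (sym (*-identityʳ _))) (*-monoʳ-≤ (fromℕ-nonneg 2) (1≤exp 0≤1))) 2e≤t
      in ≤-trans (≤-trans (<⇒≤ m<n) (fromℕ-mono (ℕ.n≤1+n n)))
        (Cover.large (S k) 2≤t 2e≤t (fromℕ-suc-pos n) (small k (ℕ.≤-trans (ℕ.m≤n⊔m N₁ N₂) N≤k)))

theorem9p16 : (em : ExcludedMiddle 0ℓ) (ℝ : CompleteOrderedField) →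
  let open Classical em
      open Reals ℝ
      open SparseCover
  in (r : ℕ) → 4 ℕ.≤ r →
     ((S : SparseCover r) → fromℕ 2 ≤ t S →
        t S / (bD+1 S * (fromℕ 8 * log[ 1# / (1# - p S) ] (fromℕ 2 * e * t S) + fromℕ 4))
          ≤ hf r (G S))
   × ((S : ℕ → SparseCover r) →
        TendsTo∞ (λ k → t (S k)) →
        LittleO (λ k → bD+1 (S k)) (λ k → (p (S k) * t (S k)) / ln (t (S k))) →
        TendsTo∞ (λ k → hf r (G (S k))))
theorem9p16 em ℝ r _ = Cover.bound , Asymptotics.hf→∞
  where open Development em ℝ
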